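{- Let $\alpha=[0;a_1,a_2,\ldots]\in\mathbf{Bad}$ and let $(p_n/q_n)_{n\ge1}$ be the sequence of its convergents. Assume that there exist a positive rational number $x$ and a sequence of finite words $(U_k)_{k\ge1}$ over the positive integers such that, for every $k\ge1$, the sequence of partial quotients $a_1a_2\ldots$ of $\alpha$ begins with the word $U_kU_k^x$, and $|U_{k+1}|>|U_k|$. Set $M=\limsup_{\ell\to+\infty}q_\ell^{1/\ell}$ and $m=\liminf_{\ell\to+\infty}q_\ell^{1/\ell}$. If $$x\ge1\quad\text{or}\quad x>\frac12\cdot\frac{\log M}{\log m},$$ then for every real number $\beta$ equal to $\alpha$ up to a rational homography one has $\inf_{q\ge1}q\cdot\Vert q\alpha\Vert\cdot\Vert q\beta\Vert=0$.
   Context: For a real number $y$, $\Vert y\Vert$ denotes the distance from $y$ to the nearest integer. $\mathbf{Bad}=\{\alpha\in\mathbb{R} : \inf_{q\ge1} q\Vert q\alpha\Vert>0\}$ (equivalently, real numbers with bounded partial quotients). A finite word $W=w_1\ldots w_r$ over the positive integers is identified with the sequence of partial quotients $w_1,\ldots,w_r$; $|W|$ denotes its length. For a positive rational $x$, $W^x$ denotes the word $W^{[x]}W'$, where $W^{[x]}$ is the concatenation of $[x]$ copies of $W$ and $W'$ is the prefix of $W$ of length $\lceil (x-[x])|W|\rceil$. A real number $\beta$ is equal to $\alpha$ up to a rational homography if $\beta=(a\alpha+b)/(c\alpha+d)$ for some integers $a,b,c,d$ with $ad-bc\neq0$. -}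

module Defs where

open import Data.Integer as ℤ using (ℤ; +_)
import Data.Integer.DivMod as ℤ
import Data.Integer.Properties as ℤ
open import Data.List using (List; _++_; applyUpTo; concat; length; replicate; take)
open import Data.Nat as ℕ using (ℕ; zero; suc; NonZero)
import Data.Nat.Properties as ℕ
open import Data.Product using (∃-syntax; _×_; _,_)
open import Data.Rational as ℚ using (ℚ; mkℚ; 0ℚ; 1ℚ; ½; *≤*)
open import Data.Rational.Literals using (fromℤ)
import Data.Rational.Properties as ℚ
open import Data.Rational.Solver using (module +-*-Solver)
open import Data.Sum using (_⊎_; inj₁; inj₂)
open import Relation.Binary.PropositionalEquality using (_≡_; _≢_; refl; sym; trans; cong; subst)
open import Relation.Nullary using (yes; no)

infix  4 _<_ _≤_ _≃_ _#0 _≃_÷_ _⟶_ _BeginsWith_ _IsHomographyOf_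
infixl 6 _+_
infixl 7 _*_
infixr 8 _^_ _^ʷ_
infix  8 -_

IsCauchy : (ℕ → ℚ) → Set
IsCauchy s = ∀ ε → 0ℚ ℚ.< ε →
  ∃[ N ] (∀ m n → N ℕ.≤ m → N ℕ.≤ n → ℚ.∣ s m ℚ.- s n ∣ ℚ.< ε)

-- The Σ-typed Cauchy condition carries a modulus, as usual constructively.
record ℝ : Set where
  constructor mkℝ
  field
    seq    : ℕ → ℚ
    cauchy : IsCauchy seq
open ℝ public

-- Since ℝ is not quotiented, _≃_ is the equality of real numbers.
_≃_ : ℝ → ℝ → Set
x ≃ y = ∀ ε → 0ℚ ℚ.< ε →
  ∃[ N ] (∀ n → N ℕ.≤ n → ℚ.∣ seq x n ℚ.- seq y n ∣ ℚ.< ε)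

_≤_ : ℝ → ℝ → Set
x ≤ y = ∀ ε → 0ℚ ℚ.< ε →
  ∃[ N ] (∀ n → N ℕ.≤ n → seq x n ℚ.≤ seq y n ℚ.+ ε)

_<_ : ℝ → ℝ → Set
x < y = ∃[ ε ] (0ℚ ℚ.< ε ×
  ∃[ N ] (∀ n → N ℕ.≤ n → seq x n ℚ.+ ε ℚ.≤ seq y n))

private
  open +-*-Solver using (solve; _:=_; _:+_; _:*_; _:-_; :-_; con)

  split-- : ∀ a b c d → (a ℚ.+ b) ℚ.- (c ℚ.+ d) ≡ (a ℚ.- c) ℚ.+ (b ℚ.- d)
  split-- = solve 4 (λ a b c d → (a :+ b) :- (c :+ d) := (a :- c) :+ (b :- d)) refl

  split-* : ∀ a b c d → a ℚ.* b ℚ.- c ℚ.* d ≡ a ℚ.* (b ℚ.- d) ℚ.+ d ℚ.* (a ℚ.- c)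
  split-* = solve 4 (λ a b c d → a :* b :- c :* d := a :* (b :- d) :+ d :* (a :- c)) refl

  telescope : ∀ a b c → a ℚ.- c ≡ (a ℚ.- b) ℚ.+ (b ℚ.- c)
  telescope = solve 3 (λ a b c → a :- c := (a :- b) :+ (b :- c)) refl

  swap-- : ∀ a b → a ℚ.- b ≡ ℚ.- (b ℚ.- a)
  swap-- = solve 2 (λ a b → a :- b := :- (b :- a)) refl

  neg-- : ∀ a b → a ℚ.- b ≡ ℚ.- b ℚ.- ℚ.- a
  neg-- = solve 2 (λ a b → a :- b := (:- b) :- (:- a)) refl

  ∣a-b∣≡∣b-a∣ : ∀ a b → ℚ.∣ a ℚ.- b ∣ ≡ ℚ.∣ b ℚ.- a ∣
  ∣a-b∣≡∣b-a∣ a b = trans (cong ℚ.∣_∣ (swap-- a b)) (ℚ.∣-p∣≡∣p∣ (b ℚ.- a))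

  half+half : ∀ ε → ½ ℚ.* ε ℚ.+ ½ ℚ.* ε ≡ ε
  half+half = solve 1 (λ ε → con ½ :* ε :+ con ½ :* ε := ε) refl

  0<half : ∀ {ε} → 0ℚ ℚ.< ε → 0ℚ ℚ.< ½ ℚ.* ε
  0<half {ε} 0<ε = subst (ℚ._< ½ ℚ.* ε) (ℚ.*-zeroʳ ½) (ℚ.*-monoʳ-<-pos ½ {0ℚ} {ε} 0<ε)

  0≤a-b : ∀ {a b} → b ℚ.≤ a → 0ℚ ℚ.≤ a ℚ.- b
  0≤a-b {a} {b} b≤a = subst (ℚ._≤ a ℚ.- b) (ℚ.+-inverseʳ b) (ℚ.+-monoˡ-≤ (ℚ.- b) b≤a)

  a≤∣a∣ : ∀ a → a ℚ.≤ ℚ.∣ a ∣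
  a≤∣a∣ a with ℚ.≤-total 0ℚ a
  ... | inj₁ 0≤a = ℚ.≤-reflexive (sym (ℚ.0≤p⇒∣p∣≡p 0≤a))
  ... | inj₂ a≤0 = ℚ.≤-trans a≤0 (ℚ.0≤∣p∣ a)

  ⊔-left : ∀ {a b n} → a ℕ.⊔ b ℕ.≤ n → a ℕ.≤ n
  ⊔-left {a} {b} = ℕ.m⊔n≤o⇒m≤o a b

  ⊔-right : ∀ a {b n} → a ℕ.⊔ b ℕ.≤ n → b ℕ.≤ n
  ⊔-right a {b} = ℕ.m⊔n≤o⇒n≤o a b

  split-∣∣ : ∀ {a b d e ε} → a ℚ.- b ≡ d ℚ.+ e →
    ℚ.∣ d ∣ ℚ.< ½ ℚ.* ε → ℚ.∣ e ∣ ℚ.< ½ ℚ.* ε → ℚ.∣ a ℚ.- b ∣ ℚ.< ε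
  split-∣∣ {a} {b} {d} {e} {ε} eq d< e< = begin-strict
    ℚ.∣ a ℚ.- b ∣           ≡⟨ cong ℚ.∣_∣ eq ⟩
    ℚ.∣ d ℚ.+ e ∣           ≤⟨ ℚ.∣p+q∣≤∣p∣+∣q∣ d e ⟩
    ℚ.∣ d ∣ ℚ.+ ℚ.∣ e ∣     <⟨ ℚ.+-mono-< d< e< ⟩
    ½ ℚ.* ε ℚ.+ ½ ℚ.* ε     ≡⟨ half+half ε ⟩
    ε                       ∎
    where open ℚ.≤-Reasoning

  bounded : ∀ {s} → IsCauchy s →
    ∃[ B ] (0ℚ ℚ.< B × ∃[ N ] (∀ n → N ℕ.≤ n → ℚ.∣ s n ∣ ℚ.≤ B))
  bounded {s} cs with cs 1ℚ (ℚ.positive⁻¹ 1ℚ)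
  ... | N , h = 1ℚ ℚ.+ ℚ.∣ s N ∣ , 0<B , N , λ n N≤n → begin
    ℚ.∣ s n ∣                             ≡⟨ cong ℚ.∣_∣ (eq (s n) (s N)) ⟩
    ℚ.∣ (s n ℚ.- s N) ℚ.+ s N ∣           ≤⟨ ℚ.∣p+q∣≤∣p∣+∣q∣ (s n ℚ.- s N) (s N) ⟩
    ℚ.∣ s n ℚ.- s N ∣ ℚ.+ ℚ.∣ s N ∣       ≤⟨ ℚ.+-monoˡ-≤ ℚ.∣ s N ∣ (ℚ.<⇒≤ (h n N N≤n ℕ.≤-refl)) ⟩
    1ℚ ℚ.+ ℚ.∣ s N ∣                      ∎
    where
    open ℚ.≤-Reasoning
    eq : ∀ a b → a ≡ (a ℚ.- b) ℚ.+ b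
    eq = solve 2 (λ a b → a := (a :- b) :+ b) refl
    0<B : 0ℚ ℚ.< 1ℚ ℚ.+ ℚ.∣ s N ∣
    0<B = ℚ.+-mono-<-≤ {0ℚ} {1ℚ} {0ℚ} (ℚ.positive⁻¹ 1ℚ) (ℚ.0≤∣p∣ (s N))

  scale : ∀ B → 0ℚ ℚ.< B → ∀ ε → 0ℚ ℚ.< ε →
    ∃[ δ ] (0ℚ ℚ.< δ × (∀ a d → ℚ.∣ a ∣ ℚ.≤ B → ℚ.∣ d ∣ ℚ.< δ → ℚ.∣ a ℚ.* d ∣ ℚ.< ε))
  scale B 0<B ε 0<ε = δ , ℚ.positive⁻¹ δ , λ a d a≤B d<δ → begin-strict
    ℚ.∣ a ℚ.* d ∣       ≡⟨ ℚ.∣p*q∣≡∣p∣*∣q∣ a d ⟩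
    ℚ.∣ a ∣ ℚ.* ℚ.∣ d ∣ ≤⟨ ℚ.*-monoʳ-≤-nonNeg ℚ.∣ d ∣ {{ℚ.∣-∣-nonNeg d}} a≤B ⟩
    B ℚ.* ℚ.∣ d ∣       <⟨ ℚ.*-monoʳ-<-pos B d<δ ⟩
    B ℚ.* δ             ≡⟨ ℚ.*-comm B δ ⟩
    ε ℚ.* B⁻¹ ℚ.* B     ≡⟨ ℚ.*-assoc ε B⁻¹ B ⟩
    ε ℚ.* (B⁻¹ ℚ.* B)   ≡⟨ cong (ε ℚ.*_) (ℚ.*-inverseˡ B) ⟩
    ε ℚ.* 1ℚ            ≡⟨ ℚ.*-identityʳ ε ⟩
    ε                   ∎
    where
    open ℚ.≤-Reasoning
    instance
      B⁺ : ℚ.Positive B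
      B⁺ = ℚ.positive 0<B
      B≢0 : ℚ.NonZero B
      B≢0 = ℚ.pos⇒nonZero B
      ε⁺ : ℚ.Positive ε
      ε⁺ = ℚ.positive 0<ε
    B⁻¹ = ℚ.1/ B
    δ   = ε ℚ.* B⁻¹
    instance
      B⁻¹⁺ : ℚ.Positive B⁻¹
      B⁻¹⁺ = ℚ.1/pos⇒pos B
      δ⁺ : ℚ.Positive δ
      δ⁺ = ℚ.pos*pos⇒pos ε B⁻¹

fromℚ : ℚ → ℝ
fromℚ r = mkℝ (λ _ → r) λ ε 0<ε → 0 , λ _ _ _ _ →
  subst (ℚ._< ε) (sym (cong ℚ.∣_∣ (ℚ.+-inverseʳ r))) 0<ε

fromInt : ℤ → ℝ
fromInt z = fromℚ (fromℤ z)

fromℕ : ℕ → ℝ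
fromℕ n = fromInt (+ n)

_+_ : ℝ → ℝ → ℝ
mkℝ s cs + mkℝ t ct = mkℝ (λ n → s n ℚ.+ t n) c
  where
  c : IsCauchy (λ n → s n ℚ.+ t n)
  c ε 0<ε =
    let N₁ , h₁ = cs (½ ℚ.* ε) (0<half 0<ε)
        N₂ , h₂ = ct (½ ℚ.* ε) (0<half 0<ε)
    in N₁ ℕ.⊔ N₂ , λ m n N≤m N≤n →
      split-∣∣ {s m ℚ.+ t m} {s n ℚ.+ t n} {s m ℚ.- s n} {t m ℚ.- t n}
        (split-- (s m) (t m) (s n) (t n))
        (h₁ m n (⊔-left N≤m) (⊔-left N≤n))
        (h₂ m n (⊔-right N₁ N≤m) (⊔-right N₁ N≤n))

_*_ : ℝ → ℝ → ℝ
mkℝ s cs * mkℝ t ct = mkℝ (λ n → s n ℚ.* t n) c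
  where
  c : IsCauchy (λ n → s n ℚ.* t n)
  c ε 0<ε =
    let B , 0<B , N₁ , b₁ = bounded cs
        C , 0<C , N₂ , b₂ = bounded ct
        δ , 0<δ , k₁ = scale B 0<B (½ ℚ.* ε) (0<half 0<ε)
        η , 0<η , k₂ = scale C 0<C (½ ℚ.* ε) (0<half 0<ε)
        N₃ , h₃ = ct δ 0<δ
        N₄ , h₄ = cs η 0<η
    in N₁ ℕ.⊔ (N₃ ℕ.⊔ (N₂ ℕ.⊔ N₄)) , λ m n N≤m N≤n →
      split-∣∣ {s m ℚ.* t m} {s n ℚ.* t n} {s m ℚ.* (t m ℚ.- t n)} {t n ℚ.* (s m ℚ.- s n)}
        (split-* (s m) (t m) (s n) (t n))
        (k₁ (s m) (t m ℚ.- t n) (b₁ m (⊔-left N≤m))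
            (h₃ m n (⊔-left (⊔-right N₁ N≤m)) (⊔-left (⊔-right N₁ N≤n))))
        (k₂ (t n) (s m ℚ.- s n) (b₂ n (⊔-left (⊔-right N₃ (⊔-right N₁ N≤n))))
            (h₄ m n (⊔-right N₂ (⊔-right N₃ (⊔-right N₁ N≤m)))
                    (⊔-right N₂ (⊔-right N₃ (⊔-right N₁ N≤n)))))

-_ : ℝ → ℝ
- mkℝ s cs = mkℝ (λ n → ℚ.- s n) λ ε 0<ε → let N , h = cs ε 0<ε in
  N , λ m n N≤m N≤n →
    subst (λ d → ℚ.∣ d ∣ ℚ.< ε) (neg-- (s n) (s m)) (h n m N≤n N≤m)

_^_ : ℝ → ℕ → ℝ
x ^ zero  = fromℕ 1
x ^ suc n = x * x ^ n

_#0 : ℝ → Set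
x #0 = x < fromℕ 0 ⊎ fromℕ 0 < x

-- Quotients are taken relationally: x / y is the unique z (up to ≃) with z y = x,
-- for y apart from 0.  Roots, exponentials and logarithms are treated likewise.
_≃_÷_ : ℝ → ℝ → ℝ → Set
z ≃ x ÷ y = y #0 × z * y ≃ x

‖_‖ℚ : ℚ → ℚ
‖ y ‖ℚ = ℚ.∣ y ℚ.- fromℤ (ℚ.floor y) ∣ ℚ.⊓ ℚ.∣ y ℚ.- fromℤ (ℤ.suc (ℚ.floor y)) ∣

private
  fromℤ-mono-≤ : ∀ {i j} → i ℤ.≤ j → fromℤ i ℚ.≤ fromℤ j
  fromℤ-mono-≤ {i} {j} i≤j = *≤* (ℤ.*-monoʳ-≤-nonNeg (+ 1) i≤j)

  floor≤ : ∀ y → fromℤ (ℚ.floor y) ℚ.≤ y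
  floor≤ y@(mkℚ n d-1 _) = *≤* (subst (ℚ.floor y ℤ.* + suc d-1 ℤ.≤_)
    (sym (ℤ.*-identityʳ n)) (ℤ.[n/d]*d≤n n (+ suc d-1)))

  ≤sucFloor : ∀ y → y ℚ.≤ fromℤ (ℤ.suc (ℚ.floor y))
  ≤sucFloor y@(mkℚ n d-1 _) = *≤* (subst (ℤ._≤ ℤ.suc (ℚ.floor y) ℤ.* + suc d-1)
    (sym (ℤ.*-identityʳ n)) (ℤ.<⇒≤ (subst (λ z → n ℤ.< ℤ.suc z ℤ.* + suc d-1)
      (sym (ℤ.div-pos-is-/ℕ n (suc d-1))) (ℤ.n<s[n/ℕd]*d n (suc d-1)))))

‖y‖≤∣y-n∣ : ∀ y n → ‖ y ‖ℚ ℚ.≤ ℚ.∣ y ℚ.- fromℤ n ∣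
‖y‖≤∣y-n∣ y n with n ℤ.≤? ℚ.floor y
... | yes n≤f = begin
  ‖ y ‖ℚ                            ≤⟨ ℚ.p⊓q≤p ℚ.∣ y ℚ.- fromℤ (ℚ.floor y) ∣ ℚ.∣ y ℚ.- fromℤ (ℤ.suc (ℚ.floor y)) ∣ ⟩
  ℚ.∣ y ℚ.- fromℤ (ℚ.floor y) ∣     ≡⟨ ℚ.0≤p⇒∣p∣≡p (0≤a-b (floor≤ y)) ⟩
  y ℚ.- fromℤ (ℚ.floor y)           ≤⟨ ℚ.+-monoʳ-≤ y (ℚ.neg-antimono-≤ (fromℤ-mono-≤ n≤f)) ⟩
  y ℚ.- fromℤ n                     ≤⟨ a≤∣a∣ (y ℚ.- fromℤ n) ⟩
  ℚ.∣ y ℚ.- fromℤ n ∣               ∎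
  where open ℚ.≤-Reasoning
... | no n≰f = begin
  ‖ y ‖ℚ                            ≤⟨ ℚ.p⊓q≤q ℚ.∣ y ℚ.- fromℤ (ℚ.floor y) ∣ ℚ.∣ y ℚ.- fromℤ f⁺ ∣ ⟩
  ℚ.∣ y ℚ.- fromℤ f⁺ ∣              ≡⟨ ∣a-b∣≡∣b-a∣ y (fromℤ f⁺) ⟩
  ℚ.∣ fromℤ f⁺ ℚ.- y ∣              ≡⟨ ℚ.0≤p⇒∣p∣≡p (0≤a-b (≤sucFloor y)) ⟩
  fromℤ f⁺ ℚ.- y                    ≤⟨ ℚ.+-monoˡ-≤ (ℚ.- y) (fromℤ-mono-≤ (ℤ.i<j⇒suc[i]≤j (ℤ.≰⇒> n≰f))) ⟩
  fromℤ n ℚ.- y                     ≤⟨ a≤∣a∣ (fromℤ n ℚ.- y) ⟩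
  ℚ.∣ fromℤ n ℚ.- y ∣               ≡⟨ ∣a-b∣≡∣b-a∣ (fromℤ n) y ⟩
  ℚ.∣ y ℚ.- fromℤ n ∣               ∎
  where
  open ℚ.≤-Reasoning
  f⁺ = ℤ.suc (ℚ.floor y)

‖z‖-attained : ∀ z → ∃[ n ] ‖ z ‖ℚ ≡ ℚ.∣ z ℚ.- fromℤ n ∣
‖z‖-attained z with ℚ.⊓-sel ℚ.∣ z ℚ.- fromℤ (ℚ.floor z) ∣ ℚ.∣ z ℚ.- fromℤ (ℤ.suc (ℚ.floor z)) ∣
... | inj₁ eq = _ , eq
... | inj₂ eq = _ , eq

private
  ‖y‖-‖z‖≤∣y-z∣ : ∀ y z → ‖ y ‖ℚ ℚ.- ‖ z ‖ℚ ℚ.≤ ℚ.∣ y ℚ.- z ∣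
  ‖y‖-‖z‖≤∣y-z∣ y z with ‖z‖-attained z
  ... | n , ‖z‖≡ = begin
    ‖ y ‖ℚ ℚ.- ‖ z ‖ℚ
      ≤⟨ ℚ.+-monoˡ-≤ (ℚ.- ‖ z ‖ℚ) (‖y‖≤∣y-n∣ y n) ⟩
    ℚ.∣ y ℚ.- fromℤ n ∣ ℚ.- ‖ z ‖ℚ
      ≡⟨ cong (λ t → ℚ.∣ t ∣ ℚ.- ‖ z ‖ℚ) (telescope y z (fromℤ n)) ⟩
    ℚ.∣ (y ℚ.- z) ℚ.+ (z ℚ.- fromℤ n) ∣ ℚ.- ‖ z ‖ℚ
      ≤⟨ ℚ.+-monoˡ-≤ (ℚ.- ‖ z ‖ℚ) (ℚ.∣p+q∣≤∣p∣+∣q∣ (y ℚ.- z) (z ℚ.- fromℤ n)) ⟩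
    ℚ.∣ y ℚ.- z ∣ ℚ.+ ℚ.∣ z ℚ.- fromℤ n ∣ ℚ.- ‖ z ‖ℚ
      ≡⟨ cong (λ t → ℚ.∣ y ℚ.- z ∣ ℚ.+ t ℚ.- ‖ z ‖ℚ) (sym ‖z‖≡) ⟩
    ℚ.∣ y ℚ.- z ∣ ℚ.+ ‖ z ‖ℚ ℚ.- ‖ z ‖ℚ
      ≡⟨ cancel ℚ.∣ y ℚ.- z ∣ ‖ z ‖ℚ ⟩
    ℚ.∣ y ℚ.- z ∣ ∎
    where
    open ℚ.≤-Reasoning
    cancel : ∀ a b → a ℚ.+ b ℚ.- b ≡ a
    cancel = solve 2 (λ a b → a :+ b :- b := a) refl

  ‖‖-lipschitz : ∀ y z → ℚ.∣ ‖ y ‖ℚ ℚ.- ‖ z ‖ℚ ∣ ℚ.≤ ℚ.∣ y ℚ.- z ∣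
  ‖‖-lipschitz y z with ℚ.∣p∣≡p∨∣p∣≡-p (‖ y ‖ℚ ℚ.- ‖ z ‖ℚ)
  ... | inj₁ eq = subst (ℚ._≤ ℚ.∣ y ℚ.- z ∣) (sym eq) (‖y‖-‖z‖≤∣y-z∣ y z)
  ... | inj₂ eq = begin
    ℚ.∣ ‖ y ‖ℚ ℚ.- ‖ z ‖ℚ ∣   ≡⟨ eq ⟩
    ℚ.- (‖ y ‖ℚ ℚ.- ‖ z ‖ℚ)   ≡⟨ swap-- ‖ z ‖ℚ ‖ y ‖ℚ ⟨
    ‖ z ‖ℚ ℚ.- ‖ y ‖ℚ         ≤⟨ ‖y‖-‖z‖≤∣y-z∣ z y ⟩
    ℚ.∣ z ℚ.- y ∣             ≡⟨ ∣a-b∣≡∣b-a∣ z y ⟩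
    ℚ.∣ y ℚ.- z ∣             ∎
    where open ℚ.≤-Reasoning

-- ‖_‖ℚ is 1-Lipschitz, so it extends to ℝ termwise.
‖_‖ : ℝ → ℝ
‖ mkℝ s cs ‖ = mkℝ (λ n → ‖ s n ‖ℚ) λ ε 0<ε → let N , h = cs ε 0<ε in
  N , λ m n N≤m N≤n → ℚ.≤-<-trans (‖‖-lipschitz (s m) (s n)) (h m n N≤m N≤n)

_⟶_ : (ℕ → ℝ) → ℝ → Set
f ⟶ L = ∀ ε → 0ℚ ℚ.< ε →
  ∃[ N ] (∀ n → N ℕ.≤ n → (L + - fromℚ ε < f n) × (f n < L + fromℚ ε))

-- Tail suprema need not exist constructively, hence the ε-form of limsup and liminf.
IsLimsup : (ℕ → ℝ) → ℝ → Set
IsLimsup f L = ∀ ε → 0ℚ ℚ.< ε →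
  (∃[ N ] (∀ n → N ℕ.≤ n → f n < L + fromℚ ε)) ×
  (∀ N → ∃[ n ] (N ℕ.≤ n × L + - fromℚ ε < f n))

IsLiminf : (ℕ → ℝ) → ℝ → Set
IsLiminf f L = ∀ ε → 0ℚ ℚ.< ε →
  (∃[ N ] (∀ n → N ℕ.≤ n → L + - fromℚ ε < f n)) ×
  (∀ N → ∃[ n ] (N ℕ.≤ n × f n < L + fromℚ ε))

LowerBound≥1 : (ℕ → ℝ) → ℝ → Set
LowerBound≥1 f c = ∀ q → 1 ℕ.≤ q → c ≤ f q

IsInf≥1 : (ℕ → ℝ) → ℝ → Set
IsInf≥1 f c = LowerBound≥1 f c ×
  (∀ ε → 0ℚ ℚ.< ε → ∃[ q ] (1 ℕ.≤ q × f q < c + fromℚ ε))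

-- The infimum being positive is expressed by a positive lower bound, since an
-- infimum need not exist constructively.
Bad : ℝ → Set
Bad α = ∃[ c ] (fromℕ 0 < c × LowerBound≥1 (λ q → fromℕ q * ‖ fromℕ q * α ‖) c)

IsRoot : ℕ → ℝ → ℝ → Set
IsRoot n x r = fromℕ 0 ≤ r × r ^ n ≃ x

-- Euler's limit exp y = lim (1 + y / n) ^ n, with n = k + 1
IsExp : ℝ → ℝ → Set
IsExp y e = (λ k → (fromℕ 1 + y * fromℚ (+ 1 ℚ./ suc k)) ^ suc k) ⟶ e

IsLog : ℝ → ℝ → Set
IsLog x y = IsExp y x

IsLogRatio : ℝ → ℝ → ℝ → Set
IsLogRatio M m t = ∃[ u ] ∃[ v ] (IsLog M u × IsLog m v × t ≃ u ÷ v)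

-- For [0; a 1, a 2, …]; the value a 0 plays no role.
num den : (ℕ → ℕ) → ℕ → ℕ
num a 0             = 0
num a 1             = 1
num a (suc (suc n)) = a (suc (suc n)) ℕ.* num a (suc n) ℕ.+ num a n
den a 0             = 1
den a 1             = a 1
den a (suc (suc n)) = a (suc (suc n)) ℕ.* den a (suc n) ℕ.+ den a n

PartialQuotients : (ℕ → ℕ) → Set
PartialQuotients a = ∀ i → 1 ℕ.≤ i → NonZero (a i)

den-nonZero : ∀ {a} → PartialQuotients a → ∀ n → NonZero (den a n)
den-nonZero a⁺ 0 = _
den-nonZero a⁺ 1 = a⁺ 1 (ℕ.s≤s ℕ.z≤n)
den-nonZero {a} a⁺ (suc (suc n)) = ℕ.>-nonZero (ℕ.m≤n⇒m≤o+n _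
  (ℕ.>-nonZero⁻¹ (den a n) {{den-nonZero a⁺ n}}))

convergent : ∀ a → PartialQuotients a → ℕ → ℚ
convergent a a⁺ n = ℚ._/_ (+ num a n) (den a n) {{den-nonZero a⁺ n}}

_IsCF[_,_] : ℝ → ∀ a → PartialQuotients a → Set
α IsCF[ a , a⁺ ] = (λ n → fromℚ (convergent a a⁺ n)) ⟶ α

-- Meant for x ≥ 0, so that ∣_∣ only converts from ℤ to ℕ.
_^ʷ_ : List ℕ → ℚ → List ℕ
W ^ʷ x = concat (replicate ℤ.∣ ℚ.floor x ∣ W)
      ++ take ℤ.∣ ℚ.ceiling ((x ℚ.- fromℤ (ℚ.floor x)) ℚ.* fromℤ (+ length W)) ∣ W

_BeginsWith_ : (ℕ → ℕ) → List ℕ → Set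
a BeginsWith W = applyUpTo (λ i → a (suc i)) (length W) ≡ W

_IsHomographyOf_ : ℝ → ℝ → Set
β IsHomographyOf α = ∃[ a ] ∃[ b ] ∃[ c ] ∃[ d ]
  (a ℤ.* d ℤ.- b ℤ.* c ≢ + 0 ×
   β ≃ fromInt a * α + fromInt b ÷ (fromInt c * α + fromInt d))

-- Let r = |U_k|, s = |U_k^x| and n = r + s. Since a_{r+i} = a_i for i ≤ s, the integral polynomial
-- P_k(X) = q_{r-1} X² + (q_r - p_{r-1}) X - p_r satisfies |P_k(α)| ≪ q_r / q_n². For β = (aα + b)/(cα + d),
-- a multiple of P_k(α) is, up to the factor cα + d, an integral linear form u + vα + wβ with coefficients
-- ≪ q_r and v ≠ 0. The pigeonhole principle on the q with uq + w p₂ divisible by v gives, for each R,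
-- some q ≤ R|v| with ‖qβ‖ ≪ 1/R and |v| ‖qα‖ ≤ q |u + vα + wβ| + |w| ‖qβ‖, so that
-- q ‖qα‖ ‖qβ‖ ≪ R |v| |u + vα + wβ| + |w| / R. Taking R a large multiple of q_r, this is small as soon as
-- q_r³ / q_n² is; and q_n ≥ q_r q_s, so q_r / q_s² → 0 suffices. If x ≥ 1 then q_s ≥ q_r; otherwise
-- q_r ≤ (M + ε)^r and q_s ≥ (m - ε)^s with s ≥ x r, and M < m^{2x}.
module Submission where

open import Data.Empty using (⊥; ⊥-elim)
open import Data.Integer as ℤ using (ℤ; +_; -[1+_])
import Data.Integer.DivMod as ℤ
import Data.Integer.Properties as ℤ
import Data.Integer.Tactic.RingSolver as ℤSolver
open import Data.List using (List; []; _∷_; _++_; applyUpTo; concat; drop; length; replicate; take)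
open import Data.List.Properties using (∷-injective; ++-assoc; ++-identityʳ; length-++; length-take; take++drop≡id)
open import Data.List.Relation.Unary.All using (All)
open import Data.Maybe using (Maybe; just; nothing)
open import Data.Nat as ℕ using (ℕ; zero; suc)
import Data.Nat.Properties as ℕ
import Data.Nat.Tactic.RingSolver as ℕSolver
open import Data.Product using (∃-syntax; _×_; _,_; proj₁; proj₂)
open import Data.Rational as ℚ using (ℚ; 0ℚ; 1ℚ; ½)
open import Data.Sum using (_⊎_; inj₁; inj₂)
open import Relation.Binary.PropositionalEquality
open import Relation.Nullary using (¬_; yes; no; contradiction)

-- P_k comes from the map T x = (p_r + p_(r-1) x) / (q_r + q_(r-1) x), which puts the word U_k in
-- front of a continued fraction: P_k(x) = 0 says T x = x, so its positive root is the purely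
-- periodic number that approximates α. This root is never formed. Each convergent c of α is
-- compared with T c instead. Two features of constructive real numbers shape the rest. They have no
-- computable floor, so the pigeonhole principle is applied to a rational term y of β, and every
-- estimate is made on rational terms of large index. Logarithms are given only through Euler's
-- limit (1 + y / n)^n. For x = X / Y the second hypothesis reads Y log M < 2 X log m once log m >
-- 0; Bernoulli's inequality carries it over, at one finite n, to M^Y < m^(2X) with rational values
-- in place of M and m. Neither a functional equation nor a fractional power occurs. The quotient of
-- logarithms only says that log m is apart from 0, so log m < 0 has to be refuted, by m ≥ 1.

module Continuants where

  -- Continuants and the fixed-point estimate for a repeated prefix

  open import Data.Nat
  open import Data.Nat.Properties
  open import Data.Nat.Tactic.RingSolver using (solve-∀)
  open import Defs using (num; den; PartialQuotients; den-nonZero)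

  shift : ℕ → (ℕ → ℕ) → ℕ → ℕ
  shift s a i = a (i + s)

  -- What `num a` and `den a` share, so that one splitting lemma serves both.
  Recurrent : (ℕ → ℕ) → (ℕ → ℕ) → Set
  Recurrent a f = ∀ n → f (2 + n) ≡ a (2 + n) * f (1 + n) + f n

  num-recurrent : ∀ a → Recurrent a (num a)
  num-recurrent a n = refl

  den-recurrent : ∀ a → Recurrent a (den a)
  den-recurrent a n = refl

  -- The solutions of the shifted recurrence form a plane, spanned by `den` and `num` of the shifted
  -- sequence with their initial values 1, a and 0, 1. This is one row of the usual product of
  -- continuant matrices.
  recurrent-split : ∀ a f → Recurrent a f → ∀ s N →
    f (N + suc s) ≡ f (suc s) * den (shift (suc s) a) N + f s * num (shift (suc s) a) N
  recurrent-split a f rec s 0 = lemma (f (suc s)) (f s)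
    where
    lemma : ∀ x y → x ≡ x * 1 + y * 0
    lemma = solve-∀
  recurrent-split a f rec s 1 = trans (rec s) (lemma (a (2 + s)) (f (suc s)) (f s))
    where
    lemma : ∀ a x y → a * x + y ≡ x * a + y * 1
    lemma = solve-∀
  recurrent-split a f rec s (suc (suc N)) = begin
    f (2 + (N + suc s))
      ≡⟨ rec (N + suc s) ⟩
    aₙ * f (1 + N + suc s) + f (N + suc s)
      ≡⟨ cong₂ (λ x y → aₙ * x + y) (recurrent-split a f rec s (suc N)) (recurrent-split a f rec s N) ⟩
    aₙ * (f (suc s) * d (suc N) + f s * n (suc N)) + (f (suc s) * d N + f s * n N)
      ≡⟨ lemma aₙ (f (suc s)) (f s) (d (suc N)) (n (suc N)) (d N) (n N) ⟩
    f (suc s) * d (2 + N) + f s * n (2 + N) ∎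
    where
    open ≡-Reasoning
    aₙ = a (2 + (N + suc s))
    d  = den (shift (suc s) a)
    n  = num (shift (suc s) a)
    lemma : ∀ a x y d₁ n₁ d₀ n₀ → a * (x * d₁ + y * n₁) + (x * d₀ + y * n₀)
                                ≡ x * (a * d₁ + d₀) + y * (a * n₁ + n₀)
    lemma = solve-∀

  AgreeUpTo : ℕ → (ℕ → ℕ) → (ℕ → ℕ) → Set
  AgreeUpTo N a b = ∀ i → 1 ≤ i → i ≤ N → a i ≡ b i

  private
    weaken : ∀ {a b M N} → M ≤ N → AgreeUpTo N a b → AgreeUpTo M a b
    weaken M≤N h i 1≤i i≤M = h i 1≤i (≤-trans i≤M M≤N)

  num-cong : ∀ {a b} N → AgreeUpTo N a b → num a N ≡ num b N
  num-cong 0 h = refl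
  num-cong 1 h = refl
  num-cong (suc (suc N)) h = cong₂ _+_
    (cong₂ _*_ (h (2 + N) (s≤s z≤n) ≤-refl) (num-cong (suc N) (weaken (n≤1+n _) h)))
    (num-cong N (weaken (m≤n+m N 2) h))

  den-cong : ∀ {a b} N → AgreeUpTo N a b → den a N ≡ den b N
  den-cong 0 h = refl
  den-cong 1 h = h 1 ≤-refl ≤-refl
  den-cong (suc (suc N)) h = cong₂ _+_
    (cong₂ _*_ (h (2 + N) (s≤s z≤n) ≤-refl) (den-cong (suc N) (weaken (n≤1+n _) h)))
    (den-cong N (weaken (m≤n+m N 2) h))

  shift-partialQuotients : ∀ {a} s → PartialQuotients a → PartialQuotients (shift s a)
  shift-partialQuotients s a⁺ i 1≤i = a⁺ (i + s) (≤-trans 1≤i (m≤m+n i s))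

  module _ {a} (a⁺ : PartialQuotients a) where

    1≤a : ∀ i → 1 ≤ a (suc i)
    1≤a i = >-nonZero⁻¹ (a (suc i)) {{a⁺ (suc i) (s≤s z≤n)}}

    1≤den : ∀ n → 1 ≤ den a n
    1≤den n = >-nonZero⁻¹ (den a n) {{den-nonZero a⁺ n}}

    num≤den : ∀ n → num a n ≤ den a n
    num≤den 0 = z≤n
    num≤den 1 = 1≤a 0
    num≤den (suc (suc n)) = +-mono-≤ (*-monoʳ-≤ (a (2 + n)) (num≤den (suc n))) (num≤den n)

    den-step : ∀ n → den a (suc n) + den a n ≤ den a (2 + n)
    den-step n = +-monoˡ-≤ (den a n)
      (≤-trans (≤-reflexive (sym (*-identityˡ _))) (*-monoˡ-≤ (den a (suc n)) (1≤a (suc n))))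

    den-≤-suc : ∀ n → den a n ≤ den a (suc n)
    den-≤-suc 0 = 1≤a 0
    den-≤-suc (suc n) = ≤-trans (m≤m+n (den a (suc n)) (den a n)) (den-step n)

    den-mono-≤ : ∀ {m n} → m ≤ n → den a m ≤ den a n
    den-mono-≤ {m} {n} m≤n with m≤n⇒m<n∨m≡n m≤n
    ... | inj₂ refl = ≤-refl
    ... | inj₁ (s≤s {n = k} m≤k) = ≤-trans (den-mono-≤ m≤k) (den-≤-suc k)

    -- Linear growth suffices: it only has to beat a constant in the case x ≥ 1.
    n≤den : ∀ n → n ≤ den a n
    n≤den 0 = z≤n
    n≤den 1 = 1≤den 1
    n≤den (suc (suc n)) = begin
      suc (suc n)               ≡⟨ +-comm 1 (suc n) ⟩
      suc n + 1                 ≤⟨ +-mono-≤ (n≤den (suc n)) (1≤den n) ⟩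
      den a (suc n) + den a n   ≤⟨ den-step n ⟩
      den a (2 + n)             ∎
      where open ≤-Reasoning

  ∣det∣≡1 : ∀ a n →
    ℤ.∣ + num a (suc n) ℤ.* + den a n ℤ.- + num a n ℤ.* + den a (suc n) ∣ ≡ 1
  ∣det∣≡1 a 0 = cong ℤ.∣_∣ (lemma (+ a 1))
    where
    lemma : ∀ x → + 1 ℤ.* + 1 ℤ.- + 0 ℤ.* x ≡ + 1
    lemma = ℤSolver.solve-∀
  ∣det∣≡1 a (suc n) = begin
    ℤ.∣ + num a (2 + n) ℤ.* + q₁ ℤ.- + p₁ ℤ.* + den a (2 + n) ∣
      ≡⟨ cong₂ (λ x y → ℤ.∣ x ℤ.* + q₁ ℤ.- + p₁ ℤ.* y ∣) (cast p₁ p₀) (cast q₁ q₀) ⟩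
    ℤ.∣ (+ x ℤ.* + p₁ ℤ.+ + p₀) ℤ.* + q₁ ℤ.- + p₁ ℤ.* (+ x ℤ.* + q₁ ℤ.+ + q₀) ∣
      ≡⟨ cong ℤ.∣_∣ (lemma (+ x) (+ p₁) (+ p₀) (+ q₁) (+ q₀)) ⟩
    ℤ.∣ ℤ.- (+ p₁ ℤ.* + q₀ ℤ.- + p₀ ℤ.* + q₁) ∣
      ≡⟨ ℤ.∣-i∣≡∣i∣ (+ p₁ ℤ.* + q₀ ℤ.- + p₀ ℤ.* + q₁) ⟩
    ℤ.∣ + p₁ ℤ.* + q₀ ℤ.- + p₀ ℤ.* + q₁ ∣
      ≡⟨ ∣det∣≡1 a n ⟩
    1 ∎
    where
    open ≡-Reasoning
    x  = a (2 + n)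
    p₁ = num a (1 + n)
    p₀ = num a n
    q₁ = den a (1 + n)
    q₀ = den a n
    cast : ∀ y z → + (x * y + z) ≡ + x ℤ.* + y ℤ.+ + z
    cast y z = trans (ℤ.pos-+ (x * y) z) (cong (λ w → w ℤ.+ + z) (ℤ.pos-* x y))
    lemma : ∀ x p₁ p₀ q₁ q₀ → (x ℤ.* p₁ ℤ.+ p₀) ℤ.* q₁ ℤ.- p₁ ℤ.* (x ℤ.* q₁ ℤ.+ q₀)
                            ≡ ℤ.- (p₁ ℤ.* q₀ ℤ.- p₀ ℤ.* q₁)
    lemma = ℤSolver.solve-∀

  ∣m-n∣≤o : ∀ {m n o} → m ≤ o → n ≤ o → ℤ.∣ + m ℤ.- + n ∣ ≤ o
  ∣m-n∣≤o {m} {n} {o} m≤o n≤o = subst (_≤ o) (sym (eq m n)) (≤-trans (∣m-n∣≤m⊔n m n) (⊔-lub m≤o n≤o))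
    where
    eq : ∀ m n → ℤ.∣ + m ℤ.- + n ∣ ≡ ∣ m - n ∣
    eq m n with ≤-total m n
    ... | inj₁ m≤n = trans (cong ℤ.∣_∣ (ℤ.m-n≡m⊖n m n)) (trans (ℤ.∣⊖∣-≤ m≤n) (sym (m≤n⇒∣m-n∣≡n∸m m≤n)))
    ... | inj₂ n≤m = trans (cong ℤ.∣_∣ (trans (ℤ.m-n≡m⊖n m n) (ℤ.⊖-≥ n≤m))) (sym (m≤n⇒∣n-m∣≡n∸m n≤m))

  private
    cast₂ : ∀ x y z w → + (x * y + z * w) ≡ + x ℤ.* + y ℤ.+ + z ℤ.* + w
    cast₂ x y z w = trans (ℤ.pos-+ (x * y) (z * w)) (cong₂ ℤ._+_ (ℤ.pos-* x y) (ℤ.pos-* z w))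

    -- Multiplicativity of the 2 × 2 determinant. The last factor is kept as a difference of two
    -- naturals, the form that `∣m-n∣≤o` bounds.
    det-factor : ∀ p p′ q q′ A B A′ B′ →
      + (p * A + p′ * B) ℤ.* + (q * A′ + q′ * B′) ℤ.- + (q * A + q′ * B) ℤ.* + (p * A′ + p′ * B′)
        ≡ (+ p ℤ.* + q′ ℤ.- + p′ ℤ.* + q) ℤ.* (+ (A * B′) ℤ.- + (A′ * B))
    det-factor p p′ q q′ A B A′ B′ = trans
      (cong₂ ℤ._-_ (cong₂ ℤ._*_ (cast₂ p A p′ B) (cast₂ q A′ q′ B′))
                   (cong₂ ℤ._*_ (cast₂ q A q′ B) (cast₂ p A′ p′ B′)))
      (trans (lemma (+ p) (+ p′) (+ q) (+ q′) (+ A) (+ B) (+ A′) (+ B′))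
        (cong (λ z → (+ p ℤ.* + q′ ℤ.- + p′ ℤ.* + q) ℤ.* z)
          (cong₂ ℤ._-_ (sym (ℤ.pos-* A B′)) (sym (ℤ.pos-* A′ B)))))
      where
      lemma : ∀ p p′ q q′ A B A′ B′ →
        (p ℤ.* A ℤ.+ p′ ℤ.* B) ℤ.* (q ℤ.* A′ ℤ.+ q′ ℤ.* B′)
          ℤ.- (q ℤ.* A ℤ.+ q′ ℤ.* B) ℤ.* (p ℤ.* A′ ℤ.+ p′ ℤ.* B′)
          ≡ (p ℤ.* q′ ℤ.- p′ ℤ.* q) ℤ.* (A ℤ.* B′ ℤ.- A′ ℤ.* B)
      lemma = ℤSolver.solve-∀

  module _ {a} (a⁺ : PartialQuotients a) (r′ s′ : ℕ)
           (periodic : AgreeUpTo (suc s′) (shift (suc r′) a) a) where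

    private
      r s n n′ : ℕ
      r = suc r′
      s = suc s′
      n′ = s′ + r
      n = s + r

      -- The sequence shifted by r agrees with `a` on its first s terms, so the continuants of the
      -- shift in `recurrent-split` may be read from `a` itself.
      split-period : ∀ f → Recurrent a f → ∀ j → j ≤ s → f (j + r) ≡ f r * den a j + f r′ * num a j
      split-period f rec j j≤s = trans (recurrent-split a f rec r′ j)
        (cong₂ (λ x y → f r * x + f r′ * y) (den-cong j (weaken j≤s periodic)) (num-cong j (weaken j≤s periodic)))

    den-superMultiplicative : den a r * den a s ≤ den a n
    den-superMultiplicative = ≤-trans (m≤m+n _ _) (≤-reflexive (sym (split-period (den a) (den-recurrent a) s ≤-refl)))

    -- With T x = (p_r + p_r′ x) / (q_r + q_r′ x), the left-hand side measures the distance
    -- from c = num a N / den a N to T c: both start with the first n partial quotients.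
    fixedPoint-bound : ∀ K → let N = K + n in
      den a n * den a n * ℤ.∣ + num a N ℤ.* + (den a r * den a N + den a r′ * num a N)
                         ℤ.- + den a N ℤ.* + (num a r * den a N + num a r′ * num a N) ∣
        ≤ 2 * den a r * (den a N * den a N)
    fixedPoint-bound K = begin
      qₙ * qₙ * ℤ.∣ + num a N ℤ.* + S ℤ.- + den a N ℤ.* + T ∣
        ≡⟨ cong (λ z → qₙ * qₙ * ℤ.∣ z ∣) (cong₂ ℤ._-_
             (cong₂ ℤ._*_ (cong +_ pN) (cong +_ S≡)) (cong₂ ℤ._*_ (cong +_ qN) (cong +_ T≡))) ⟩
      qₙ * qₙ * ℤ.∣ + (pₙ * A + pₙ′ * B) ℤ.* + (qₙ * A′ + qₙ′ * B′)
                ℤ.- + (qₙ * A + qₙ′ * B) ℤ.* + (pₙ * A′ + pₙ′ * B′) ∣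
        ≡⟨ cong (λ z → qₙ * qₙ * ℤ.∣ z ∣) (det-factor pₙ pₙ′ qₙ qₙ′ A B A′ B′) ⟩
      qₙ * qₙ * ℤ.∣ (+ pₙ ℤ.* + qₙ′ ℤ.- + pₙ′ ℤ.* + qₙ) ℤ.* (+ (A * B′) ℤ.- + (A′ * B)) ∣
        ≡⟨ cong (qₙ * qₙ *_) (trans (ℤ.abs-* (+ pₙ ℤ.* + qₙ′ ℤ.- + pₙ′ ℤ.* + qₙ) (+ (A * B′) ℤ.- + (A′ * B)))
                                    (cong (_* ℤ.∣ + (A * B′) ℤ.- + (A′ * B) ∣) (∣det∣≡1 a n′))) ⟩
      qₙ * qₙ * (1 * ℤ.∣ + (A * B′) ℤ.- + (A′ * B) ∣)
        -- Both products lie between 0 and A A′, so no cancellation between them is needed.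
        ≤⟨ *-monoʳ-≤ (qₙ * qₙ) (*-monoʳ-≤ 1 (∣m-n∣≤o AB′≤ A′B≤)) ⟩
      qₙ * qₙ * (1 * (A * A′))
        ≡⟨ regroup qₙ A A′ ⟩
      qₙ * A * (qₙ * A′)
        ≤⟨ *-mono-≤ qₙA≤ qₙA′≤ ⟩
      den a N * S
        ≤⟨ *-monoʳ-≤ (den a N) (+-monoʳ-≤ (den a r * den a N)
             (*-mono-≤ (den-≤-suc a⁺ r′) (num≤den a⁺ N))) ⟩
      den a N * (den a r * den a N + den a r * den a N)
        ≡⟨ regroup₂ (den a N) (den a r) ⟩
      2 * den a r * (den a N * den a N) ∎
      where
      open ≤-Reasoning
      N = K + n
      pₙ  = num a n
      pₙ′ = num a n′
      qₙ  = den a n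
      qₙ′ = den a n′
      A  = den (shift n a) K
      B  = num (shift n a) K
      A′ = den (shift s a) (K + r)
      B′ = num (shift s a) (K + r)
      S  = den a r * den a N + den a r′ * num a N
      T  = num a r * den a N + num a r′ * num a N
      pN : num a N ≡ pₙ * A + pₙ′ * B
      pN = recurrent-split a (num a) (num-recurrent a) n′ K
      qN : den a N ≡ qₙ * A + qₙ′ * B
      qN = recurrent-split a (den a) (den-recurrent a) n′ K
      N≡ : N ≡ K + r + s
      N≡ = trans (cong (λ m → K + m) (+-comm s r)) (sym (+-assoc K r s))
      split-s : ∀ f → Recurrent a f → f N ≡ f s * A′ + f s′ * B′
      split-s f rec = trans (cong f N≡) (recurrent-split a f rec s′ (K + r))
      -- T prepends the first r partial quotients. Followed by the first s ones they are the first
      -- n, so T c splits at n, with the tail of c after s as its remainder.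
      extend : ∀ f → Recurrent a f →
        f r * den a N + f r′ * num a N ≡ f n * A′ + f n′ * B′
      extend f rec = trans
        (cong₂ (λ x y → f r * x + f r′ * y) (split-s (den a) (den-recurrent a)) (split-s (num a) (num-recurrent a)))
        (trans (lemma (f r) (f r′) (den a s) (den a s′) (num a s) (num a s′) A′ B′)
          (sym (cong₂ (λ x y → x * A′ + y * B′) (split-period f rec s ≤-refl) (split-period f rec s′ (n≤1+n s′)))))
        where
        lemma : ∀ f f′ d d′ e e′ A B → f * (d * A + d′ * B) + f′ * (e * A + e′ * B)
                                     ≡ (f * d + f′ * e) * A + (f * d′ + f′ * e′) * B
        lemma = solve-∀
      S≡ : S ≡ qₙ * A′ + qₙ′ * B′
      S≡ = extend (den a) (den-recurrent a)
      T≡ : T ≡ pₙ * A′ + pₙ′ * B′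
      T≡ = extend (num a) (num-recurrent a)
      AB′≤ : A * B′ ≤ A * A′
      AB′≤ = *-monoʳ-≤ A (num≤den (shift-partialQuotients s a⁺) (K + r))
      A′B≤ : A′ * B ≤ A * A′
      A′B≤ = ≤-trans (*-monoʳ-≤ A′ (num≤den (shift-partialQuotients n a⁺) K)) (≤-reflexive (*-comm A′ A))
      qₙA≤ : qₙ * A ≤ den a N
      qₙA≤ = ≤-trans (m≤m+n _ _) (≤-reflexive (sym qN))
      qₙA′≤ : qₙ * A′ ≤ S
      qₙA′≤ = ≤-trans (m≤m+n _ _) (≤-reflexive (sym S≡))
      regroup : ∀ q A A′ → q * q * (1 * (A * A′)) ≡ q * A * (q * A′)
      regroup = solve-∀
      regroup₂ : ∀ Q q → Q * (q * Q + q * Q) ≡ 2 * q * (Q * Q)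
      regroup₂ = solve-∀

-- Dirichlet approximation under a congruence condition

module DirichletCongruence where

  open import Data.Fin as Fin using (Fin; toℕ; fromℕ<; combine)
  import Data.Fin.Properties as Fin
  open import Data.Integer
  open import Data.Integer.DivMod using (_/ℕ_; _%ℕ_; n%ℕd<d; a≡a%ℕn+[a/ℕn]*n)
  open import Data.Integer.Properties
  open import Data.Integer.Tactic.RingSolver using (solve-∀)
  import Data.Nat.DivMod as ℕ
  open Continuants using (∣m-n∣≤o)

  private
    -- Division with remainder takes the modulus `∣ v ∣`; the sign σ turns its multiples into
    -- multiples of `v`.
    +∣i∣≡i*σ : ∀ i → ∃[ σ ] + ∣ i ∣ ≡ i * σ
    +∣i∣≡i*σ (+ n)      = + 1 , sym (*-identityʳ (+ n))
    +∣i∣≡i*σ -[1+ n ] = - (+ 1) , sym (trans (*-comm -[1+ n ] (- (+ 1))) (-1*i≡-i -[1+ n ]))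

  module _ (Y : ℤ) (d : ℕ) .{{_ : ℕ.NonZero d}} (u v w : ℤ) .{{_ : NonZero v}}
           (R : ℕ) .{{_ : ℕ.NonZero R}} where

    private
      floor : ℕ → ℤ
      floor t = (+ t * Y) /ℕ d

      rem : ℕ → ℕ
      rem t = (+ t * Y) %ℕ d

      form : ℕ → ℤ
      form t = u * + t + w * floor t

      cell : ℕ → Fin R
      cell t = fromℕ< {R ℕ.* rem t ℕ./ d}
        (ℕ.m<n*o⇒m/o<n (ℕ.*-monoʳ-< R (n%ℕd<d (+ t * Y) d)))

      residue : ℕ → Fin ∣ v ∣
      residue t = fromℕ< (n%ℕd<d (form t) ∣ v ∣)

      same-quotient : ∀ a b → a ℕ./ d ≡ b ℕ./ d → ∣ + b - + a ∣ ℕ.≤ d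
      same-quotient a b eq = subst (ℕ._≤ d) (cong ∣_∣ (sym difference))
        (∣m-n∣≤o (ℕ.<⇒≤ (ℕ.m%n<n b d)) (ℕ.<⇒≤ (ℕ.m%n<n a d)))
        where
        expand : ∀ x → + x ≡ + (x ℕ.% d) + + (x ℕ./ d) * + d
        expand x = trans (cong +_ (ℕ.m≡m%n+[m/n]*n x d))
          (trans (pos-+ (x ℕ.% d) _) (cong (λ z → + (x ℕ.% d) + z) (pos-* (x ℕ./ d) d)))
        cancel : ∀ r s q d → (r + q * d) - (s + q * d) ≡ r - s
        cancel = solve-∀
        difference : + b - + a ≡ + (b ℕ.% d) - + (a ℕ.% d)
        difference = trans (cong₂ _-_ (expand b)
          (trans (expand a) (cong (λ z → + (a ℕ.% d) + + z * + d) eq)))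
          (cancel (+ (b ℕ.% d)) (+ (a ℕ.% d)) (+ (b ℕ./ d)) (+ d))

    -- Pigeonhole on t ↦ (u t + w ⌊t y⌋ mod v , ⌊R (t y - ⌊t y⌋)⌋) for y = Y / d.
    dirichlet-congruence : ∃[ q ] ∃[ p₁ ] ∃[ p₂ ] (1 ℕ.≤ q × q ℕ.≤ R ℕ.* ∣ v ∣ ×
      ∣ + R * (+ q * Y - p₂ * + d) ∣ ℕ.≤ d × u * + q + v * p₁ + w * p₂ ≡ + 0)
    dirichlet-congruence
      -- There are R |v| boxes for the R |v| + 1 values t = 0, ..., R |v|, whence q ≤ R |v|.
      with i , j , i<j , eq ← Fin.pigeonhole (ℕ.n<1+n (R ℕ.* ∣ v ∣))
                                (λ t → combine (cell (toℕ t)) (residue (toℕ t)))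
      with cellᵢ≡cellⱼ , residueᵢ≡residueⱼ ← Fin.combine-injective
             (cell (toℕ i)) (residue (toℕ i)) (cell (toℕ j)) (residue (toℕ j)) eq
      with σ , +∣v∣≡v*σ ← +∣i∣≡i*σ v
      -- The forms at t′ and t differ by u q + w p₂ = k |v| = v σ k, which forces p₁ = - σ k.
      = q , - (σ * k) , floor t′ - floor t
      , ℕ.m<n⇒0<n∸m i<j
      , ℕ.≤-trans (ℕ.m∸n≤m t′ t) (ℕ.≤-pred (Fin.toℕ<n j))
      , subst (λ z → ∣ z ∣ ℕ.≤ d) (sym approx)
          (same-quotient (R ℕ.* rem t) (R ℕ.* rem t′) (Fin.fromℕ<-injective _ _ _ _ cellᵢ≡cellⱼ))
      , trans (cong (λ z → u * z + v * - (σ * k) + w * (floor t′ - floor t)) +q≡)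
          (relation u v w (+ t′) (+ t) (floor t′) (floor t) σ k
            (trans form-difference (cong (k *_) +∣v∣≡v*σ)))
      where
      t t′ q : ℕ
      t = toℕ i
      t′ = toℕ j
      q = t′ ℕ.∸ t
      +q≡ : + q ≡ + t′ - + t
      +q≡ = sym (trans (m-n≡m⊖n t′ t) (⊖-≥ (ℕ.<⇒≤ i<j)))
      k : ℤ
      k = form t′ /ℕ ∣ v ∣ - form t /ℕ ∣ v ∣
      same-rem : form t %ℕ ∣ v ∣ ≡ form t′ %ℕ ∣ v ∣
      same-rem = Fin.fromℕ<-injective _ _ _ _ residueᵢ≡residueⱼ
      form-difference : form t′ - form t ≡ k * + ∣ v ∣
      form-difference = trans (cong₂ _-_ (a≡a%ℕn+[a/ℕn]*n (form t′) ∣ v ∣)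
        (trans (a≡a%ℕn+[a/ℕn]*n (form t) ∣ v ∣) (cong (λ z → + z + form t /ℕ ∣ v ∣ * + ∣ v ∣) same-rem)))
        (cancel (+ (form t′ %ℕ ∣ v ∣)) (form t′ /ℕ ∣ v ∣) (form t /ℕ ∣ v ∣) (+ ∣ v ∣))
        where
        cancel : ∀ r a b v → (r + a * v) - (r + b * v) ≡ (a - b) * v
        cancel = solve-∀
      relation : ∀ u v w t′ t f′ f σ k → (u * t′ + w * f′) - (u * t + w * f) ≡ k * (v * σ) →
        u * (t′ - t) + v * - (σ * k) + w * (f′ - f) ≡ + 0
      relation u v w t′ t f′ f σ k h = trans (lemma₁ u v w t′ t f′ f σ k)
        (trans (cong (λ z → z - k * (v * σ)) h) (+-inverseʳ (k * (v * σ))))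
        where
        lemma₁ : ∀ u v w t′ t f′ f σ k → u * (t′ - t) + v * - (σ * k) + w * (f′ - f)
          ≡ (u * t′ + w * f′) - (u * t + w * f) - k * (v * σ)
        lemma₁ = solve-∀
      approx : + R * (+ q * Y - (floor t′ - floor t) * + d) ≡ + (R ℕ.* rem t′) - + (R ℕ.* rem t)
      approx = trans (cong (λ z → + R * (z * Y - (floor t′ - floor t) * + d)) +q≡)
        (trans (step (+ R) (+ t′) (+ t) Y (floor t′) (floor t) (+ d) (+ rem t′) (+ rem t)
          (a≡a%ℕn+[a/ℕn]*n (+ t′ * Y) d) (a≡a%ℕn+[a/ℕn]*n (+ t * Y) d))
          (cong₂ _-_ (sym (pos-* R (rem t′))) (sym (pos-* R (rem t)))))
        where
        step : ∀ R t′ t Y f′ f d r′ r → t′ * Y ≡ r′ + f′ * d → t * Y ≡ r + f * d →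
          R * ((t′ - t) * Y - (f′ - f) * d) ≡ R * r′ - R * r
        step R t′ t Y f′ f d r′ r h′ h = trans (lemma₁ R t′ t Y f′ f d)
          (trans (cong₂ (λ x y → R * ((x - y) - (f′ - f) * d)) h′ h) (lemma₂ R r′ r f′ f d))
          where
          lemma₁ : ∀ R t′ t Y f′ f d → R * ((t′ - t) * Y - (f′ - f) * d)
            ≡ R * ((t′ * Y - t * Y) - (f′ - f) * d)
          lemma₁ = solve-∀
          lemma₂ : ∀ R r′ r f′ f d → R * (((r′ + f′ * d) - (r + f * d)) - (f′ - f) * d) ≡ R * r′ - R * r
          lemma₂ = solve-∀

module Approximation where

  open import Algebra.Bundles using (CommutativeRing)
  open import Data.Rational
  open import Data.Rational.Literals using (fromℤ)
  open import Data.Rational.Properties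
  open import Algebra.Properties.CommutativeSemiring.Exp
    (CommutativeRing.commutativeSemiring +-*-commutativeRing)
    using (_^_; ^-homo-*; ^-assocʳ; ^-distrib-*)
  import Data.Rational.Unnormalised as ℚᵘ
  import Data.Rational.Unnormalised.Properties as ℚᵘ
  open import Defs as ℝ using (ℝ; seq; cauchy; fromℚ; fromℕ; fromInt; ‖_‖; ‖_‖ℚ; ‖y‖≤∣y-n∣; ‖z‖-attained;
    num; den; den-nonZero; PartialQuotients; convergent; _IsCF[_,_]; _^ʷ_; _BeginsWith_;
    IsInf≥1; IsRoot; IsLog; IsLimsup; IsLiminf)
  open import Level using (0ℓ)
  open import Tactic.RingSolver using (solve-∀)
  open import Tactic.RingSolver.Core.AlmostCommutativeRing using (AlmostCommutativeRing; fromCommutativeRing)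
  open Continuants
  open DirichletCongruence

  -- Ordered field arithmetic

  private
    0≟ : ∀ x → Maybe (0ℚ ≡ x)
    0≟ x with 0ℚ ≟ x
    ... | yes p = just p
    ... | no _  = nothing

  ring : AlmostCommutativeRing 0ℓ 0ℓ
  ring = fromCommutativeRing +-*-commutativeRing 0≟

  infixl 6 _⊞_
  infixl 7 _⊠_

  _⊞_ : ∀ {p q} → 0ℚ ≤ p → 0ℚ ≤ q → 0ℚ ≤ p + q
  _⊞_ = +-mono-≤ {0ℚ} {_} {0ℚ}

  _⊠_ : ∀ {p q} → 0ℚ ≤ p → 0ℚ ≤ q → 0ℚ ≤ p * q
  _⊠_ {p} {q} 0≤p 0≤q = nonNegative⁻¹ (p * q)
    {{nonNeg*nonNeg⇒nonNeg p {{nonNegative 0≤p}} q {{nonNegative 0≤q}}}}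

  0≤p*p : ∀ p → 0ℚ ≤ p * p
  0≤p*p p with ≤-total 0ℚ p
  ... | inj₁ 0≤p = 0≤p ⊠ 0≤p
  ... | inj₂ p≤0 = subst (0ℚ ≤_) (-p*-p≡p*p p) (neg-antimono-≤ p≤0 ⊠ neg-antimono-≤ p≤0)
    where
    -p*-p≡p*p : ∀ p → - p * - p ≡ p * p
    -p*-p≡p*p = solve-∀ ring

  *-pos : ∀ {p q} → 0ℚ < p → 0ℚ < q → 0ℚ < p * q
  *-pos {p} {q} 0<p 0<q = positive⁻¹ (p * q)
    {{pos*pos⇒pos p {{positive 0<p}} q {{positive 0<q}}}}

  0≤1 : 0ℚ ≤ 1ℚ
  0≤1 = nonNegative⁻¹ 1ℚ

  0<1 : 0ℚ < 1ℚ
  0<1 = positive⁻¹ 1ℚ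

  0≤½ : 0ℚ ≤ ½
  0≤½ = nonNegative⁻¹ ½

  0<½ : 0ℚ < ½
  0<½ = positive⁻¹ ½

  p≤q⇒0≤q-p : ∀ {p q} → p ≤ q → 0ℚ ≤ q - p
  p≤q⇒0≤q-p {p} {q} p≤q = subst (_≤ q - p) (+-inverseʳ p) (+-monoˡ-≤ (- p) p≤q)

  private
    cancel : ∀ p q → p + (q - p) ≡ q
    cancel = solve-∀ ring

  -- With p≤q⇒0≤q-p, _⊞_ and _⊠_, this reduces an inequality to a ring identity
  -- that exhibits q - p as a combination of products of nonnegative terms.
  q-p≡e⇒p≤q : ∀ {p q e} → 0ℚ ≤ e → q - p ≡ e → p ≤ q
  q-p≡e⇒p≤q {p} {q} 0≤e eq = subst₂ _≤_ (+-identityʳ p) (cancel p q)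
    (+-monoʳ-≤ p (subst (0ℚ ≤_) (sym eq) 0≤e))

  *-mono-≤ : ∀ {a b c d} → 0ℚ ≤ a → 0ℚ ≤ c → a ≤ b → c ≤ d → a * c ≤ b * d
  *-mono-≤ {a} {b} {c} {d} 0≤a 0≤c a≤b c≤d = ≤-trans
    (*-monoʳ-≤-nonNeg c {{nonNegative 0≤c}} a≤b)
    (*-monoˡ-≤-nonNeg b {{nonNegative (≤-trans 0≤a a≤b)}} c≤d)

  ≤-by-ε : ∀ {p q} → (∀ ε → 0ℚ < ε → p ≤ q + ε) → p ≤ q
  ≤-by-ε {p} {q} h with p ≤? q
  ... | yes p≤q = p≤q
  ... | no p≰q = contradiction (h (½ * (p - q)) (*-pos 0<½ 0<p-q)) (<⇒≱ q+ε<p)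
    where
    q<p = ≰⇒> p≰q
    0<p-q : 0ℚ < p - q
    0<p-q = subst (_< p - q) (+-inverseʳ q) (+-monoˡ-< (- q) q<p)
    split : ∀ p q → q + ½ * (p - q) + ½ * (p - q) ≡ p
    split = solve-∀ ring
    q+ε<p : q + ½ * (p - q) < p
    q+ε<p = subst₂ _<_ (+-identityʳ _) (split p q)
      (+-monoʳ-< (q + ½ * (p - q)) (*-pos 0<½ 0<p-q))
    <⇒≱ : ∀ {x y} → x < y → ¬ (y ≤ x)
    <⇒≱ x<y y≤x = <-irrefl refl (<-≤-trans x<y y≤x)

  p≤∣p∣ : ∀ p → p ≤ ∣ p ∣
  p≤∣p∣ p with ≤-total 0ℚ p
  ... | inj₁ 0≤p = ≤-reflexive (sym (0≤p⇒∣p∣≡p 0≤p))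
  ... | inj₂ p≤0 = ≤-trans p≤0 (0≤∣p∣ p)

  -p≤∣p∣ : ∀ p → - p ≤ ∣ p ∣
  -p≤∣p∣ p = subst (- p ≤_) (∣-p∣≡∣p∣ p) (p≤∣p∣ (- p))

  ∣p∣≤q : ∀ {p q} → p ≤ q → - p ≤ q → ∣ p ∣ ≤ q
  ∣p∣≤q {p} p≤q -p≤q with ∣p∣≡p∨∣p∣≡-p p
  ... | inj₁ eq = subst (_≤ _) (sym eq) p≤q
  ... | inj₂ eq = subst (_≤ _) (sym eq) -p≤q

  ∣p-q∣≡∣q-p∣ : ∀ p q → ∣ p - q ∣ ≡ ∣ q - p ∣
  ∣p-q∣≡∣q-p∣ p q = trans (cong ∣_∣ (flip p q)) (∣-p∣≡∣p∣ (q - p))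
    where
    flip : ∀ p q → p - q ≡ - (q - p)
    flip = solve-∀ ring

  ∣+∣-mono : ∀ {p q b c} → ∣ p ∣ ≤ b → ∣ q ∣ ≤ c → ∣ p + q ∣ ≤ b + c
  ∣+∣-mono {p} {q} p≤b q≤c = ≤-trans (∣p+q∣≤∣p∣+∣q∣ p q) (+-mono-≤ p≤b q≤c)

  ∣*∣-mono : ∀ {p q b c} → ∣ p ∣ ≤ b → ∣ q ∣ ≤ c → ∣ p * q ∣ ≤ b * c
  ∣*∣-mono {p} {q} p≤b q≤c = subst (_≤ _) (sym (∣p*q∣≡∣p∣*∣q∣ p q))
    (*-mono-≤ (0≤∣p∣ p) (0≤∣p∣ q) p≤b q≤c)

  fromℤ-+ : ∀ i j → fromℤ (i ℤ.+ j) ≡ fromℤ i + fromℤ j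
  fromℤ-+ i j = toℚᵘ-injective (ℚᵘ.≃-trans
    (ℚᵘ.*≡* (lemma i j)) (ℚᵘ.≃-sym (toℚᵘ-homo-+ (fromℤ i) (fromℤ j))))
    where
    lemma : ∀ i j → (i ℤ.+ j) ℤ.* + 1 ≡ (i ℤ.* + 1 ℤ.+ j ℤ.* + 1) ℤ.* + 1
    lemma = ℤSolver.solve-∀

  fromℤ-* : ∀ i j → fromℤ (i ℤ.* j) ≡ fromℤ i * fromℤ j
  fromℤ-* i j = toℚᵘ-injective (ℚᵘ.≃-sym (toℚᵘ-homo-* (fromℤ i) (fromℤ j)))

  fromℤ-neg : ∀ i → fromℤ (ℤ.- i) ≡ - fromℤ i
  fromℤ-neg (+ 0)      = refl
  fromℤ-neg (+ suc n)  = refl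
  fromℤ-neg (-[1+ n ]) = refl

  fromℤ-- : ∀ i j → fromℤ (i ℤ.- j) ≡ fromℤ i - fromℤ j
  fromℤ-- i j = trans (fromℤ-+ i (ℤ.- j)) (cong (λ t → fromℤ i + t) (fromℤ-neg j))

  fromℤ-∣∣ : ∀ i → fromℤ (+ ℤ.∣ i ∣) ≡ ∣ fromℤ i ∣
  fromℤ-∣∣ (+ n)      = refl
  fromℤ-∣∣ (-[1+ n ]) = refl

  fromℤ-mono-≤ : ∀ {i j} → i ℤ.≤ j → fromℤ i ≤ fromℤ j
  fromℤ-mono-≤ i≤j = *≤* (ℤ.*-monoʳ-≤-nonNeg (+ 1) i≤j)

  fromℤ-cancel-≤ : ∀ {i j} → fromℤ i ≤ fromℤ j → i ℤ.≤ j
  fromℤ-cancel-≤ {i} {j} (*≤* h) = subst₂ ℤ._≤_ (ℤ.*-identityʳ i) (ℤ.*-identityʳ j) h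

  q*↧q≡↥q : ∀ q → q * fromℤ (↧ q) ≡ fromℤ (↥ q)
  q*↧q≡↥q q@(mkℚ n d-1 _) = toℚᵘ-injective (ℚᵘ.≃-trans (toℚᵘ-homo-* q (fromℤ (↧ q)))
    (ℚᵘ.*≡* (trans (ℤ.*-identityʳ (n ℤ.* + suc d-1))
      (cong (λ z → n ℤ.* z) (sym (ℤ.*-identityʳ (+ suc d-1)))))))

  ι : ℕ → ℚ
  ι n = fromℤ (+ n)

  ι-+ : ∀ m n → ι (m ℕ.+ n) ≡ ι m + ι n
  ι-+ m n = fromℤ-+ (+ m) (+ n)

  ι-* : ∀ m n → ι (m ℕ.* n) ≡ ι m * ι n
  ι-* m n = trans (cong fromℤ (ℤ.pos-* m n)) (fromℤ-* (+ m) (+ n))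

  ι-mono-≤ : ∀ {m n} → m ℕ.≤ n → ι m ≤ ι n
  ι-mono-≤ m≤n = fromℤ-mono-≤ (ℤ.+≤+ m≤n)

  ι-cancel-≤ : ∀ {m n} → ι m ≤ ι n → m ℕ.≤ n
  ι-cancel-≤ h = ℤ.drop‿+≤+ (fromℤ-cancel-≤ h)

  0≤ι : ∀ n → 0ℚ ≤ ι n
  0≤ι n = ι-mono-≤ ℕ.z≤n

  1≤⇒0< : ∀ {p} → 1ℚ ≤ p → 0ℚ < p
  1≤⇒0< 1≤p = <-≤-trans 0<1 1≤p

  1≤p⇒0≤p : ∀ {p} → 1ℚ ≤ p → 0ℚ ≤ p
  1≤p⇒0≤p = ≤-trans 0≤1

  p≤ι∣↥p∣ : ∀ p → p ≤ ι ℤ.∣ ↥ p ∣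
  p≤ι∣↥p∣ p@(mkℚ (+ n) d-1 _) = *≤* (begin
    + n ℤ.* + 1       ≤⟨ ℤ.*-monoˡ-≤-nonNeg (+ n) (ℤ.+≤+ (ℕ.s≤s ℕ.z≤n)) ⟩
    + n ℤ.* + suc d-1 ∎)
    where open ℤ.≤-Reasoning
  p≤ι∣↥p∣ (mkℚ (-[1+ n ]) d-1 _) = *≤* ℤ.-≤+

  archimedean : ∀ p → ∃[ n ] p ≤ ι n
  archimedean p = _ , p≤ι∣↥p∣ p

  1≤n*ε : ∀ {ε} → 0ℚ < ε → ∃[ n ] (1 ℕ.≤ n × 1ℚ ≤ ι n * ε)
  1≤n*ε {ε@(mkℚ (+ suc k) d-1 _)} 0<ε = suc d-1 , ℕ.s≤s ℕ.z≤n ,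
    subst (1ℚ ≤_) (sym (trans (*-comm (ι (suc d-1)) ε) (q*↧q≡↥q ε))) (ι-mono-≤ (ℕ.s≤s ℕ.z≤n))
  1≤n*ε {mkℚ (+ 0) d-1 _} (*<* (ℤ.+<+ ()))
  1≤n*ε {mkℚ (-[1+ _ ]) d-1 _} (*<* ())

  0≤^ : ∀ {p} → 0ℚ ≤ p → ∀ n → 0ℚ ≤ p ^ n
  0≤^ 0≤p zero    = 0≤1
  0≤^ 0≤p (suc n) = 0≤p ⊠ 0≤^ 0≤p n

  ^-monoˡ-≤ : ∀ {p q} n → 0ℚ ≤ p → p ≤ q → p ^ n ≤ q ^ n
  ^-monoˡ-≤ zero    0≤p p≤q = ≤-refl
  ^-monoˡ-≤ (suc n) 0≤p p≤q = *-mono-≤ 0≤p (0≤^ 0≤p n) p≤q (^-monoˡ-≤ n 0≤p p≤q)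

  1≤^ : ∀ {p} n → 1ℚ ≤ p → 1ℚ ≤ p ^ n
  1≤^ zero    1≤p = ≤-refl
  1≤^ (suc n) 1≤p = *-mono-≤ 0≤1 0≤1 1≤p (1≤^ n 1≤p)

  ^≤1 : ∀ {p} n → 0ℚ ≤ p → p ≤ 1ℚ → p ^ n ≤ 1ℚ
  ^≤1 zero    0≤p p≤1 = ≤-refl
  ^≤1 (suc n) 0≤p p≤1 = *-mono-≤ 0≤p (0≤^ 0≤p n) p≤1 (^≤1 n 0≤p p≤1)

  ^-monoʳ-≤ : ∀ {p m n} → 1ℚ ≤ p → m ℕ.≤ n → p ^ m ≤ p ^ n
  ^-monoʳ-≤ {n = n} 1≤p ℕ.z≤n = 1≤^ n 1≤p
  ^-monoʳ-≤ {p} 1≤p (ℕ.s≤s m≤n) =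
    *-monoˡ-≤-nonNeg p {{nonNegative (1≤p⇒0≤p 1≤p)}} (^-monoʳ-≤ 1≤p m≤n)

  ∣p∣^n : ∀ p n → ∣ p ^ n ∣ ≡ ∣ p ∣ ^ n
  ∣p∣^n p zero    = refl
  ∣p∣^n p (suc n) = trans (∣p*q∣≡∣p∣*∣q∣ p (p ^ n)) (cong (∣ p ∣ *_) (∣p∣^n p n))

  ι-^ : ∀ m n → ι (m ℕ.^ n) ≡ ι m ^ n
  ι-^ m zero    = refl
  ι-^ m (suc n) = trans (ι-* m (m ℕ.^ n)) (cong (ι m *_) (ι-^ m n))

  1+ιn : ∀ n → ι (suc n) ≡ 1ℚ + ι n
  1+ιn n = ι-+ 1 n

  bernoulli : ∀ {h} n → 0ℚ ≤ 1ℚ + h → 1ℚ + ι n * h ≤ (1ℚ + h) ^ n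
  bernoulli {h} zero 0≤1+h = ≤-reflexive (lemma h)
    where
    lemma : ∀ h → 1ℚ + 0ℚ * h ≡ 1ℚ
    lemma = solve-∀ ring
  bernoulli {h} (suc n) 0≤1+h = ≤-trans
    (subst (λ t → 1ℚ + t * h ≤ (1ℚ + h) * (1ℚ + ι n * h)) (sym (1+ιn n))
      (q-p≡e⇒p≤q (0≤ι n ⊠ 0≤p*p h) (lemma h (ι n))))
    (*-monoˡ-≤-nonNeg (1ℚ + h) {{nonNegative 0≤1+h}} (bernoulli {h} n 0≤1+h))
    where
    lemma : ∀ h n → (1ℚ + h) * (1ℚ + n * h) - (1ℚ + (1ℚ + n) * h) ≡ n * (h * h)
    lemma = solve-∀ ring

  -- Quadratic and linear forms

  private
    approx-cast : ∀ y Y d R q p → y * ι d ≡ fromℤ Y → 1 ℕ.≤ d →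
      ℤ.∣ + R ℤ.* (+ q ℤ.* Y ℤ.- p ℤ.* + d) ∣ ℕ.≤ d →
      ι R * ∣ ι q * y - fromℤ p ∣ ≤ 1ℚ
    approx-cast y Y d R q p yd≡Y 1≤d approx = *-cancelˡ-≤-pos (ι d) {{positive (1≤⇒0< (ι-mono-≤ 1≤d))}}
      (subst₂ _≤_ (trans (fromℤ-∣∣ z) scaled) (sym (*-identityʳ (ι d))) (ι-mono-≤ approx))
      where
      z : ℤ
      z = + R ℤ.* (+ q ℤ.* Y ℤ.- p ℤ.* + d)
      e : ℚ
      e = ι q * y - fromℤ p
      factor : ∀ R q y d p → R * (q * (y * d) - p * d) ≡ d * (R * (q * y - p))
      factor = solve-∀ ring
      z≡ : fromℤ z ≡ ι d * (ι R * e)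
      z≡ = begin
        fromℤ z
          ≡⟨ fromℤ-* (+ R) (+ q ℤ.* Y ℤ.- p ℤ.* + d) ⟩
        ι R * fromℤ (+ q ℤ.* Y ℤ.- p ℤ.* + d)
          ≡⟨ cong (ι R *_) (trans (fromℤ-- (+ q ℤ.* Y) (p ℤ.* + d))
               (cong₂ _-_ (fromℤ-* (+ q) Y) (fromℤ-* p (+ d)))) ⟩
        ι R * (ι q * fromℤ Y - fromℤ p * ι d)
          ≡⟨ cong (λ t → ι R * (ι q * t - fromℤ p * ι d)) yd≡Y ⟨
        ι R * (ι q * (y * ι d) - fromℤ p * ι d)
          ≡⟨ factor (ι R) (ι q) y (ι d) (fromℤ p) ⟩
        ι d * (ι R * e) ∎
        where open ≡-Reasoning
      scaled : ∣ fromℤ z ∣ ≡ ι d * (ι R * ∣ e ∣)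
      scaled = trans (cong ∣_∣ z≡) (trans (∣p*q∣≡∣p∣*∣q∣ (ι d) (ι R * e))
        (cong (ι d *_) (∣p*q∣≡∣p∣*∣q∣ (ι R) e)))

    relation-cast : ∀ u v w q p₁ p₂ → u ℤ.* q ℤ.+ v ℤ.* p₁ ℤ.+ w ℤ.* p₂ ≡ + 0 →
      fromℤ u * fromℤ q + fromℤ v * fromℤ p₁ + fromℤ w * fromℤ p₂ ≡ 0ℚ
    relation-cast u v w q p₁ p₂ relation = trans (sym cast) (cong fromℤ relation)
      where
      cast : fromℤ (u ℤ.* q ℤ.+ v ℤ.* p₁ ℤ.+ w ℤ.* p₂)
           ≡ fromℤ u * fromℤ q + fromℤ v * fromℤ p₁ + fromℤ w * fromℤ p₂
      cast = trans (fromℤ-+ (u ℤ.* q ℤ.+ v ℤ.* p₁) (w ℤ.* p₂)) (cong₂ _+_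
        (trans (fromℤ-+ (u ℤ.* q) (v ℤ.* p₁)) (cong₂ _+_ (fromℤ-* u q) (fromℤ-* v p₁)))
        (fromℤ-* w p₂))

  -- Here y will be a rational term of β. Its multiples have computable integer parts, which those
  -- of β itself need not have.
  dirichlet-congruenceℚ : ∀ y u v w .{{_ : ℤ.NonZero v}} R .{{_ : ℕ.NonZero R}} →
    ∃[ q ] ∃[ p₁ ] ∃[ p₂ ] (1 ℕ.≤ q × q ℕ.≤ R ℕ.* ℤ.∣ v ∣ ×
      ι R * ∣ ι q * y - fromℤ p₂ ∣ ≤ 1ℚ ×
      fromℤ u * ι q + fromℤ v * fromℤ p₁ + fromℤ w * fromℤ p₂ ≡ 0ℚ)
  dirichlet-congruenceℚ y u v w R =
    let Y = ↥ y
        d = ↧ₙ y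
        q , p₁ , p₂ , 1≤q , q≤ , approx , relation = dirichlet-congruence Y d u v w R
    in q , p₁ , p₂ , 1≤q , q≤
     , approx-cast y Y d R q p₂ (q*↧q≡↥q y) (ℕ.s≤s ℕ.z≤n) approx
     , relation-cast u v w (+ q) p₁ p₂ relation

  -- v (q α - p₁) = q (u + v α + w β) - w (q β - p₂) transfers the approximation of β to α.
  product-bound : ∀ {u v w p₁ p₂ α β y δ R V W q ε} →
    0ℚ < R → ∣ v ∣ ≡ V → ∣ w ∣ ≤ W → 0ℚ ≤ q → q ≤ R * V →
    R * ∣ q * y - p₂ ∣ ≤ 1ℚ →
    R * (R * V) * ∣ β - y ∣ ≤ 1ℚ →
    ∣ u + v * α + w * β ∣ ≤ δ →
    u * q + v * p₁ + w * p₂ ≡ 0ℚ →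
    ι 2 * (R * (R * V) * δ) + ι 4 * W ≤ R * ε →
    q * ∣ q * α - p₁ ∣ * ∣ q * β - p₂ ∣ ≤ ε
  product-bound {u} {v} {w} {p₁} {p₂} {α} {β} {y} {δ} {R} {V} {W} {q} {ε}
    0<R ∣v∣≡V ∣w∣≤W 0≤q q≤RV approx β≈y form≤δ relation small =
    -- The chain is R q a b ≤ 2 q a ≤ 2 R V a ≤ 2 (R² V δ + 2 W), which explains the constants 2 and
    -- 4 in the smallness hypothesis.
    *-cancelˡ-≤-pos R {{positive 0<R}} (q-p≡e⇒p≤q
      (p≤q⇒0≤q-p small ⊞ 0≤ι 2 ⊠ p≤q⇒0≤q-p RVa≤ ⊞ 0≤ι 2 ⊠ 0≤a ⊠ p≤q⇒0≤q-p q≤RV ⊞ 0≤q ⊠ 0≤a ⊠ p≤q⇒0≤q-p Rb≤2)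
      (final R V W q ε δ a b))
    where
    0≤R = <⇒≤ 0<R
    a b e g : ℚ
    a = ∣ q * α - p₁ ∣
    b = ∣ q * β - p₂ ∣
    e = ∣ q * y - p₂ ∣
    g = ∣ β - y ∣
    0≤a : 0ℚ ≤ a
    0≤a = 0≤∣p∣ (q * α - p₁)
    0≤g : 0ℚ ≤ g
    0≤g = 0≤∣p∣ (β - y)
    0≤δ : 0ℚ ≤ δ
    0≤δ = ≤-trans (0≤∣p∣ _) form≤δ
    0≤W : 0ℚ ≤ W
    0≤W = ≤-trans (0≤∣p∣ _) ∣w∣≤W
    ∣q∣≡q = 0≤p⇒∣p∣≡p 0≤q
    b≤ : b ≤ e + q * g
    b≤ = subst (λ t → ∣ t ∣ ≤ e + q * g) (split q y β p₂)
      (∣+∣-mono {q * y - p₂} ≤-refl (∣*∣-mono {q} (≤-reflexive ∣q∣≡q) ≤-refl))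
      where
      split : ∀ q y β p → (q * y - p) + q * (β - y) ≡ q * β - p
      split = solve-∀ ring
    -- One unit comes from the approximation of q y, the other from q |β - y| ≤ R V |β - y| ≤ 1 / R.
    Rb≤2 : R * b ≤ ι 2
    Rb≤2 = q-p≡e⇒p≤q
      (p≤q⇒0≤q-p approx ⊞ p≤q⇒0≤q-p β≈y ⊞ 0≤R ⊠ p≤q⇒0≤q-p q≤RV ⊠ 0≤g ⊞ 0≤R ⊠ p≤q⇒0≤q-p b≤)
      (lemma R V q b e g)
      where
      lemma : ∀ R V q b e g → ι 2 - R * b ≡
        1ℚ - R * e + (1ℚ - R * (R * V) * g) + R * (R * V - q) * g + R * (e + q * g - b)
      lemma = solve-∀ ring
    Va≤ : V * a ≤ q * δ + W * b
    Va≤ = subst (_≤ q * δ + W * b) (trans (cong ∣_∣ transfer)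
        (trans (∣p*q∣≡∣p∣*∣q∣ v (q * α - p₁)) (cong (_* a) ∣v∣≡V)))
      (∣+∣-mono {q * (u + v * α + w * β)} (∣*∣-mono {q} (≤-reflexive ∣q∣≡q) form≤δ)
        (∣*∣-mono {w} { - (q * β - p₂)} ∣w∣≤W (≤-reflexive (∣-p∣≡∣p∣ (q * β - p₂)))))
      where
      lemma : ∀ u v w p₁ p₂ α β q → q * (u + v * α + w * β) + w * - (q * β - p₂)
        ≡ v * (q * α - p₁) + (u * q + v * p₁ + w * p₂)
      lemma = solve-∀ ring
      transfer : q * (u + v * α + w * β) + w * - (q * β - p₂) ≡ v * (q * α - p₁)
      transfer = trans (lemma u v w p₁ p₂ α β q)
        (trans (cong (λ t → v * (q * α - p₁) + t) relation) (+-identityʳ _))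
    RVa≤ : R * V * a ≤ R * (R * V) * δ + ι 2 * W
    RVa≤ = q-p≡e⇒p≤q
      (0≤R ⊠ p≤q⇒0≤q-p Va≤ ⊞ 0≤R ⊠ 0≤δ ⊠ p≤q⇒0≤q-p q≤RV ⊞ 0≤W ⊠ p≤q⇒0≤q-p Rb≤2)
      (lemma R V W q δ a b)
      where
      lemma : ∀ R V W q δ a b → R * (R * V) * δ + ι 2 * W - R * V * a ≡
        R * (q * δ + W * b - V * a) + R * δ * (R * V - q) + W * (ι 2 - R * b)
      lemma = solve-∀ ring
    final : ∀ R V W q ε δ a b → R * ε - R * (q * a * b) ≡
      R * ε - (ι 2 * (R * (R * V) * δ) + ι 4 * W) + ι 2 * (R * (R * V) * δ + ι 2 * W - R * V * a)
        + ι 2 * a * (R * V - q) + q * a * (ι 2 - R * b)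
    final = solve-∀ ring

  -- (u + v X) (c X + d) + w (a X + b) = c (a d - b c) P(X) for P = A X² + B X + C.
  linear-form-bound : ∀ {A B C a b c d α β} →
    let Δ = a * d - b * c
        u = a * c * C - b * c * B + b * d * A
        v = Δ * A
        w = - (c * c * C - c * d * B + d * d * A)
        γ = c * α + d in
    ∀ {κ G q Q} → 0ℚ ≤ κ → 0ℚ ≤ G → 0ℚ ≤ Q →
    ∣ c * Δ ∣ ≤ κ → ∣ w ∣ ≤ κ * q → 1ℚ ≤ G * ∣ γ ∣ →
    ∣ A * (α * α) + B * α + C ∣ * Q ≤ ι 3 * q →
    ∣ β * γ - (a * α + b) ∣ * Q ≤ 1ℚ →
    ∣ u + v * α + w * β ∣ * Q ≤ ι 4 * κ * G * q
  linear-form-bound {A} {B} {C} {a} {b} {c} {d} {α} {β} {κ} {G} {q} {Q}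
    0≤κ 0≤G 0≤Q cΔ≤ w≤ γ≥ P≤ β≈ = q-p≡e⇒p≤q
      (p≤q⇒0≤q-p γ≥ ⊠ 0≤L ⊠ 0≤Q ⊞ 0≤G ⊠ p≤q⇒0≤q-p γL≤ ⊠ 0≤Q
        ⊞ 0≤G ⊠ 0≤κ ⊠ p≤q⇒0≤q-p P≤ ⊞ 0≤G ⊠ 0≤κq ⊠ p≤q⇒0≤q-p β≈)
      (lemma (∣ L ∣) (∣ γ ∣) (∣ P ∣) (∣ E ∣) κ G q Q)
    where
    Δ = a * d - b * c
    u = a * c * C - b * c * B + b * d * A
    v = Δ * A
    w = - (c * c * C - c * d * B + d * d * A)
    γ = c * α + d
    P = A * (α * α) + B * α + C
    -- Terms of the Cauchy sequences satisfy the homography only up to this defect.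
    E = β * γ - (a * α + b)
    L = u + v * α + w * β
    0≤L : 0ℚ ≤ ∣ L ∣
    0≤L = 0≤∣p∣ L
    0≤κq : 0ℚ ≤ κ * q
    0≤κq = ≤-trans (0≤∣p∣ w) w≤
    identity : ∀ A B C a b c d α β →
      c * (a * d - b * c) * (A * (α * α) + B * α + C)
        + - (c * c * C - c * d * B + d * d * A) * (β * (c * α + d) - (a * α + b))
      ≡ (c * α + d) * (a * c * C - b * c * B + b * d * A + (a * d - b * c) * A * α
        + - (c * c * C - c * d * B + d * d * A) * β)
    identity = solve-∀ ring
    -- Multiplied by G Q, the two terms on the right contribute 3 κ G q and κ G q: hence the 4.
    γL≤ : ∣ γ ∣ * ∣ L ∣ ≤ κ * ∣ P ∣ + κ * q * ∣ E ∣
    γL≤ = subst (_≤ κ * ∣ P ∣ + κ * q * ∣ E ∣)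
      (trans (cong ∣_∣ (identity A B C a b c d α β)) (∣p*q∣≡∣p∣*∣q∣ γ L))
      (∣+∣-mono {c * Δ * P} (∣*∣-mono {c * Δ} cΔ≤ ≤-refl) (∣*∣-mono {w} w≤ ≤-refl))
    lemma : ∀ L γ P E κ G q Q → ι 4 * κ * G * q - L * Q ≡
      (G * γ - 1ℚ) * L * Q + G * (κ * P + κ * q * E - γ * L) * Q
        + G * κ * (ι 3 * q - P * Q) + G * (κ * q) * (1ℚ - E * Q)
    lemma = solve-∀ ring

  -- P(α) - P(c) = (α - c) (A ((α - c) + 2 c) + B), and the second factor is at most 4 q because c
  -- and |α - c| are at most 1. So moving from c to α costs at most q / Q, which raises the 2 to 3.
  quadratic-perturb : ∀ {A B C c α q Q} →
    ∣ A ∣ ≤ q → ∣ B ∣ ≤ q → 0ℚ ≤ c → c ≤ 1ℚ → 1ℚ ≤ Q →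
    ∣ A * (c * c) + B * c + C ∣ * Q ≤ ι 2 * q →
    ι 4 * Q * ∣ α - c ∣ ≤ 1ℚ →
    ∣ A * (α * α) + B * α + C ∣ * Q ≤ ι 3 * q
  quadratic-perturb {A} {B} {C} {c} {α} {q} {Q} A≤ B≤ 0≤c c≤1 1≤Q Pc≤ α≈c = q-p≡e⇒p≤q
    (p≤q⇒0≤q-p Pc≤ ⊞ p≤q⇒0≤q-p Pα≤ ⊠ 0≤Q ⊞ 0≤q ⊠ p≤q⇒0≤q-p α≈c)
    (lemma (∣ Pα ∣) (∣ Pc ∣) t q Q)
    where
    Pα = A * (α * α) + B * α + C
    Pc = A * (c * c) + B * c + C
    t = ∣ α - c ∣
    0≤t : 0ℚ ≤ t
    0≤t = 0≤∣p∣ (α - c)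
    0≤Q : 0ℚ ≤ Q
    0≤Q = 1≤p⇒0≤p 1≤Q
    0≤q : 0ℚ ≤ q
    0≤q = ≤-trans (0≤∣p∣ A) A≤
    t≤1 : t ≤ 1ℚ
    t≤1 = q-p≡e⇒p≤q (p≤q⇒0≤q-p α≈c ⊞ 0≤ι 4 ⊠ p≤q⇒0≤q-p 1≤Q ⊠ 0≤t ⊞ 0≤ι 3 ⊠ 0≤t) (lem t Q)
      where
      lem : ∀ t Q → 1ℚ - t ≡ 1ℚ - ι 4 * Q * t + ι 4 * (Q - 1ℚ) * t + ι 3 * t
      lem = solve-∀ ring
    expand : ∀ A B C c α → A * (c * c) + B * c + C + (α - c) * (A * ((α - c) + ι 2 * c) + B)
      ≡ A * (α * α) + B * α + C
    expand = solve-∀ ring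
    slope : ∣ A * ((α - c) + ι 2 * c) + B ∣ ≤ ι 4 * q
    slope = ≤-trans
      (∣+∣-mono {A * ((α - c) + ι 2 * c)}
        (∣*∣-mono {A} A≤ (∣+∣-mono {α - c} t≤1 (≤-reflexive (0≤p⇒∣p∣≡p (0≤ι 2 ⊠ 0≤c))))) B≤)
      (q-p≡e⇒p≤q (0≤ι 2 ⊠ 0≤q ⊠ p≤q⇒0≤q-p c≤1) (lem q c))
      where
      lem : ∀ q c → ι 4 * q - (q * (1ℚ + ι 2 * c) + q) ≡ ι 2 * q * (1ℚ - c)
      lem = solve-∀ ring
    Pα≤ : ∣ Pα ∣ ≤ ∣ Pc ∣ + t * (ι 4 * q)
    Pα≤ = subst (λ z → ∣ z ∣ ≤ ∣ Pc ∣ + t * (ι 4 * q)) (expand A B C c α)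
      (∣+∣-mono {Pc} ≤-refl (∣*∣-mono {α - c} ≤-refl slope))
    lemma : ∀ Pα Pc t q Q → ι 3 * q - Pα * Q ≡
      ι 2 * q - Pc * Q + (Pc + t * (ι 4 * q) - Pα) * Q + q * (1ℚ - ι 4 * Q * t)
    lemma = solve-∀ ring

  -- Convergents as rational numbers

  i/n*n≡i : ∀ i n .{{_ : ℕ.NonZero n}} → i / n * ι n ≡ fromℤ i
  i/n*n≡i i n@(suc n-1) = toℚᵘ-injective (ℚᵘ.≃-trans (toℚᵘ-homo-* (i / n) (ι n))
    (ℚᵘ.≃-trans (ℚᵘ.*-congʳ {ℚᵘ.mkℚᵘ (+ n) 0} (toℚᵘ-fromℚᵘ (ℚᵘ.mkℚᵘ i n-1)))
      (ℚᵘ.*≡* (trans (ℤ.*-identityʳ (i ℤ.* + n)) (cong (λ z → i ℤ.* z) (sym (ℤ.*-identityʳ (+ n))))))))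

  module _ {a} (a⁺ : PartialQuotients a) where

    convergent*den≡num : ∀ n → convergent a a⁺ n * ι (den a n) ≡ ι (num a n)
    convergent*den≡num n = i/n*n≡i (+ num a n) (den a n) {{den-nonZero a⁺ n}}

    0<den : ∀ n → 0ℚ < ι (den a n)
    0<den n = 1≤⇒0< (ι-mono-≤ (1≤den a⁺ n))

    0≤convergent : ∀ n → 0ℚ ≤ convergent a a⁺ n
    0≤convergent n = *-cancelʳ-≤-pos (ι (den a n)) {{positive (0<den n)}}
      (subst₂ _≤_ (sym (*-zeroˡ (ι (den a n)))) (sym (convergent*den≡num n)) (0≤ι (num a n)))

    convergent≤1 : ∀ n → convergent a a⁺ n ≤ 1ℚ
    convergent≤1 n = *-cancelʳ-≤-pos (ι (den a n)) {{positive (0<den n)}}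
      (subst₂ _≤_ (sym (convergent*den≡num n)) (sym (*-identityˡ (ι (den a n)))) (ι-mono-≤ (num≤den a⁺ n)))

    module _ (r′ s′ : ℕ) (periodic : AgreeUpTo (suc s′) (shift (suc r′) a) a) where

      private
        r n : ℕ
        r = suc r′
        n = suc s′ ℕ.+ r

      -- Dividing `fixedPoint-bound` by the square of den a N turns its determinant into the
      -- equation T c = c cleared of denominators.
      fixedPoint-boundℚ : ∀ K → let c = convergent a a⁺ (K ℕ.+ n) in
        ∣ ι (den a r′) * (c * c) + (ι (den a r) - ι (num a r′)) * c + - ι (num a r) ∣
          * (ι (den a n) * ι (den a n)) ≤ ι 2 * ι (den a r)
      fixedPoint-boundℚ K = *-cancelʳ-≤-pos D² {{positive (*-pos 0<D 0<D)}}
        (subst₂ _≤_ lhs rhs (ι-mono-≤ (fixedPoint-bound a⁺ r′ s′ periodic K)))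
        where
        N = K ℕ.+ n
        c = convergent a a⁺ N
        D = ι (den a N)
        D² = D * D
        0<D = 0<den N
        qₙ = ι (den a n)
        P = ι (den a r′) * (c * c) + (ι (den a r) - ι (num a r′)) * c + - ι (num a r)
        S = den a r ℕ.* den a N ℕ.+ den a r′ ℕ.* num a N
        T = num a r ℕ.* den a N ℕ.+ num a r′ ℕ.* num a N
        X = + num a N ℤ.* + S ℤ.- + den a N ℤ.* + T
        cast₂ : ∀ x y z w → ι (x ℕ.* y ℕ.+ z ℕ.* w) ≡ ι x * ι y + ι z * ι w
        cast₂ x y z w = trans (ι-+ (x ℕ.* y) (z ℕ.* w)) (cong₂ _+_ (ι-* x y) (ι-* z w))
        algebra : ∀ p q p′ q′ c D → c * D * (q * D + q′ * (c * D)) - D * (p * D + p′ * (c * D))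
          ≡ (q′ * (c * c) + (q - p′) * c + - p) * (D * D)
        algebra = solve-∀ ring
        X≡ : fromℤ X ≡ P * D²
        X≡ = begin
          fromℤ X
            ≡⟨ trans (fromℤ-- (+ num a N ℤ.* + S) (+ den a N ℤ.* + T))
                 (cong₂ _-_ (fromℤ-* (+ num a N) (+ S)) (fromℤ-* (+ den a N) (+ T))) ⟩
          ι (num a N) * ι S - D * ι T
            ≡⟨ cong₂ (λ x y → ι (num a N) * x - D * y)
                 (cast₂ (den a r) (den a N) (den a r′) (num a N))
                 (cast₂ (num a r) (den a N) (num a r′) (num a N)) ⟩
          ι (num a N) * (ι (den a r) * D + ι (den a r′) * ι (num a N))
            - D * (ι (num a r) * D + ι (num a r′) * ι (num a N))
            ≡⟨ cong (λ t → t * (ι (den a r) * D + ι (den a r′) * t) - D * (ι (num a r) * D + ι (num a r′) * t))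
                 (sym (convergent*den≡num N)) ⟩
          c * D * (ι (den a r) * D + ι (den a r′) * (c * D)) - D * (ι (num a r) * D + ι (num a r′) * (c * D))
            ≡⟨ algebra (ι (num a r)) (ι (den a r)) (ι (num a r′)) (ι (den a r′)) c D ⟩
          P * D² ∎
          where open ≡-Reasoning
        lhs : ι (den a n ℕ.* den a n ℕ.* ℤ.∣ X ∣) ≡ ∣ P ∣ * (qₙ * qₙ) * D²
        lhs = begin
          ι (den a n ℕ.* den a n ℕ.* ℤ.∣ X ∣)
            ≡⟨ trans (ι-* (den a n ℕ.* den a n) ℤ.∣ X ∣) (cong₂ _*_ (ι-* (den a n) (den a n)) (fromℤ-∣∣ X)) ⟩
          qₙ * qₙ * ∣ fromℤ X ∣
            ≡⟨ cong (λ t → qₙ * qₙ * t) (trans (cong ∣_∣ X≡) (trans (∣p*q∣≡∣p∣*∣q∣ P D²)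
                 (cong (∣ P ∣ *_) (0≤p⇒∣p∣≡p (<⇒≤ (*-pos 0<D 0<D)))))) ⟩
          qₙ * qₙ * (∣ P ∣ * D²)
            ≡⟨ swap (qₙ * qₙ) ∣ P ∣ D² ⟩
          ∣ P ∣ * (qₙ * qₙ) * D² ∎
          where
          open ≡-Reasoning
          swap : ∀ x y z → x * (y * z) ≡ y * x * z
          swap = solve-∀ ring
        rhs : ι (2 ℕ.* den a r ℕ.* (den a N ℕ.* den a N)) ≡ ι 2 * ι (den a r) * D²
        rhs = trans (ι-* (2 ℕ.* den a r) (den a N ℕ.* den a N))
          (cong₂ _*_ (ι-* 2 (den a r)) (ι-* (den a N) (den a N)))

  -- Powers of words

  applyUpTo-injective : ∀ {A : Set} {f g : ℕ → A} n → applyUpTo f n ≡ applyUpTo g n →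
    ∀ i → i ℕ.< n → f i ≡ g i
  applyUpTo-injective (suc n) eq zero    _           = proj₁ (∷-injective eq)
  applyUpTo-injective (suc n) eq (suc i) (ℕ.s≤s i<n) =
    applyUpTo-injective n (proj₂ (∷-injective eq)) i i<n

  applyUpTo-++ : ∀ {A : Set} (f : ℕ → A) V W → applyUpTo f (length (V ++ W)) ≡ V ++ W →
    applyUpTo f (length V) ≡ V × applyUpTo (λ i → f (length V ℕ.+ i)) (length W) ≡ W
  applyUpTo-++ f []      W eq = refl , eq
  applyUpTo-++ f (x ∷ V) W eq with ∷-injective eq
  ... | eq₀ , eq₊ with applyUpTo-++ (λ i → f (suc i)) V W eq₊
  ... | eqV , eqW = cong₂ _∷_ eq₀ eqV , eqW

  concat-replicate-comm : ∀ {A : Set} k (W : List A) →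
    W ++ concat (replicate k W) ≡ concat (replicate k W) ++ W
  concat-replicate-comm zero    W = ++-identityʳ W
  concat-replicate-comm (suc k) W = trans (cong (W ++_) (concat-replicate-comm k W))
    (sym (++-assoc W (concat (replicate k W)) W))

  -- W commutes with its integral powers, so W W^x is W^[x] W W′, and the W in the middle begins
  -- with W′. Thus W^x is a prefix of W W^x.
  ^ʷ-prefix : ∀ W x → ∃[ T ] W ++ W ^ʷ x ≡ W ^ʷ x ++ T
  ^ʷ-prefix W x = drop j W ++ take j W , (begin
    W ++ (C ++ take j W)                           ≡⟨ ++-assoc W C (take j W) ⟨
    (W ++ C) ++ take j W                           ≡⟨ cong (_++ take j W) (concat-replicate-comm k W) ⟩
    (C ++ W) ++ take j W                           ≡⟨ cong (λ V → (C ++ V) ++ take j W) (take++drop≡id j W) ⟨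
    (C ++ (take j W ++ drop j W)) ++ take j W      ≡⟨ cong (_++ take j W) (++-assoc C (take j W) (drop j W)) ⟨
    ((C ++ take j W) ++ drop j W) ++ take j W      ≡⟨ ++-assoc (C ++ take j W) (drop j W) (take j W) ⟩
    (C ++ take j W) ++ (drop j W ++ take j W)      ∎)
    where
    open ≡-Reasoning
    k = ℤ.∣ floor x ∣
    j = ℤ.∣ ceiling ((x - fromℤ (floor x)) * fromℤ (+ length W)) ∣
    C = concat (replicate k W)

  -- W^x is read after the first |W| letters and, by `^ʷ-prefix`, also from the very start.
  beginsWith⇒periodic : ∀ {a} W x → a BeginsWith (W ++ W ^ʷ x) →
    AgreeUpTo (length (W ^ʷ x)) (shift (length W) a) a
  beginsWith⇒periodic {a} W x begins (suc i) _ i<s = trans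
    (cong (λ j → a (suc j)) (ℕ.+-comm i (length W)))
    (applyUpTo-injective (length (W ^ʷ x))
      (trans (proj₂ (applyUpTo-++ (λ i → a (suc i)) W (W ^ʷ x) begins)) (sym front)) i i<s)
    where
    front : applyUpTo (λ i → a (suc i)) (length (W ^ʷ x)) ≡ W ^ʷ x
    front with ^ʷ-prefix W x
    ... | T , eq = proj₁ (applyUpTo-++ (λ i → a (suc i)) (W ^ʷ x) T
      (subst (a BeginsWith_) eq begins))

  floor≤p : ∀ p → fromℤ (floor p) ≤ p
  floor≤p p@(mkℚ n d-1 _) = *≤* (subst (floor p ℤ.* + suc d-1 ℤ.≤_)
    (sym (ℤ.*-identityʳ n)) (ℤ.[n/d]*d≤n n (+ suc d-1)))

  p≤1+floor : ∀ p → p ≤ fromℤ (ℤ.suc (floor p))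
  p≤1+floor p@(mkℚ n d-1 _) = *≤* (subst (ℤ._≤ ℤ.suc (floor p) ℤ.* + suc d-1)
    (sym (ℤ.*-identityʳ n)) (ℤ.<⇒≤ (subst (λ z → n ℤ.< ℤ.suc z ℤ.* + suc d-1)
      (sym (ℤ.div-pos-is-/ℕ n (suc d-1))) (ℤ.n<s[n/ℕd]*d n (suc d-1)))))

  p≤ceiling : ∀ p → p ≤ fromℤ (ceiling p)
  p≤ceiling p@record{} = subst₂ _≤_ (neg-involutive p) (sym (fromℤ-neg (floor (- p))))
    (neg-antimono-≤ (floor≤p (- p)))
    where
    neg-involutive : ∀ p → - (- p) ≡ p
    neg-involutive = solve-∀ ring

  0≤floor : ∀ p → 0ℚ < p → + 0 ℤ.≤ floor p
  0≤floor p 0<p with floor p | p≤1+floor p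
  ... | + n      | _ = ℤ.+≤+ ℕ.z≤n
  ... | -[1+ n ] | p≤ = contradiction
    (<-≤-trans 0<p (≤-trans p≤ (fromℤ-mono-≤ (ℤ.i<j⇒suc[i]≤j { -[1+ n ]} {+ 0} ℤ.-<+))))
    (<-irrefl refl)

  length-concat-replicate : ∀ {A : Set} k (W : List A) →
    length (concat (replicate k W)) ≡ k ℕ.* length W
  length-concat-replicate zero    W = refl
  length-concat-replicate (suc k) W = trans (length-++ W)
    (cong (length W ℕ.+_) (length-concat-replicate k W))

  x*length≤length-^ʷ : ∀ W x → 0ℚ < x → x * ι (length W) ≤ ι (length (W ^ʷ x))
  x*length≤length-^ʷ W x 0<x = begin
    x * ι r
      ≡⟨ split x φ (ι r) ⟩
    φ * ι r + f * ι r
      ≤⟨ +-monoʳ-≤ (φ * ι r) remainder≤ ⟩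
    φ * ι r + ι (j ℕ.⊓ r)
      ≡⟨ cong (λ t → t * ι r + ι (j ℕ.⊓ r)) (cong fromℤ (ℤ.0≤i⇒+∣i∣≡i (0≤floor x 0<x))) ⟨
    ι k * ι r + ι (j ℕ.⊓ r)
      ≡⟨ cong (_+ ι (j ℕ.⊓ r)) (ι-* k r) ⟨
    ι (k ℕ.* r) + ι (j ℕ.⊓ r)
      ≡⟨ ι-+ (k ℕ.* r) (j ℕ.⊓ r) ⟨
    ι (k ℕ.* r ℕ.+ j ℕ.⊓ r)
      ≡⟨ cong ι length≡ ⟨
    ι (length (W ^ʷ x)) ∎
    where
    open ≤-Reasoning
    r k : ℕ
    r = length W
    k = ℤ.∣ floor x ∣
    φ f : ℚ
    φ = fromℤ (floor x)
    f = x - φ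
    j : ℕ
    j = ℤ.∣ ceiling (f * ι r) ∣
    split : ∀ x φ r → x * r ≡ φ * r + (x - φ) * r
    split = solve-∀ ring
    length≡ : length (W ^ʷ x) ≡ k ℕ.* r ℕ.+ j ℕ.⊓ r
    length≡ = trans (length-++ (concat (replicate k W)))
      (cong₂ ℕ._+_ (length-concat-replicate k W) (length-take j W))
    f≤1 : f ≤ 1ℚ
    f≤1 = q-p≡e⇒p≤q (p≤q⇒0≤q-p (p≤1+floor x))
      (trans (lemma x φ) (cong (_- x) (sym (fromℤ-+ (+ 1) (floor x)))))
      where
      lemma : ∀ x φ → 1ℚ - (x - φ) ≡ 1ℚ + φ - x
      lemma = solve-∀ ring
    -- `take` stops at the end of W, whence the minimum; in that case f ≤ 1 is enough.
    remainder≤ : f * ι r ≤ ι (j ℕ.⊓ r)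
    remainder≤ with ℕ.⊓-sel j r
    ... | inj₁ eq rewrite eq = ≤-trans (p≤ceiling (f * ι r)) (fromℤ-mono-≤ (i≤+∣i∣ (ceiling (f * ι r))))
      where
      i≤+∣i∣ : ∀ i → i ℤ.≤ + ℤ.∣ i ∣
      i≤+∣i∣ (+ n)    = ℤ.≤-refl
      i≤+∣i∣ -[1+ n ] = ℤ.-≤+
    ... | inj₂ eq rewrite eq = subst (f * ι r ≤_) (*-identityˡ (ι r))
      (*-monoʳ-≤-nonNeg (ι r) {{nonNegative (0≤ι r)}} f≤1)

  -- Comparison of exponentials

  -- From (1 + a h)(1 - a h) ≤ 1 and Bernoulli: (1 + a h)^Y ≤ 1 / (1 - Y a h), while
  -- (1 + b h)^Z ≥ 1 + Z b h.
  power-gap : ∀ {a b g h B} Y Z → 0ℚ ≤ g → 0ℚ ≤ h → 0ℚ ≤ B →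
    ∣ a ∣ ≤ B → ∣ b ∣ ≤ B → ι Y * a + g ≤ ι Z * b →
    B * h ≤ 1ℚ → ι Z * B * h ≤ 1ℚ → ι 2 * (ι Y * ι Z) * (B * B) * h ≤ g →
    (1ℚ + a * h) ^ Y * (1ℚ + ½ * g * h) ≤ (1ℚ + b * h) ^ Z
  power-gap {a} {b} {g} {h} {B} Y Z 0≤g 0≤h 0≤B a≤B b≤B Ya+g≤Zb Bh≤1 ZBh≤1 YZBBh≤g =
    q-p≡e⇒p≤q
      (p≤q⇒0≤q-p z≤ ⊞ 0≤z ⊠ p≤q⇒0≤q-p α^Y≤ ⊞ 0≤^ 0≤α Y ⊠ p≤q⇒0≤q-p product≥)
      (final ((1ℚ + a * h) ^ Y) ((1ℚ + b * h) ^ Z) (ι Y * (a * h)) z (½ * g * h))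
    where
    bound : ∀ {c} → ∣ c ∣ ≤ B → ∣ c * h ∣ ≤ 1ℚ
    bound {c} c≤B = ≤-trans (∣*∣-mono {c} {h} c≤B (≤-reflexive (0≤p⇒∣p∣≡p 0≤h))) Bh≤1
    0≤1-t : ∀ {t} → ∣ t ∣ ≤ 1ℚ → 0ℚ ≤ 1ℚ + - t
    0≤1-t {t} t≤1 = p≤q⇒0≤q-p (≤-trans (p≤∣p∣ t) t≤1)
    0≤1+t : ∀ {t} → ∣ t ∣ ≤ 1ℚ → 0ℚ ≤ 1ℚ + t
    0≤1+t {t} t≤1 = subst (0ℚ ≤_) (lemma t) (p≤q⇒0≤q-p (≤-trans (-p≤∣p∣ t) t≤1))
      where
      lemma : ∀ t → 1ℚ - - t ≡ 1ℚ + t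
      lemma = solve-∀ ring
    0≤α : 0ℚ ≤ 1ℚ + a * h
    0≤α = 0≤1+t {a * h} (bound {a} a≤B)
    0≤α⁻ : 0ℚ ≤ 1ℚ + - (a * h)
    0≤α⁻ = 0≤1-t {a * h} (bound {a} a≤B)
    z : ℚ
    z = 1ℚ + ι Z * (b * h)
    z≤ : z ≤ (1ℚ + b * h) ^ Z
    z≤ = bernoulli {b * h} Z (0≤1+t {b * h} (bound {b} b≤B))
    0≤z : 0ℚ ≤ z
    0≤z = subst (0ℚ ≤_) (lemma (ι Z) B b h)
      (p≤q⇒0≤q-p ZBh≤1 ⊞ 0≤ι Z ⊠ 0≤h ⊠ p≤q⇒0≤q-p (≤-trans (-p≤∣p∣ b) b≤B))
      where
      lemma : ∀ Z B b h → 1ℚ - Z * B * h + Z * h * (B - - b) ≡ 1ℚ + Z * (b * h)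
      lemma = solve-∀ ring
    α^Y≤ : (1ℚ + a * h) ^ Y * (1ℚ - ι Y * (a * h)) ≤ 1ℚ
    α^Y≤ = begin
      (1ℚ + a * h) ^ Y * (1ℚ - ι Y * (a * h))
        ≡⟨ cong ((1ℚ + a * h) ^ Y *_) (lemma₁ (ι Y) (a * h)) ⟩
      (1ℚ + a * h) ^ Y * (1ℚ + ι Y * - (a * h))
        ≤⟨ *-monoˡ-≤-nonNeg ((1ℚ + a * h) ^ Y) {{nonNegative (0≤^ 0≤α Y)}} (bernoulli { - (a * h)} Y 0≤α⁻) ⟩
      (1ℚ + a * h) ^ Y * (1ℚ + - (a * h)) ^ Y
        ≡⟨ ^-distrib-* (1ℚ + a * h) (1ℚ + - (a * h)) Y ⟨
      ((1ℚ + a * h) * (1ℚ + - (a * h))) ^ Y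
        ≤⟨ ^≤1 Y (0≤α ⊠ 0≤α⁻) (q-p≡e⇒p≤q (0≤p*p (a * h)) (lemma₂ (a * h))) ⟩
      1ℚ ∎
      where
      open ≤-Reasoning
      lemma₁ : ∀ Y t → 1ℚ - Y * t ≡ 1ℚ + Y * - t
      lemma₁ = solve-∀ ring
      lemma₂ : ∀ t → 1ℚ - (1ℚ + t) * (1ℚ + - t) ≡ t * t
      lemma₂ = solve-∀ ring
    ab≤BB : a * b ≤ B * B
    ab≤BB = ≤-trans (p≤∣p∣ (a * b)) (∣*∣-mono {a} a≤B b≤B)
    -- The product is 1 + (Z b - Y a) h - Y Z a b h². The linear part gains at least g h, and the
    -- last hypothesis lets the quadratic part consume at most half of it.
    product≥ : 1ℚ + ½ * g * h ≤ (1ℚ - ι Y * (a * h)) * z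
    product≥ = q-p≡e⇒p≤q
      (p≤q⇒0≤q-p Ya+g≤Zb ⊠ 0≤h ⊞ 0≤½ ⊠ 0≤h ⊠
        (p≤q⇒0≤q-p YZBBh≤g ⊞ 0≤ι 2 ⊠ (0≤ι Y ⊠ 0≤ι Z) ⊠ 0≤h ⊠ p≤q⇒0≤q-p ab≤BB))
      (lemma (ι Y) (ι Z) a b g h B)
      where
      lemma : ∀ Y Z a b g h B → (1ℚ - Y * (a * h)) * (1ℚ + Z * (b * h)) - (1ℚ + ½ * g * h) ≡
        (Z * b - (Y * a + g)) * h + ½ * h *
          (g - ι 2 * (Y * Z) * (B * B) * h + ι 2 * (Y * Z) * h * (B * B - a * b))
      lemma = solve-∀ ring
    final : ∀ αY βZ t z s → βZ - αY * (1ℚ + s) ≡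
      βZ - z + z * (1ℚ - αY * (1ℚ - t)) + αY * ((1ℚ - t) * z - (1ℚ + s))
    final = solve-∀ ring

  euler : ℕ → ℚ → ℚ
  euler k z = (1ℚ + z * (+ 1 / suc k)) ^ suc k

  -- The three smallness conditions of `power-gap` for h = 1 / (k + 1), multiplied out.
  record Large (B g : ℚ) (Y Z k : ℕ) : Set where
    field
      B≤n     : B ≤ ι (suc k)
      ZB≤n    : ι Z * B ≤ ι (suc k)
      YZBB≤gn : ι 2 * (ι Y * ι Z) * (B * B) ≤ g * ι (suc k)

  ^-swap : ∀ p m n → (p ^ m) ^ n ≡ (p ^ n) ^ m
  ^-swap p m n = trans (^-assocʳ p m n) (trans (cong (p ^_) (ℕ.*-comm m n)) (sym (^-assocʳ p n m)))

  -- `power-gap` for h = 1 / n, raised to the n-th power. Bernoulli's inequality collects the gains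
  -- 1 + g / (2 n) into 1 + g / 2, a factor independent of n that survives the later approximations.
  exp-gap : ∀ {a b g B} Y Z k → 0ℚ ≤ g → 0ℚ ≤ B → ∣ a ∣ ≤ B → ∣ b ∣ ≤ B →
    ι Y * a + g ≤ ι Z * b → Large B g Y Z k →
    euler k a ^ Y * (1ℚ + ½ * g) ≤ euler k b ^ Z
  exp-gap {a} {b} {g} {B} Y Z k 0≤g 0≤B a≤B b≤B Ya+g≤Zb large = begin
    euler k a ^ Y * (1ℚ + ½ * g)
      ≡⟨ cong₂ _*_ (^-swap α n Y) (cong (λ t → 1ℚ + t) (unscale (½ * g))) ⟩
    (α ^ Y) ^ n * (1ℚ + ι n * (½ * g * h))
      ≤⟨ *-monoˡ-≤-nonNeg ((α ^ Y) ^ n) {{nonNegative (0≤^ (0≤^ 0≤α Y) n)}} (bernoulli {½ * g * h} n 0≤s) ⟩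
    (α ^ Y) ^ n * (1ℚ + ½ * g * h) ^ n
      ≡⟨ ^-distrib-* (α ^ Y) (1ℚ + ½ * g * h) n ⟨
    (α ^ Y * (1ℚ + ½ * g * h)) ^ n
      ≤⟨ ^-monoˡ-≤ n (0≤^ 0≤α Y ⊠ 0≤s)
           (power-gap Y Z 0≤g 0≤h 0≤B a≤B b≤B Ya+g≤Zb
             (scale B≤n) (scale ZB≤n) (subst (ι 2 * (ι Y * ι Z) * (B * B) * h ≤_) (gnh g)
               (*-monoʳ-≤-nonNeg h {{nonNegative 0≤h}} YZBB≤gn))) ⟩
    (β ^ Z) ^ n
      ≡⟨ ^-swap β Z n ⟩
    euler k b ^ Z ∎
    where
    open ≤-Reasoning
    open Large large
    n = suc k
    h α β : ℚ
    h = + 1 / n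
    α = 1ℚ + a * h
    β = 1ℚ + b * h
    hn≡1 : h * ι n ≡ 1ℚ
    hn≡1 = i/n*n≡i (+ 1) n
    0≤h : 0ℚ ≤ h
    0≤h = nonNegative⁻¹ h {{normalize-nonNeg 1 n}}
    scale : ∀ {t} → t ≤ ι n → t * h ≤ 1ℚ
    scale {t} t≤n = subst (t * h ≤_) (trans (*-comm (ι n) h) hn≡1) (*-monoʳ-≤-nonNeg h {{nonNegative 0≤h}} t≤n)
    gnh : ∀ t → t * ι n * h ≡ t
    gnh t = trans (*-assoc t (ι n) h) (trans (cong (t *_) (trans (*-comm (ι n) h) hn≡1)) (*-identityʳ t))
    unscale : ∀ t → t ≡ ι n * (t * h)
    unscale t = sym (trans (lemma (ι n) t h) (gnh t))
      where
      lemma : ∀ n t h → n * (t * h) ≡ t * n * h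
      lemma = solve-∀ ring
    0≤s : 0ℚ ≤ 1ℚ + ½ * g * h
    0≤s = 0≤1 ⊞ 0≤½ ⊠ 0≤g ⊠ 0≤h
    0≤α : 0ℚ ≤ α
    0≤α = subst (0ℚ ≤_) (lemma a h) (p≤q⇒0≤q-p (≤-trans (-p≤∣p∣ (a * h))
      (≤-trans (∣*∣-mono {a} {h} a≤B (≤-reflexive (0≤p⇒∣p∣≡p 0≤h))) (scale B≤n))))
      where
      lemma : ∀ a h → 1ℚ - - (a * h) ≡ 1ℚ + a * h
      lemma = solve-∀ ring

  large-exists : ∀ {B g} Y Z → 0ℚ ≤ B → 0ℚ < g → ∃[ k₀ ] (∀ k → k₀ ℕ.≤ k → Large B g Y Z k)
  large-exists {B} {g} Y Z 0≤B 0<g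
    with b , B≤b ← archimedean B
    with n , _ , 1≤ng ← 1≤n*ε 0<g
    = b ℕ.+ Z ℕ.* b ℕ.+ T ℕ.* n , λ k k₀≤k → let k≤n = ℕ.≤-trans k₀≤k (ℕ.n≤1+n k) in record
      { B≤n = ≤-trans B≤b (ι-mono-≤ (ℕ.≤-trans (ℕ.m≤m+n b _) (ℕ.≤-trans (ℕ.m≤m+n _ (T ℕ.* n)) k≤n)))
      ; ZB≤n = ≤-trans (subst (ι Z * B ≤_) (sym (ι-* Z b)) (*-mono-≤ (0≤ι Z) 0≤B ≤-refl B≤b))
          (ι-mono-≤ (ℕ.≤-trans (ℕ.m≤n+m (Z ℕ.* b) b) (ℕ.≤-trans (ℕ.m≤m+n _ (T ℕ.* n)) k≤n)))
      ; YZBB≤gn = begin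
          ι 2 * (ι Y * ι Z) * (B * B)
            ≤⟨ *-mono-≤ (0≤ι 2 ⊠ (0≤ι Y ⊠ 0≤ι Z)) (0≤B ⊠ 0≤B) ≤-refl (*-mono-≤ 0≤B 0≤B B≤b B≤b) ⟩
          ι 2 * (ι Y * ι Z) * (ι b * ι b)
            ≡⟨ cong₂ _*_ (trans (cong (ι 2 *_) (sym (ι-* Y Z))) (sym (ι-* 2 (Y ℕ.* Z)))) (sym (ι-* b b)) ⟩
          ι (2 ℕ.* (Y ℕ.* Z)) * ι (b ℕ.* b)
            ≡⟨ ι-* (2 ℕ.* (Y ℕ.* Z)) (b ℕ.* b) ⟨
          ι T
            ≡⟨ *-identityʳ (ι T) ⟨
          ι T * 1ℚ
            ≤⟨ *-monoˡ-≤-nonNeg (ι T) {{nonNegative (0≤ι T)}} 1≤ng ⟩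
          ι T * (ι n * g)
            ≡⟨ rearrange (ι T) (ι n) g ⟩
          g * (ι T * ι n)
            ≡⟨ cong (g *_) (ι-* T n) ⟨
          g * ι (T ℕ.* n)
            ≤⟨ *-monoˡ-≤-nonNeg g {{nonNegative (<⇒≤ 0<g)}} (ι-mono-≤ (ℕ.≤-trans (ℕ.m≤n+m (T ℕ.* n) _) k≤n)) ⟩
          g * ι (suc k) ∎
      }
    where
    open ≤-Reasoning
    T = 2 ℕ.* (Y ℕ.* Z) ℕ.* (b ℕ.* b)
    rearrange : ∀ T n g → T * (n * g) ≡ g * (T * n)
    rearrange = solve-∀ ring

  -- With η = 3 ε, an error of 3 ε in M and m costs at most a factor (1 - η)^(Y + Z) ≥ 1 - (Y + Z) η.
  gap-stable : ∀ {eᵤ eᵥ M m g ε} Y Z → 0ℚ ≤ g → g ≤ 1ℚ → 0ℚ ≤ ε → ι 24 * ι (Y ℕ.+ Z) * ε ≡ g →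
    ι 3 * ε ≤ 1ℚ → 1ℚ ≤ M → 1ℚ ≤ eᵥ → M ≤ eᵤ + ι 3 * ε → eᵥ ≤ m + ι 3 * ε →
    eᵤ ^ Y * (1ℚ + ½ * g) ≤ eᵥ ^ Z →
    M ^ Y * (1ℚ + ½ * ½ * g) ≤ m ^ Z
  gap-stable {eᵤ} {eᵥ} {M} {m} {g} {ε} Y Z 0≤g g≤1 0≤ε ε≡ η≤1 1≤M 1≤eᵥ M≤ eᵥ≤ gap = begin
    M ^ Y * (1ℚ + ½ * ½ * g)
      ≤⟨ *-monoˡ-≤-nonNeg (M ^ Y) {{nonNegative 0≤M^Y}} loss ⟩
    M ^ Y * ((1ℚ + ½ * g) * (1ℚ + - η) ^ (Y ℕ.+ Z))
      ≡⟨ cong (λ t → M ^ Y * ((1ℚ + ½ * g) * t)) (^-homo-* (1ℚ + - η) Y Z) ⟩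
    M ^ Y * ((1ℚ + ½ * g) * (c ^ Y * c ^ Z))
      ≡⟨ rearrange (M ^ Y) (1ℚ + ½ * g) (c ^ Y) (c ^ Z) ⟩
    M ^ Y * c ^ Y * (1ℚ + ½ * g) * c ^ Z
      ≡⟨ cong (λ t → t * (1ℚ + ½ * g) * c ^ Z) (^-distrib-* M c Y) ⟨
    (M * c) ^ Y * (1ℚ + ½ * g) * c ^ Z
      ≤⟨ *-mono-≤ (0≤^ (0≤M ⊠ 0≤c) Y ⊠ 0≤G) (0≤^ 0≤c Z)
           (*-mono-≤ (0≤^ (0≤M ⊠ 0≤c) Y) 0≤G (^-monoˡ-≤ Y (0≤M ⊠ 0≤c) Mc≤) ≤-refl) ≤-refl ⟩
    eᵤ ^ Y * (1ℚ + ½ * g) * c ^ Z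
      ≤⟨ *-monoʳ-≤-nonNeg (c ^ Z) {{nonNegative (0≤^ 0≤c Z)}} gap ⟩
    eᵥ ^ Z * c ^ Z
      ≡⟨ ^-distrib-* eᵥ c Z ⟨
    (eᵥ * c) ^ Z
      ≤⟨ ^-monoˡ-≤ Z (1≤p⇒0≤p 1≤eᵥ ⊠ 0≤c) eᵥc≤ ⟩
    m ^ Z ∎
    where
    open ≤-Reasoning
    η c : ℚ
    η = ι 3 * ε
    c = 1ℚ + - η
    0≤η : 0ℚ ≤ η
    0≤η = 0≤ι 3 ⊠ 0≤ε
    0≤c : 0ℚ ≤ c
    0≤c = p≤q⇒0≤q-p η≤1
    0≤M : 0ℚ ≤ M
    0≤M = 1≤p⇒0≤p 1≤M
    0≤M^Y = 0≤^ 0≤M Y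
    0≤G : 0ℚ ≤ 1ℚ + ½ * g
    0≤G = 0≤1 ⊞ 0≤½ ⊠ 0≤g
    eighth : ι 8 * (ι (Y ℕ.+ Z) * η) ≡ g
    eighth = trans (lemma (ι (Y ℕ.+ Z)) ε) ε≡
      where
      lemma : ∀ z ε → ι 8 * (z * (ι 3 * ε)) ≡ ι 24 * z * ε
      lemma = solve-∀ ring
    -- (1 + g / 2) (1 - g / 8) ≥ 1 + g / 4 for 0 ≤ g ≤ 1. So (Y + Z) η has to be g / 8, and η = 3 ε
    -- gives the factor 24.
    loss : 1ℚ + ½ * ½ * g ≤ (1ℚ + ½ * g) * (1ℚ + - η) ^ (Y ℕ.+ Z)
    loss = ≤-trans
      (q-p≡e⇒p≤q (0≤½ ⊠ 0≤½ ⊠ 0≤½ ⊠ 0≤½ ⊠ 0≤g ⊠ p≤q⇒0≤q-p g≤1 ⊞ 0≤½ ⊠ 0≤½ ⊠ 0≤½ ⊠ 0≤½ ⊠ 0≤g)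
        (subst (λ t → (1ℚ + ½ * t) * (1ℚ + y * - η) - (1ℚ + ½ * ½ * t)
                    ≡ ½ * ½ * ½ * ½ * t * (1ℚ - t) + ½ * ½ * ½ * ½ * t) eighth (lemma y η)))
      (*-monoˡ-≤-nonNeg (1ℚ + ½ * g) {{nonNegative 0≤G}} (bernoulli { - η} (Y ℕ.+ Z) 0≤c))
      where
      y = ι (Y ℕ.+ Z)
      lemma : ∀ y η → (1ℚ + ½ * (ι 8 * (y * η))) * (1ℚ + y * - η) - (1ℚ + ½ * ½ * (ι 8 * (y * η)))
        ≡ ½ * ½ * ½ * ½ * (ι 8 * (y * η)) * (1ℚ - ι 8 * (y * η)) + ½ * ½ * ½ * ½ * (ι 8 * (y * η))
      lemma = solve-∀ ring
    rearrange : ∀ a b c d → a * (b * (c * d)) ≡ a * c * b * d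
    rearrange = solve-∀ ring
    -- Since M ≥ 1, the factor 1 - η takes away at least the additive error η.
    Mc≤ : M * c ≤ eᵤ
    Mc≤ = q-p≡e⇒p≤q (p≤q⇒0≤q-p M≤ ⊞ 0≤η ⊠ p≤q⇒0≤q-p 1≤M) (lemma M eᵤ η)
      where
      lemma : ∀ M e η → e - M * (1ℚ + - η) ≡ e + η - M + η * (M - 1ℚ)
      lemma = solve-∀ ring
    eᵥc≤ : eᵥ * c ≤ m
    eᵥc≤ = q-p≡e⇒p≤q (p≤q⇒0≤q-p eᵥ≤ ⊞ 0≤η ⊠ p≤q⇒0≤q-p 1≤eᵥ) (lemma m eᵥ η)
      where
      lemma : ∀ m e η → m - e * (1ℚ + - η) ≡ m + η - e + η * (e - 1ℚ)
      lemma = solve-∀ ring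

  -- Real numbers as sequences of rationals

  Eventually : (ℕ → Set) → Set
  Eventually P = ∃[ N ] (∀ n → N ℕ.≤ n → P n)

  infixr 4 _and_

  _and_ : ∀ {P Q} → Eventually P → Eventually Q → Eventually (λ n → P n × Q n)
  (M , p) and (N , q) = M ℕ.⊔ N , λ n M⊔N≤n →
    p n (ℕ.m⊔n≤o⇒m≤o M N M⊔N≤n) , q n (ℕ.m⊔n≤o⇒n≤o M N M⊔N≤n)

  sample : ∀ {P} → Eventually P → ∃[ n ] P n
  sample (N , p) = N , p N ℕ.≤-refl

  mapᵉ : ∀ {P Q : ℕ → Set} → (∀ {n} → P n → Q n) → Eventually P → Eventually Q
  mapᵉ f (N , p) = N , λ n N≤n → f (p n N≤n)

  fraction : ∀ g n .{{_ : ℕ.NonZero n}} → 0ℚ < g → ∃[ ε ] (0ℚ < ε × ι n * ε ≡ g)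
  fraction g n 0<g = + 1 / n * g
    , *-pos (positive⁻¹ (+ 1 / n) {{normalize-pos 1 n}}) 0<g
    , trans (lemma (ι n) (+ 1 / n) g) (trans (cong (_* g) (i/n*n≡i (+ 1) n)) (*-identityˡ g))
    where
    lemma : ∀ n h g → n * (h * g) ≡ h * n * g
    lemma = solve-∀ ring

  ⊓-pos : ∀ {p q} → 0ℚ < p → 0ℚ < q → 0ℚ < p ⊓ q
  ⊓-pos {p} {q} 0<p 0<q with ⊓-sel p q
  ... | inj₁ eq = subst (0ℚ <_) (sym eq) 0<p
  ... | inj₂ eq = subst (0ℚ <_) (sym eq) 0<q

  p+δ≤q⇒p≤q : ∀ {p q δ} → 0ℚ < δ → p + δ ≤ q → p ≤ q
  p+δ≤q⇒p≤q {p} {q} {δ} 0<δ p+δ≤q = q-p≡e⇒p≤q (p≤q⇒0≤q-p p+δ≤q ⊞ <⇒≤ 0<δ) (lemma p q δ)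
    where
    lemma : ∀ p q δ → q - p ≡ q - (p + δ) + δ
    lemma = solve-∀ ring

  <⇒≤ᵉ : ∀ {x y} → x ℝ.< y → Eventually (λ i → seq x i ≤ seq y i)
  <⇒≤ᵉ (δ , 0<δ , N , h) = N , λ n N≤n → p+δ≤q⇒p≤q 0<δ (h n N≤n)

  ∣p-q∣≤ε⇒p≤q+ε : ∀ {p q ε} → ∣ p - q ∣ ≤ ε → p ≤ q + ε
  ∣p-q∣≤ε⇒p≤q+ε {p} {q} {ε} h = q-p≡e⇒p≤q (p≤q⇒0≤q-p (≤-trans (p≤∣p∣ (p - q)) h)) (lemma p q ε)
    where
    lemma : ∀ p q ε → q + ε - p ≡ ε - (p - q)
    lemma = solve-∀ ring

  ≃⇒≤ᵉ : ∀ {x y} → x ℝ.≃ y → ∀ {ε} → 0ℚ < ε → Eventually (λ i → seq x i ≤ seq y i + ε)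
  ≃⇒≤ᵉ h 0<ε with h _ 0<ε
  ... | N , h′ = N , λ n N≤n → ∣p-q∣≤ε⇒p≤q+ε (<⇒≤ (h′ n N≤n))

  ℝ-sym : ∀ {x y} → x ℝ.≃ y → y ℝ.≃ x
  ℝ-sym {x} {y} h ε 0<ε with h ε 0<ε
  ... | N , h′ = N , λ n N≤n → subst (_< ε) (∣p-q∣≡∣q-p∣ (seq x n) (seq y n)) (h′ n N≤n)

  Stable : ℝ → ℚ → ℕ → Set
  Stable x ε N = ∀ i j → N ℕ.≤ i → N ℕ.≤ j → ∣ seq x i - seq x j ∣ ≤ ε

  stable : ∀ x {ε} → 0ℚ < ε → ∃[ N ] Stable x ε N
  stable x 0<ε with cauchy x _ 0<ε
  ... | N , h = N , λ i j N≤i N≤j → <⇒≤ (h i j N≤i N≤j)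

  eventually-bounded : ∀ x → ∃[ B ] (0ℚ ≤ B × Eventually (λ i → ∣ seq x i ∣ ≤ B))
  eventually-bounded x with stable x 0<1
  ... | N , h = 1ℚ + ∣ seq x N ∣ , 0≤1 ⊞ 0≤∣p∣ (seq x N) , N , λ i N≤i →
    subst (λ z → ∣ z ∣ ≤ 1ℚ + ∣ seq x N ∣) (lemma (seq x i) (seq x N))
      (∣+∣-mono {seq x i - seq x N} (h i N N≤i ℕ.≤-refl) ≤-refl)
    where
    lemma : ∀ p q → (p - q) + q ≡ p
    lemma = solve-∀ ring

  module _ {x z : ℝ} {ε N} (st : Stable x ε N) {i} (N≤i : N ℕ.≤ i) where

    -- One ε comes from the comparison with x, the other pays for freezing x at its i-th term. The
    -- result is a rational bound that can be raised to powers.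
    tail-upper : z ℝ.< (x ℝ.+ fromℚ ε) → Eventually (λ j → seq z j ≤ seq x i + ι 2 * ε)
    tail-upper z< = mapᵉ (λ {j} (z≤ , x≤) → q-p≡e⇒p≤q (p≤q⇒0≤q-p z≤ ⊞ p≤q⇒0≤q-p x≤)
        (lemma (seq x i) (seq x j) (seq z j) ε))
      (<⇒≤ᵉ {z} {x ℝ.+ fromℚ ε} z< and (N , λ j N≤j → ∣p-q∣≤ε⇒p≤q+ε {seq x j} {seq x i} (st j i N≤j N≤i)))
      where
      lemma : ∀ p q z ε → p + ι 2 * ε - z ≡ q + ε - z + (p + ε - q)
      lemma = solve-∀ ring

    tail-lower : (x ℝ.+ ℝ.- fromℚ ε) ℝ.< z → Eventually (λ j → seq x i - ι 2 * ε ≤ seq z j)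
    tail-lower <z = mapᵉ (λ {j} (≤z , x≤) → q-p≡e⇒p≤q (p≤q⇒0≤q-p ≤z ⊞ p≤q⇒0≤q-p x≤)
        (lemma (seq x i) (seq x j) (seq z j) ε))
      (<⇒≤ᵉ {x ℝ.+ ℝ.- fromℚ ε} {z} <z and (N , λ j N≤j → ∣p-q∣≤ε⇒p≤q+ε {seq x i} {seq x j} (st i j N≤i N≤j)))
      where
      lemma : ∀ p q z ε → z - (p - ι 2 * ε) ≡ z - (q + - ε) + (q + ε - p)
      lemma = solve-∀ ring

  seq-^ : ∀ x n i → seq (x ℝ.^ n) i ≡ seq x i ^ n
  seq-^ x zero    i = refl
  seq-^ x (suc n) i = cong (seq x i *_) (seq-^ x n i)

  private
    seq-power : ∀ y h n i → seq ((fromℕ 1 ℝ.+ y ℝ.* fromℚ h) ℝ.^ n) i ≡ (1ℚ + seq y i * h) ^ n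
    seq-power y h n i = seq-^ (fromℕ 1 ℝ.+ y ℝ.* fromℚ h) n i

    near : ∀ (X e : ℝ) (p : ℕ → ℚ) ε → (∀ i → seq X i ≡ p i) →
      (e ℝ.+ ℝ.- fromℚ ε) ℝ.< X → X ℝ.< (e ℝ.+ fromℚ ε) →
      Eventually (λ i → p i ≤ seq e i + ε × seq e i ≤ p i + ε)
    near X e p ε X≡p <X X< = mapᵉ step
      (<⇒≤ᵉ {e ℝ.+ ℝ.- fromℚ ε} {X} <X and <⇒≤ᵉ {X} {e ℝ.+ fromℚ ε} X<)
      where
      lemma : ∀ e ε X → X + ε - e ≡ X - (e + - ε)
      lemma = solve-∀ ring
      step : ∀ {i} → seq e i + - ε ≤ seq X i × seq X i ≤ seq e i + ε →
        p i ≤ seq e i + ε × seq e i ≤ p i + ε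
      step {i} (e≤ , ≤e) = subst (_≤ seq e i + ε) (X≡p i) ≤e
        , subst (λ t → seq e i ≤ t + ε) (X≡p i) (q-p≡e⇒p≤q (p≤q⇒0≤q-p e≤) (lemma (seq e i) ε (seq X i)))

  exp-approx : ∀ {y e} → ℝ.IsExp y e → ∀ {ε} → 0ℚ < ε → ∃[ K ] (∀ k → K ℕ.≤ k →
    Eventually (λ i → euler k (seq y i) ≤ seq e i + ε × seq e i ≤ euler k (seq y i) + ε))
  exp-approx {y} {e} isExp {ε} 0<ε = proj₁ (isExp ε 0<ε) , λ k K≤k →
    near ((fromℕ 1 ℝ.+ y ℝ.* fromℚ (+ 1 / suc k)) ℝ.^ suc k) e (λ i → euler k (seq y i)) ε
      (seq-power y (+ 1 / suc k) (suc k))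
      (proj₁ (proj₂ (isExp ε 0<ε) k K≤k)) (proj₂ (proj₂ (isExp ε 0<ε) k K≤k))

  module _ {ℓ q ρ} (root : IsRoot ℓ (fromℕ q) ρ) where

    root-upper′ : ∀ {y} → 0ℚ < y → Eventually (λ j → seq ρ j ≤ y) → ι q ≤ y ^ ℓ
    root-upper′ {y} 0<y ρ≤y = ≤-by-ε λ ε 0<ε →
      -- Terms of a nonnegative real may be negative. Using 0 ≤ ρ with tolerance y still gives |ρ_j|
      -- ≤ y.
      let j , ρ≤y , 0≤ρ+y , q≤ = sample (ρ≤y and proj₁ root y 0<y
            and ≃⇒≤ᵉ {fromℕ q} {ρ ℝ.^ ℓ} (ℝ-sym {ρ ℝ.^ ℓ} {fromℕ q} (proj₂ root)) 0<ε)
          p = seq ρ j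
          ∣ρ∣≤y = ∣p∣≤q ρ≤y (q-p≡e⇒p≤q 0≤ρ+y (lemma p y))
      in ≤-trans (subst (λ t → ι q ≤ t + ε) (seq-^ ρ ℓ j) q≤)
           (+-monoˡ-≤ ε (≤-trans (p≤∣p∣ (p ^ ℓ))
             (subst (_≤ y ^ ℓ) (sym (∣p∣^n p ℓ)) (^-monoˡ-≤ ℓ (0≤∣p∣ p) ∣ρ∣≤y))))
      where
      lemma : ∀ p y → y - - p ≡ p + y
      lemma = solve-∀ ring

    root-lower : ∀ {y} → 0ℚ ≤ y → Eventually (λ j → y ≤ seq ρ j) → y ^ ℓ ≤ ι q
    root-lower {y} 0≤y y≤ρ = ≤-by-ε λ ε 0<ε →
      let j , y≤ρ , ≤q = sample (y≤ρ and ≃⇒≤ᵉ {ρ ℝ.^ ℓ} {fromℕ q} (proj₂ root) 0<ε)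
      in ≤-trans (^-monoˡ-≤ ℓ 0≤y y≤ρ) (subst (_≤ ι q + ε) (seq-^ ρ ℓ j) ≤q)

    -- If y < 1, then z = max(1/2, y) would satisfy q ≤ z^ℓ ≤ z < 1, against q ≥ 1. The maximum with
    -- 1/2 supplies the positivity that `root-upper′` asks for.
    root-upper : ∀ {y} → 1 ℕ.≤ ℓ → 1 ℕ.≤ q → Eventually (λ j → seq ρ j ≤ y) → 1ℚ ≤ y × ι q ≤ y ^ ℓ
    root-upper {y} (ℕ.s≤s {n = n} _) 1≤q ρ≤y with 1ℚ ≤? y
    ... | yes 1≤y = 1≤y , root-upper′ (1≤⇒0< 1≤y) ρ≤y
    ... | no 1≰y = ⊥-elim (<-irrefl refl (≤-<-trans (ι-mono-≤ 1≤q) (≤-<-trans q≤z z<1)))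
      where
      z : ℚ
      z = ½ ⊔ y
      0<z : 0ℚ < z
      0<z = <-≤-trans 0<½ (p≤p⊔q ½ y)
      z<1 : z < 1ℚ
      z<1 with ⊔-sel ½ y
      ... | inj₁ eq = subst (_< 1ℚ) (sym eq) (*<* (ℤ.+<+ (ℕ.s≤s (ℕ.s≤s ℕ.z≤n))))
      ... | inj₂ eq = subst (_< 1ℚ) (sym eq) (≰⇒> 1≰y)
      q≤z : ι q ≤ z
      q≤z = ≤-trans (root-upper′ 0<z (mapᵉ (λ ρ≤y → ≤-trans ρ≤y (p≤q⊔p ½ y)) ρ≤y))
        (subst (z ^ suc n ≤_) (*-identityʳ z) (*-monoˡ-≤-nonNeg z {{nonNegative (<⇒≤ 0<z)}}
          (^≤1 n (<⇒≤ 0<z) (<⇒≤ z<1))))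

  -- Exponential bounds from the limsup and liminf of the roots

  module _ {Q : ℕ → ℕ} (1≤Q : ∀ ℓ → 1 ℕ.≤ Q ℓ) {ρ : ℕ → ℝ}
           (roots : ∀ ℓ → 1 ℕ.≤ ℓ → IsRoot ℓ (fromℕ (Q ℓ)) (ρ ℓ)) where

    module _ {M : ℝ} (sup : IsLimsup ρ M) {ε} (0<ε : 0ℚ < ε) {N} (st : Stable M ε N)
             {i} (N≤i : N ℕ.≤ i) where

      limsup-upper : ∃[ L ] (∀ ℓ → L ℕ.≤ ℓ → 1 ℕ.≤ ℓ →
        1ℚ ≤ seq M i + ι 2 * ε × ι (Q ℓ) ≤ (seq M i + ι 2 * ε) ^ ℓ)
      limsup-upper = proj₁ (proj₁ (sup ε 0<ε)) , λ ℓ L≤ℓ 1≤ℓ →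
        root-upper {ℓ} {Q ℓ} {ρ ℓ} (roots ℓ 1≤ℓ) 1≤ℓ (1≤Q ℓ)
          (tail-upper {M} {ρ ℓ} st N≤i (proj₂ (proj₁ (sup ε 0<ε)) ℓ L≤ℓ))

    module _ {m : ℝ} (inf : IsLiminf ρ m) {ε} (0<ε : 0ℚ < ε) {N} (st : Stable m ε N)
             {i} (N≤i : N ℕ.≤ i) where

      liminf-lower : 0ℚ ≤ seq m i - ι 2 * ε →
        ∃[ L ] (∀ ℓ → L ℕ.≤ ℓ → 1 ℕ.≤ ℓ → (seq m i - ι 2 * ε) ^ ℓ ≤ ι (Q ℓ))
      liminf-lower 0≤y = proj₁ (proj₁ (inf ε 0<ε)) , λ ℓ L≤ℓ 1≤ℓ →
        root-lower {ℓ} {Q ℓ} {ρ ℓ} (roots ℓ 1≤ℓ) 0≤y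
          (tail-lower {m} {ρ ℓ} st N≤i (proj₂ (proj₁ (inf ε 0<ε)) ℓ L≤ℓ))

      1≤liminf : 1ℚ ≤ seq m i + ι 2 * ε
      1≤liminf = bound (proj₂ (inf ε 0<ε) 1)
        where
        bound : ∃[ ℓ ] (1 ℕ.≤ ℓ × ρ ℓ ℝ.< (m ℝ.+ fromℚ ε)) → 1ℚ ≤ seq m i + ι 2 * ε
        bound (ℓ , 1≤ℓ , ρ<) = proj₁ (root-upper {ℓ} {Q ℓ} {ρ ℓ} (roots ℓ 1≤ℓ) 1≤ℓ (1≤Q ℓ)
          (tail-upper {m} {ρ ℓ} st N≤i ρ<))

    -- All Q ℓ are at least 1, hence m ≥ 1. With exponents 1 and 0, `exp-gap` turns v + g ≤ 0 into
    -- an approximation e of m with e (1 + g / 2) ≤ 1, while e ≥ 1 - 3 ε = 1 - g / 8.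
    log-liminf≮0 : ∀ {m v} → IsLiminf ρ m → IsLog m v → ∀ {g} → 0ℚ < g → g ≤ 1ℚ →
      Eventually (λ i → seq v i + g ≤ 0ℚ) → ⊥
    log-liminf≮0 {m} {v} inf log {g} 0<g g≤1 v<0 =
      let ε , 0<ε , 24ε≡g = fraction g 24 0<g
          K , approx = exp-approx {v} {m} log 0<ε
          B , 0≤B , bounded = eventually-bounded v
          k₀ , large = large-exists {B} {g} 1 0 0≤B 0<g
          k = K ℕ.⊔ k₀
          N , st = stable m 0<ε
          i , v<0 , v≤B , (_ , m≤) , N≤i = sample (v<0 and bounded and approx k (ℕ.m≤m⊔n K k₀) and (N , λ _ N≤i → N≤i))
          gap = exp-gap 1 0 k (<⇒≤ 0<g) 0≤B v≤B v≤B
            (subst₂ _≤_ (sym (cong (_+ g) (*-identityˡ (seq v i)))) (sym (*-zeroˡ (seq v i))) v<0)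
            (large k (ℕ.m≤n⊔m K k₀))
      in absurd {m = seq m i} {e = euler k (seq v i)} 0<g g≤1 0<ε 24ε≡g (1≤liminf {m} inf 0<ε st N≤i) m≤ gap
      where
      absurd : ∀ {g ε m e} → 0ℚ < g → g ≤ 1ℚ → 0ℚ < ε → ι 24 * ε ≡ g →
        1ℚ ≤ m + ι 2 * ε → m ≤ e + ε → e ^ 1 * (1ℚ + ½ * g) ≤ 1ℚ → ⊥
      absurd {g} {ε} {m} {e} 0<g g≤1 0<ε refl 1≤m m≤e gap = <-irrefl refl (<-≤-trans (*-pos 0<5 0<g) 5g≤0)
        where
        0<5 : 0ℚ < ι 5
        0<5 = positive⁻¹ (ι 5)
        lemma : ∀ ε m e → 0ℚ - ι 5 * (ι 24 * ε) ≡
          ι 16 * ((1ℚ - e * 1ℚ * (1ℚ + ½ * (ι 24 * ε))) + ((m + ι 2 * ε - 1ℚ) + (e + ε - m)) * (1ℚ + ½ * (ι 24 * ε)))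
            + (ι 24 * ε) * (1ℚ - ι 24 * ε)
        lemma = solve-∀ ring
        5g≤0 : ι 5 * g ≤ 0ℚ
        5g≤0 = q-p≡e⇒p≤q
          (0≤ι 16 ⊠ (p≤q⇒0≤q-p gap ⊞ (p≤q⇒0≤q-p 1≤m ⊞ p≤q⇒0≤q-p m≤e) ⊠ (0≤1 ⊞ 0≤½ ⊠ <⇒≤ 0<g))
            ⊞ <⇒≤ 0<g ⊠ p≤q⇒0≤q-p g≤1)
          (lemma ε m e)

    -- Rational stand-ins for M + ε and m - ε. For x = X / Y and Z = 2 X, `separated` expresses M <
    -- m^(2x) with integral exponents; the room 1 + τ will absorb constants.
    record ExponentialBounds (Y Z : ℕ) : Set where
      field
        upper lower τ : ℚ
        threshold     : ℕ
        1≤upper       : 1ℚ ≤ upper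
        1≤lower       : 1ℚ ≤ lower
        0<τ           : 0ℚ < τ
        separated     : upper ^ Y * (1ℚ + τ) ≤ lower ^ Z
        Q≤upper^      : ∀ ℓ → threshold ℕ.≤ ℓ → 1 ℕ.≤ ℓ → ι (Q ℓ) ≤ upper ^ ℓ
        lower^≤Q      : ∀ ℓ → threshold ℕ.≤ ℓ → 1 ℕ.≤ ℓ → lower ^ ℓ ≤ ι (Q ℓ)

    module _ {M m u v : ℝ} (sup : IsLimsup ρ M) (inf : IsLiminf ρ m) (logM : IsLog M u) (logm : IsLog m v)
             (Y Z : ℕ) .{{_ : ℕ.NonZero (Y ℕ.+ Z)}} {g : ℚ} (0<g : 0ℚ < g) (g≤1 : g ≤ 1ℚ) where

      exponential-bounds : Eventually (λ i → ι Y * seq u i + g ≤ ι Z * seq v i) →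
        Eventually (λ i → g ≤ seq v i) → ExponentialBounds Y Z
      exponential-bounds gap g≤v =
        -- The order of choice matters: ε from g, Y and Z, then Euler's index k, and last one index
        -- i at which all the eventual statements hold together.
        let ε , 0<ε , 24ε≡g = fraction g (24 ℕ.* (Y ℕ.+ Z)) {{ℕ.m*n≢0 24 (Y ℕ.+ Z)}} 0<g
            Kᵤ , approxᵤ = exp-approx {u} {M} logM 0<ε
            Kᵥ , approxᵥ = exp-approx {v} {m} logm 0<ε
            Bᵤ , 0≤Bᵤ , boundedᵤ = eventually-bounded u
            Bᵥ , 0≤Bᵥ , boundedᵥ = eventually-bounded v
            B = Bᵤ + Bᵥ
            0≤B = 0≤Bᵤ ⊞ 0≤Bᵥ
            k₁ , large₁ = large-exists {B} {g} Y Z 0≤B 0<g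
            k₂ , large₂ = large-exists {B} {g} 0 1 0≤B 0<g
            k = (Kᵤ ℕ.⊔ Kᵥ) ℕ.⊔ (k₁ ℕ.⊔ k₂)
            N₁ , stM = stable M 0<ε
            N₂ , stm = stable m 0<ε
            i , gapᵢ , g≤vᵢ , u≤B , v≤B , (_ , M≤) , (≤m , _) , N₁≤i , N₂≤i = sample
              (gap and g≤v and boundedᵤ and boundedᵥ
               and approxᵤ k (ℕ.≤-trans (ℕ.m≤m⊔n Kᵤ Kᵥ) (ℕ.m≤m⊔n _ (k₁ ℕ.⊔ k₂)))
               and approxᵥ k (ℕ.≤-trans (ℕ.m≤n⊔m Kᵤ Kᵥ) (ℕ.m≤m⊔n _ (k₁ ℕ.⊔ k₂)))
               and (N₁ , λ _ N₁≤i → N₁≤i) and (N₂ , λ _ N₂≤i → N₂≤i))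
            u≤B′ = ≤-trans u≤B (q-p≡e⇒p≤q 0≤Bᵥ (lemma₁ Bᵤ Bᵥ))
            v≤B′ = ≤-trans v≤B (q-p≡e⇒p≤q 0≤Bᵤ (lemma₂ Bᵤ Bᵥ))
            gap₁ = exp-gap Y Z k (<⇒≤ 0<g) 0≤B u≤B′ v≤B′ gapᵢ
              (large₁ k (ℕ.≤-trans (ℕ.m≤m⊔n k₁ k₂) (ℕ.m≤n⊔m (Kᵤ ℕ.⊔ Kᵥ) _)))
            -- Exponents 0 and 1 turn g ≤ v into the bound 1 + g / 2 for the approximation of m;
            -- this margin keeps `lower` at least 1.
            gap₂ = exp-gap 0 1 k (<⇒≤ 0<g) 0≤B v≤B′ v≤B′
              (subst₂ _≤_ (sym (lemma₃ (seq v i) g)) (sym (*-identityˡ (seq v i))) g≤vᵢ)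
              (large₂ k (ℕ.≤-trans (ℕ.m≤n⊔m k₁ k₂) (ℕ.m≤n⊔m (Kᵤ ℕ.⊔ Kᵥ) _)))
        in assemble (euler k (seq u i)) (euler k (seq v i)) 0<ε
             (trans (cong (_* ε) (sym (ι-* 24 (Y ℕ.+ Z)))) 24ε≡g)
             N₁≤i N₂≤i stM stm M≤ ≤m gap₁ gap₂
        where
        lemma₁ : ∀ p q → p + q - p ≡ q
        lemma₁ = solve-∀ ring
        lemma₂ : ∀ p q → p + q - q ≡ p
        lemma₂ = solve-∀ ring
        lemma₃ : ∀ v g → 0ℚ * v + g ≡ g
        lemma₃ = solve-∀ ring
        assemble : ∀ eᵤ eᵥ {ε i N₁ N₂} → 0ℚ < ε → ι 24 * ι (Y ℕ.+ Z) * ε ≡ g →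
          N₁ ℕ.≤ i → N₂ ℕ.≤ i → Stable M ε N₁ → Stable m ε N₂ →
          seq M i ≤ eᵤ + ε → eᵥ ≤ seq m i + ε →
          eᵤ ^ Y * (1ℚ + ½ * g) ≤ eᵥ ^ Z → eᵥ ^ 0 * (1ℚ + ½ * g) ≤ eᵥ ^ 1 → ExponentialBounds Y Z
        assemble eᵤ eᵥ {ε} {i} 0<ε 24ε≡g N₁≤i N₂≤i stM stm M≤ ≤m gap₁ gap₂ = record
          { upper     = M′
          ; lower     = m′
          ; τ         = ½ * ½ * g
          ; threshold = proj₁ above ℕ.⊔ proj₁ below
          ; 1≤upper   = 1≤M′
          ; 1≤lower   = 1≤m′
          ; 0<τ       = *-pos (*-pos 0<½ 0<½) 0<g
          ; separated = gap-stable Y Z (<⇒≤ 0<g) g≤1 (<⇒≤ 0<ε) 24ε≡g 3ε≤1 1≤M′ 1≤eᵥ M′≤ eᵥ≤ gap₁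
          ; Q≤upper^  = λ ℓ L≤ℓ 1≤ℓ → proj₂ (proj₂ above ℓ (ℕ.m⊔n≤o⇒m≤o (proj₁ above) (proj₁ below) L≤ℓ) 1≤ℓ)
          ; lower^≤Q  = λ ℓ L≤ℓ 1≤ℓ → proj₂ below ℓ (ℕ.m⊔n≤o⇒n≤o (proj₁ above) (proj₁ below) L≤ℓ) 1≤ℓ
          }
          where
          M′ m′ y : ℚ
          M′ = seq M i + ι 2 * ε
          m′ = seq m i - ι 2 * ε
          y  = ι (Y ℕ.+ Z)
          1≤y : 1ℚ ≤ y
          1≤y = ι-mono-≤ (ℕ.>-nonZero⁻¹ (Y ℕ.+ Z))
          above : ∃[ L ] (∀ ℓ → L ℕ.≤ ℓ → 1 ℕ.≤ ℓ → 1ℚ ≤ M′ × ι (Q ℓ) ≤ M′ ^ ℓ)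
          above = limsup-upper {M} sup 0<ε stM N₁≤i
          1≤M′ : 1ℚ ≤ M′
          1≤M′ = proj₁ (proj₂ above (suc (proj₁ above)) (ℕ.n≤1+n _) (ℕ.s≤s ℕ.z≤n))
          6ε≤g : ι 6 * ε ≤ g
          6ε≤g = q-p≡e⇒p≤q (0≤ι 24 ⊠ p≤q⇒0≤q-p 1≤y ⊠ <⇒≤ 0<ε ⊞ 0≤ι 18 ⊠ <⇒≤ 0<ε)
            (trans (cong (_- ι 6 * ε) (sym 24ε≡g)) (lemma y ε))
            where
            lemma : ∀ y ε → ι 24 * y * ε - ι 6 * ε ≡ ι 24 * (y - 1ℚ) * ε + ι 18 * ε
            lemma = solve-∀ ring
          3ε≤1 : ι 3 * ε ≤ 1ℚ
          3ε≤1 = q-p≡e⇒p≤q (p≤q⇒0≤q-p g≤1 ⊞ p≤q⇒0≤q-p 6ε≤g ⊞ 0≤ι 3 ⊠ <⇒≤ 0<ε) (lemma g ε)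
            where
            lemma : ∀ g ε → 1ℚ - ι 3 * ε ≡ 1ℚ - g + (g - ι 6 * ε) + ι 3 * ε
            lemma = solve-∀ ring
          1≤eᵥ : 1ℚ ≤ eᵥ
          1≤eᵥ = q-p≡e⇒p≤q (p≤q⇒0≤q-p gap₂ ⊞ 0≤½ ⊠ <⇒≤ 0<g) (lemma eᵥ g)
            where
            lemma : ∀ e g → e - 1ℚ ≡ e * 1ℚ - 1ℚ * (1ℚ + ½ * g) + ½ * g
            lemma = solve-∀ ring
          M′≤ : M′ ≤ eᵤ + ι 3 * ε
          M′≤ = q-p≡e⇒p≤q (p≤q⇒0≤q-p M≤) (lemma (seq M i) eᵤ ε)
            where
            lemma : ∀ M e ε → e + ι 3 * ε - (M + ι 2 * ε) ≡ e + ε - M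
            lemma = solve-∀ ring
          eᵥ≤ : eᵥ ≤ m′ + ι 3 * ε
          eᵥ≤ = q-p≡e⇒p≤q (p≤q⇒0≤q-p ≤m) (lemma (seq m i) eᵥ ε)
            where
            lemma : ∀ m e ε → m - ι 2 * ε + ι 3 * ε - e ≡ m + ε - e
            lemma = solve-∀ ring
          1≤m′ : 1ℚ ≤ m′
          1≤m′ = q-p≡e⇒p≤q (p≤q⇒0≤q-p eᵥ≤ ⊞ p≤q⇒0≤q-p gap₂ ⊞ 0≤½ ⊠ p≤q⇒0≤q-p 6ε≤g) (lemma m′ eᵥ g ε)
            where
            lemma : ∀ m e g ε → m - 1ℚ ≡
              m + ι 3 * ε - e + (e * 1ℚ - 1ℚ * (1ℚ + ½ * g)) + ½ * (g - ι 6 * ε)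
            lemma = solve-∀ ring
          below : ∃[ L ] (∀ ℓ → L ℕ.≤ ℓ → 1 ℕ.≤ ℓ → m′ ^ ℓ ≤ ι (Q ℓ))
          below = liminf-lower {m} inf 0<ε stm N₂≤i (1≤p⇒0≤p 1≤m′)

  -- Growth of the denominators

  ^-cancelʳ-≤ : ∀ m n Y .{{_ : ℕ.NonZero Y}} → m ℕ.^ Y ℕ.≤ n ℕ.^ Y → m ℕ.≤ n
  ^-cancelʳ-≤ m n Y h with m ℕ.≤? n
  ... | yes m≤n = m≤n
  ... | no m≰n = contradiction h (ℕ.<⇒≱ (ℕ.^-monoˡ-< Y (ℕ.≰⇒> m≰n)))

  -- q_r / q_s² → 0, uniformly over s ≥ x r. Both alternatives of the hypothesis are used through
  -- this condition.
  GrowsFast : (ℕ → ℕ) → ℚ → Set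
  GrowsFast Q x = ∀ C → ∃[ R ] (∀ r s → R ℕ.≤ r → x * ι r ≤ ι s → C ℕ.* Q r ℕ.≤ Q s ℕ.* Q s)

  module _ {Q : ℕ → ℕ} (1≤Q : ∀ ℓ → 1 ℕ.≤ Q ℓ) {ρ : ℕ → ℝ}
           (roots : ∀ ℓ → 1 ℕ.≤ ℓ → IsRoot ℓ (fromℕ (Q ℓ)) (ρ ℓ))
           {x : ℚ} (X Y : ℕ) (1≤X : 1 ℕ.≤ X) .{{_ : ℕ.NonZero Y}} (xY≡X : x * ι Y ≡ ι X) where

    -- Compare Y-th powers: q_r^Y is at most upper^(Y r), and lower^(2 X r) is at most q_s^(2 Y)
    -- because X r ≤ Y s. The quotient of the two bounds is at least (1 + τ)^r, which outgrows C^Y.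
    bounds⇒growsFast : ExponentialBounds 1≤Q roots Y (2 ℕ.* X) → GrowsFast Q x
    bounds⇒growsFast bounds C =
      let n , _ , 1≤nτ = 1≤n*ε 0<τ
      -- The first summand makes both r and s pass the threshold, as s Y ≥ X r ≥ r. The second gives
      -- (1 + τ)^r ≥ r τ ≥ C^Y.
      in suc threshold ℕ.* Y ℕ.+ C ℕ.^ Y ℕ.* n , λ r s R≤r xr≤s → grow n 1≤nτ r s
           (ℕ.≤-trans (ℕ.m≤m+n _ _) R≤r) (ℕ.≤-trans (ℕ.m≤n+m _ (suc threshold ℕ.* Y)) R≤r) xr≤s
      where
      open ExponentialBounds bounds
      grow : ∀ n → 1ℚ ≤ ι n * τ → ∀ r s → suc threshold ℕ.* Y ℕ.≤ r → C ℕ.^ Y ℕ.* n ℕ.≤ r →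
        x * ι r ≤ ι s → C ℕ.* Q r ℕ.≤ Q s ℕ.* Q s
      grow n 1≤nτ r s LY≤r Cn≤r xr≤s = ^-cancelʳ-≤ (C ℕ.* Q r) (Q s ℕ.* Q s) Y (ι-cancel-≤ (begin
        ι ((C ℕ.* Q r) ℕ.^ Y)
          ≡⟨ trans (ι-^ (C ℕ.* Q r) Y) (trans (cong (_^ Y) (ι-* C (Q r))) (^-distrib-* (ι C) (ι (Q r)) Y)) ⟩
        ι C ^ Y * ι (Q r) ^ Y
          ≤⟨ *-mono-≤ (0≤^ (0≤ι C) Y) (0≤^ (0≤ι (Q r)) Y) C^Y≤ (^-monoˡ-≤ Y (0≤ι (Q r)) (Q≤upper^ r L≤r 1≤r)) ⟩
        (1ℚ + τ) ^ r * (upper ^ r) ^ Y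
          ≡⟨ trans (*-comm ((1ℚ + τ) ^ r) ((upper ^ r) ^ Y)) (cong (_* (1ℚ + τ) ^ r) (^-swap upper r Y)) ⟩
        (upper ^ Y) ^ r * (1ℚ + τ) ^ r
          ≡⟨ ^-distrib-* (upper ^ Y) (1ℚ + τ) r ⟨
        (upper ^ Y * (1ℚ + τ)) ^ r
          ≤⟨ ^-monoˡ-≤ r (0≤^ (1≤p⇒0≤p 1≤upper) Y ⊠ 0≤1+τ) separated ⟩
        (lower ^ (2 ℕ.* X)) ^ r
          ≡⟨ ^-assocʳ lower (2 ℕ.* X) r ⟩
        lower ^ (2 ℕ.* X ℕ.* r)
          ≤⟨ ^-monoʳ-≤ 1≤lower 2Xr≤ ⟩
        lower ^ ((s ℕ.+ s) ℕ.* Y)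
          ≡⟨ ^-assocʳ lower (s ℕ.+ s) Y ⟨
        (lower ^ (s ℕ.+ s)) ^ Y
          ≡⟨ cong (_^ Y) (^-homo-* lower s s) ⟩
        (lower ^ s * lower ^ s) ^ Y
          ≤⟨ ^-monoˡ-≤ Y (0≤lower^s ⊠ 0≤lower^s)
               (*-mono-≤ 0≤lower^s 0≤lower^s (lower^≤Q s L≤s 1≤s) (lower^≤Q s L≤s 1≤s)) ⟩
        (ι (Q s) * ι (Q s)) ^ Y
          ≡⟨ trans (cong (_^ Y) (sym (ι-* (Q s) (Q s)))) (sym (ι-^ (Q s ℕ.* Q s) Y)) ⟩
        ι ((Q s ℕ.* Q s) ℕ.^ Y) ∎))
        where
        open ≤-Reasoning
        0≤lower^s : 0ℚ ≤ lower ^ s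
        0≤lower^s = 0≤^ (1≤p⇒0≤p 1≤lower) s
        0≤1+τ : 0ℚ ≤ 1ℚ + τ
        0≤1+τ = 0≤1 ⊞ <⇒≤ 0<τ
        L+1≤r : suc threshold ℕ.≤ r
        L+1≤r = ℕ.≤-trans (ℕ.m≤m*n (suc threshold) Y) LY≤r
        L≤r : threshold ℕ.≤ r
        L≤r = ℕ.≤-trans (ℕ.n≤1+n _) L+1≤r
        1≤r : 1 ℕ.≤ r
        1≤r = ℕ.≤-trans (ℕ.s≤s ℕ.z≤n) L+1≤r
        Xr≤sY : X ℕ.* r ℕ.≤ s ℕ.* Y
        Xr≤sY = ι-cancel-≤ (subst₂ _≤_
          (trans (rearrange x (ι r) (ι Y)) (trans (cong (_* ι r) xY≡X) (sym (ι-* X r))))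
          (sym (ι-* s Y))
          (*-monoʳ-≤-nonNeg (ι Y) {{nonNegative (0≤ι Y)}} xr≤s))
          where
          rearrange : ∀ x r Y → x * r * Y ≡ x * Y * r
          rearrange = solve-∀ ring
        L+1≤s : suc threshold ℕ.≤ s
        L+1≤s = ℕ.*-cancelʳ-≤ (suc threshold) s Y (ℕ.≤-trans LY≤r
          (ℕ.≤-trans (ℕ.≤-trans (ℕ.≤-reflexive (sym (ℕ.*-identityˡ r))) (ℕ.*-monoˡ-≤ r 1≤X)) Xr≤sY))
        L≤s : threshold ℕ.≤ s
        L≤s = ℕ.≤-trans (ℕ.n≤1+n _) L+1≤s
        1≤s : 1 ℕ.≤ s
        1≤s = ℕ.≤-trans (ℕ.s≤s ℕ.z≤n) L+1≤s
        2Xr≤ : 2 ℕ.* X ℕ.* r ℕ.≤ (s ℕ.+ s) ℕ.* Y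
        2Xr≤ = ℕ.≤-trans (ℕ.≤-reflexive (ℕ.*-assoc 2 X r))
          (ℕ.≤-trans (ℕ.*-monoʳ-≤ 2 Xr≤sY) (ℕ.≤-reflexive (lemma s Y)))
          where
          lemma : ∀ s Y → 2 ℕ.* (s ℕ.* Y) ≡ (s ℕ.+ s) ℕ.* Y
          lemma = ℕSolver.solve-∀
        C^Y≤ : ι C ^ Y ≤ (1ℚ + τ) ^ r
        C^Y≤ = begin
          ι C ^ Y                       ≡⟨ ι-^ C Y ⟨
          ι (C ℕ.^ Y)                   ≡⟨ *-identityʳ (ι (C ℕ.^ Y)) ⟨
          ι (C ℕ.^ Y) * 1ℚ              ≤⟨ *-monoˡ-≤-nonNeg (ι (C ℕ.^ Y)) {{nonNegative (0≤ι (C ℕ.^ Y))}} 1≤nτ ⟩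
          ι (C ℕ.^ Y) * (ι n * τ)       ≡⟨ *-assoc (ι (C ℕ.^ Y)) (ι n) τ ⟨
          ι (C ℕ.^ Y) * ι n * τ         ≡⟨ cong (_* τ) (ι-* (C ℕ.^ Y) n) ⟨
          ι (C ℕ.^ Y ℕ.* n) * τ         ≤⟨ *-monoʳ-≤-nonNeg τ {{nonNegative (<⇒≤ 0<τ)}} (ι-mono-≤ Cn≤r) ⟩
          ι r * τ                       ≤⟨ q-p≡e⇒p≤q 0≤1 (lemma (ι r * τ)) ⟩
          1ℚ + ι r * τ                  ≤⟨ bernoulli {τ} r 0≤1+τ ⟩
          (1ℚ + τ) ^ r                  ∎
          where
          lemma : ∀ p → 1ℚ + p - p ≡ 1ℚ
          lemma = solve-∀ ring

    -- 2 x v - u - ε g = 2 v (x - t / 2 - ε) + (t v + ε g - u) + 2 ε (v - g)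
    log-gap : ∀ {t u v} {ε g h} → 0ℚ < ε → 0ℚ < g → 0ℚ ≤ h → h ≤ ε * g →
      ½ * t + ε ≤ x → u ≤ t * v + ε * g → g ≤ v → ι Y * u + h ≤ ι (2 ℕ.* X) * v
    log-gap {t} {u} {v} {ε} {g} {h} 0<ε 0<g 0≤h h≤εg t<2x u≤tv g≤v = subst (ι Y * u + h ≤_) 2Xv≡
      (q-p≡e⇒p≤q
        (0≤ι Y ⊠ (0≤ι 2 ⊠ ≤-trans (<⇒≤ 0<g) g≤v ⊠ p≤q⇒0≤q-p t<2x ⊞ p≤q⇒0≤q-p u≤tv ⊞ 0≤ι 2 ⊠ <⇒≤ 0<ε ⊠ p≤q⇒0≤q-p g≤v)
          ⊞ 0≤ι Y ⊠ p≤q⇒0≤q-p h≤εg ⊞ p≤q⇒0≤q-p 1≤Y ⊠ 0≤h)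
        (lemma (ι Y) x t u v ε g h))
      where
      1≤Y : 1ℚ ≤ ι Y
      1≤Y = ι-mono-≤ (ℕ.>-nonZero⁻¹ Y)
      2Xv≡ : ι 2 * (x * ι Y) * v ≡ ι (2 ℕ.* X) * v
      2Xv≡ = cong (_* v) (trans (cong (ι 2 *_) xY≡X) (sym (ι-* 2 X)))
      lemma : ∀ Y x t u v ε g h → ι 2 * (x * Y) * v - (Y * u + h) ≡
        Y * (ι 2 * v * (x - (½ * t + ε)) + (t * v + ε * g - u) + ι 2 * ε * (v - g))
          + Y * (ε * g - h) + (Y - 1ℚ) * h
      lemma = solve-∀ ring

    module _ {M m t u v : ℝ} (sup : IsLimsup ρ M) (inf : IsLiminf ρ m)
             (logM : IsLog M u) (logm : IsLog m v) where

      private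
        v≮0 : (v ℝ.< fromℕ 0) → ⊥
        v≮0 (g , 0<g , N , v<0) = log-liminf≮0 1≤Q roots {m} {v} inf logm (⊓-pos 0<g 0<1) (p⊓q≤q g 1ℚ)
          (N , λ i N≤i → ≤-trans (+-monoʳ-≤ (seq v i) (p⊓q≤p g 1ℚ)) (v<0 i N≤i))

        instance
          Y+2X≢0 : ℕ.NonZero (Y ℕ.+ 2 ℕ.* X)
          Y+2X≢0 = ℕ.≢-nonZero λ Y+2X≡0 → ℕ.≢-nonZero⁻¹ Y (ℕ.m+n≡0⇒m≡0 Y Y+2X≡0)

        positive-case : ∀ {g ε} → 0ℚ < g → 0ℚ < ε → Eventually (λ i → g ≤ seq v i) →
          Eventually (λ i → ½ * seq t i + ε ≤ x) →
          Eventually (λ i → seq u i ≤ seq t i * seq v i + ε * g) → GrowsFast Q x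
        positive-case {g} {ε} 0<g 0<ε g≤v t<2x u≤tv = bounds⇒growsFast
          (exponential-bounds 1≤Q roots {M} {m} {u} {v} sup inf logM logm Y (2 ℕ.* X) 0<h h≤1
            (mapᵉ step (t<2x and u≤tv and g≤v)) (mapᵉ (≤-trans h≤g) g≤v))
          where
          -- The three members of the minimum meet `log-gap`, the lower bound on v, and the
          -- condition g ≤ 1 of `exponential-bounds`.
          h : ℚ
          h = (ε * g ⊓ g) ⊓ 1ℚ
          0<h : 0ℚ < h
          0<h = ⊓-pos (⊓-pos (*-pos 0<ε 0<g) 0<g) 0<1
          h≤1 : h ≤ 1ℚ
          h≤1 = p⊓q≤q (ε * g ⊓ g) 1ℚ
          h≤εg : h ≤ ε * g
          h≤εg = ≤-trans (p⊓q≤p (ε * g ⊓ g) 1ℚ) (p⊓q≤p (ε * g) g)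
          h≤g : h ≤ g
          h≤g = ≤-trans (p⊓q≤p (ε * g ⊓ g) 1ℚ) (p⊓q≤q (ε * g) g)
          step : ∀ {i} → ½ * seq t i + ε ≤ x × seq u i ≤ seq t i * seq v i + ε * g × g ≤ seq v i →
            ι Y * seq u i + h ≤ ι (2 ℕ.* X) * seq v i
          step {i} (t<2x , u≤tv , g≤v) =
            log-gap {seq t i} {seq u i} {seq v i} 0<ε 0<g (<⇒≤ 0<h) h≤εg t<2x u≤tv g≤v

        v>0⇒growsFast : (fromℕ 0 ℝ.< v) → (t ℝ.* v) ℝ.≃ u → (fromℚ ½ ℝ.* t) ℝ.< fromℚ x → GrowsFast Q x
        v>0⇒growsFast (g , 0<g , N , 0<v) tv≃u (ε , 0<ε , t<2x) = positive-case 0<g 0<ε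
          (N , λ i N≤i → subst (_≤ seq v i) (+-identityˡ g) (0<v i N≤i)) t<2x
          (≃⇒≤ᵉ {u} {t ℝ.* v} (ℝ-sym {t ℝ.* v} {u} tv≃u) (*-pos 0<ε 0<g))

      logs⇒growsFast : ℝ._≃_÷_ t u v → (fromℚ ½ ℝ.* t) ℝ.< fromℚ x → GrowsFast Q x
      logs⇒growsFast (inj₁ v<0 , _)    _    = ⊥-elim (v≮0 v<0)
      logs⇒growsFast (inj₂ 0<v , tv≃u) t<2x = v>0⇒growsFast 0<v tv≃u t<2x

  -- One factor Q s covers Q r, the other covers C as soon as r ≥ C.
  1≤x⇒growsFast : ∀ {Q x} → (∀ n → n ℕ.≤ Q n) → (∀ {m n} → m ℕ.≤ n → Q m ℕ.≤ Q n) →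
    1ℚ ≤ x → GrowsFast Q x
  1≤x⇒growsFast {Q} {x} n≤Q Q-mono 1≤x C = C , λ r s C≤r xr≤s →
    let r≤s = ι-cancel-≤ (≤-trans (≤-reflexive (sym (*-identityˡ (ι r))))
                (≤-trans (*-monoʳ-≤-nonNeg (ι r) {{nonNegative (0≤ι r)}} 1≤x) xr≤s))
    in ℕ.*-mono-≤ (ℕ.≤-trans C≤r (ℕ.≤-trans (n≤Q r) (Q-mono r≤s))) (Q-mono r≤s)

  -- Homographies

  0≤‖p‖ : ∀ p → 0ℚ ≤ ‖ p ‖ℚ
  0≤‖p‖ p = subst (0ℚ ≤_) (sym (proj₂ (‖z‖-attained p))) (0≤∣p∣ (p - fromℤ (proj₁ (‖z‖-attained p))))

  ‖‖-product-≤ : ∀ {q p r ε} m n → 0ℚ ≤ q → q * ∣ p - fromℤ m ∣ * ∣ r - fromℤ n ∣ ≤ ε →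
    q * ‖ p ‖ℚ * ‖ r ‖ℚ ≤ ε
  ‖‖-product-≤ {q} {p} {r} m n 0≤q h = ≤-trans
    (*-mono-≤ (0≤q ⊠ 0≤‖p‖ p) (0≤‖p‖ r) (*-mono-≤ 0≤q (0≤‖p‖ p) ≤-refl (‖y‖≤∣y-n∣ p m)) (‖y‖≤∣y-n∣ r n)) h

  ∣p-q∣≤ : ∀ {p q ε} → p ≤ q + ε → q - ε ≤ p → ∣ p - q ∣ ≤ ε
  ∣p-q∣≤ {p} {q} {ε} p≤ ≤p = ∣p∣≤q
    (q-p≡e⇒p≤q (p≤q⇒0≤q-p p≤) (lemma₁ p q ε)) (q-p≡e⇒p≤q (p≤q⇒0≤q-p ≤p) (lemma₂ p q ε))
    where
    lemma₁ : ∀ p q ε → ε - (p - q) ≡ q + ε - p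
    lemma₁ = solve-∀ ring
    lemma₂ : ∀ p q ε → ε - - (p - q) ≡ p - (q - ε)
    lemma₂ = solve-∀ ring

  #0⇒bounded-below : ∀ x → x ℝ.#0 → ∃[ G ] Eventually (λ i → 1ℚ ≤ ι G * ∣ seq x i ∣)
  #0⇒bounded-below x (inj₁ (δ , 0<δ , N , x<0)) = proj₁ (1≤n*ε 0<δ) , N , λ i N≤i →
    ≤-trans (proj₂ (proj₂ (1≤n*ε 0<δ))) (*-monoˡ-≤-nonNeg (ι G) {{nonNegative (0≤ι G)}}
      (≤-trans (q-p≡e⇒p≤q (p≤q⇒0≤q-p (x<0 i N≤i)) (lemma (seq x i) δ)) (-p≤∣p∣ (seq x i))))
    where
    G = proj₁ (1≤n*ε 0<δ)
    lemma : ∀ x δ → - x - δ ≡ 0ℚ - (x + δ)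
    lemma = solve-∀ ring
  #0⇒bounded-below x (inj₂ (δ , 0<δ , N , 0<x)) = proj₁ (1≤n*ε 0<δ) , N , λ i N≤i →
    ≤-trans (proj₂ (proj₂ (1≤n*ε 0<δ))) (*-monoˡ-≤-nonNeg (ι G) {{nonNegative (0≤ι G)}}
      (≤-trans (subst (_≤ seq x i) (+-identityˡ δ) (0<x i N≤i)) (p≤∣p∣ (seq x i))))
    where
    G = proj₁ (1≤n*ε 0<δ)

  module Homography (a b c d : ℤ) where

    Δ : ℤ
    Δ = a ℤ.* d ℤ.- b ℤ.* c

    -- For c ≠ 0 the polynomial identity behind `linear-form-bound` forces these values: the
    -- coefficient of X² gives v, and X = - d / c gives w = - c² P(- d / c). For c = 0 they still
    -- work: the multiple of P is 0, and the form expresses the linear dependence of 1, α and β.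
    formᵤ formᵥ formʷ : ℤ → ℤ → ℤ → ℤ
    formᵤ A B C = a ℤ.* c ℤ.* C ℤ.- b ℤ.* c ℤ.* B ℤ.+ b ℤ.* d ℤ.* A
    formᵥ A B C = Δ ℤ.* A
    formʷ A B C = ℤ.- (c ℤ.* c ℤ.* C ℤ.- c ℤ.* d ℤ.* B ℤ.+ d ℤ.* d ℤ.* A)

    -- One constant for all coefficient bounds, depending on the homography and not on the period.
    κ : ℕ
    κ = 1 ℕ.+ ℤ.∣ c ℤ.* Δ ∣ ℕ.+ ℤ.∣ Δ ∣ ℕ.+ (ℤ.∣ c ℤ.* c ∣ ℕ.+ ℤ.∣ c ℤ.* d ∣ ℕ.+ ℤ.∣ d ℤ.* d ∣)

    ∣cΔ∣≤κ : ℤ.∣ c ℤ.* Δ ∣ ℕ.≤ κ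
    ∣cΔ∣≤κ = ℕ.≤-trans (ℕ.m≤n+m _ 1) (ℕ.≤-trans (ℕ.m≤m+n _ ℤ.∣ Δ ∣) (ℕ.m≤m+n _ _))

    ∣Δ∣≤κ : ℤ.∣ Δ ∣ ℕ.≤ κ
    ∣Δ∣≤κ = ℕ.≤-trans (ℕ.m≤n+m _ (1 ℕ.+ ℤ.∣ c ℤ.* Δ ∣)) (ℕ.m≤m+n _ _)

    sum≤κ : ℤ.∣ c ℤ.* c ∣ ℕ.+ ℤ.∣ c ℤ.* d ∣ ℕ.+ ℤ.∣ d ℤ.* d ∣ ℕ.≤ κ
    sum≤κ = ℕ.m≤n+m _ (1 ℕ.+ ℤ.∣ c ℤ.* Δ ∣ ℕ.+ ℤ.∣ Δ ∣)

    private
      cast₃ : ∀ x y z → fromℤ (x ℤ.* y ℤ.* z) ≡ fromℤ x * fromℤ y * fromℤ z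
      cast₃ x y z = trans (fromℤ-* (x ℤ.* y) z) (cong (_* fromℤ z) (fromℤ-* x y))

      cast-sum : ∀ x y z → fromℤ (x ℤ.- y ℤ.+ z) ≡ fromℤ x - fromℤ y + fromℤ z
      cast-sum x y z = trans (fromℤ-+ (x ℤ.- y) z) (cong (_+ fromℤ z) (fromℤ-- x y))

    Δ-cast : fromℤ Δ ≡ fromℤ a * fromℤ d - fromℤ b * fromℤ c
    Δ-cast = trans (fromℤ-- (a ℤ.* d) (b ℤ.* c)) (cong₂ _-_ (fromℤ-* a d) (fromℤ-* b c))

    module _ (A B C : ℤ) where

      formᵤ-cast : fromℤ (formᵤ A B C) ≡
        fromℤ a * fromℤ c * fromℤ C - fromℤ b * fromℤ c * fromℤ B + fromℤ b * fromℤ d * fromℤ A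
      formᵤ-cast = trans (cast-sum (a ℤ.* c ℤ.* C) (b ℤ.* c ℤ.* B) (b ℤ.* d ℤ.* A))
        (cong₂ _+_ (cong₂ _-_ (cast₃ a c C) (cast₃ b c B)) (cast₃ b d A))

      formᵥ-cast : fromℤ (formᵥ A B C) ≡ (fromℤ a * fromℤ d - fromℤ b * fromℤ c) * fromℤ A
      formᵥ-cast = trans (fromℤ-* Δ A) (cong (_* fromℤ A) Δ-cast)

      formʷ-cast : fromℤ (formʷ A B C) ≡
        - (fromℤ c * fromℤ c * fromℤ C - fromℤ c * fromℤ d * fromℤ B + fromℤ d * fromℤ d * fromℤ A)
      formʷ-cast = trans (fromℤ-neg (c ℤ.* c ℤ.* C ℤ.- c ℤ.* d ℤ.* B ℤ.+ d ℤ.* d ℤ.* A))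
        (cong -_ (trans (cast-sum (c ℤ.* c ℤ.* C) (c ℤ.* d ℤ.* B) (d ℤ.* d ℤ.* A))
          (cong₂ _+_ (cong₂ _-_ (cast₃ c c C) (cast₃ c d B)) (cast₃ d d A))))

      module _ {q : ℕ} (A≤q : ℤ.∣ A ∣ ℕ.≤ q) (B≤q : ℤ.∣ B ∣ ℕ.≤ q) (C≤q : ℤ.∣ C ∣ ℕ.≤ q) where

        ∣formᵥ∣≤ : ℤ.∣ formᵥ A B C ∣ ℕ.≤ κ ℕ.* q
        ∣formᵥ∣≤ = ℕ.≤-trans (ℕ.≤-reflexive (ℤ.abs-* Δ A)) (ℕ.*-mono-≤ ∣Δ∣≤κ A≤q)

        ∣formʷ∣≤ : ℤ.∣ formʷ A B C ∣ ℕ.≤ κ ℕ.* q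
        ∣formʷ∣≤ = begin
          ℤ.∣ formʷ A B C ∣
            ≡⟨ ℤ.∣-i∣≡∣i∣ (c² ℤ.* C ℤ.- cd ℤ.* B ℤ.+ d² ℤ.* A) ⟩
          ℤ.∣ c² ℤ.* C ℤ.- cd ℤ.* B ℤ.+ d² ℤ.* A ∣
            ≤⟨ ℕ.≤-trans (ℤ.∣i+j∣≤∣i∣+∣j∣ (c² ℤ.* C ℤ.- cd ℤ.* B) (d² ℤ.* A))
                 (ℕ.+-monoˡ-≤ _ (ℤ.∣i-j∣≤∣i∣+∣j∣ (c² ℤ.* C) (cd ℤ.* B))) ⟩
          ℤ.∣ c² ℤ.* C ∣ ℕ.+ ℤ.∣ cd ℤ.* B ∣ ℕ.+ ℤ.∣ d² ℤ.* A ∣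
            ≡⟨ cong₂ ℕ._+_ (cong₂ ℕ._+_ (ℤ.abs-* c² C) (ℤ.abs-* cd B)) (ℤ.abs-* d² A) ⟩
          ℤ.∣ c² ∣ ℕ.* ℤ.∣ C ∣ ℕ.+ ℤ.∣ cd ∣ ℕ.* ℤ.∣ B ∣ ℕ.+ ℤ.∣ d² ∣ ℕ.* ℤ.∣ A ∣
            ≤⟨ ℕ.+-mono-≤ (ℕ.+-mono-≤ (ℕ.*-monoʳ-≤ ℤ.∣ c² ∣ C≤q) (ℕ.*-monoʳ-≤ ℤ.∣ cd ∣ B≤q)) (ℕ.*-monoʳ-≤ ℤ.∣ d² ∣ A≤q) ⟩
          ℤ.∣ c² ∣ ℕ.* q ℕ.+ ℤ.∣ cd ∣ ℕ.* q ℕ.+ ℤ.∣ d² ∣ ℕ.* q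
            ≡⟨ trans (cong (ℕ._+ ℤ.∣ d² ∣ ℕ.* q) (sym (ℕ.*-distribʳ-+ q ℤ.∣ c² ∣ ℤ.∣ cd ∣)))
                 (sym (ℕ.*-distribʳ-+ q (ℤ.∣ c² ∣ ℕ.+ ℤ.∣ cd ∣) ℤ.∣ d² ∣)) ⟩
          (ℤ.∣ c² ∣ ℕ.+ ℤ.∣ cd ∣ ℕ.+ ℤ.∣ d² ∣) ℕ.* q
            ≤⟨ ℕ.*-monoˡ-≤ q sum≤κ ⟩
          κ ℕ.* q ∎
          where
          open ℕ.≤-Reasoning
          c² = c ℤ.* c
          cd = c ℤ.* d
          d² = d ℤ.* d

  -- Here R = E q and ω = 1 / Q. By V ≤ κ q and the lower bound for Q, the first summand is at most
  -- q; the second is 4 κ q. So 1 + 4 κ ≤ E ε is what remains to ask.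
  parameters-small : ∀ {E q κ G V ω Q ε} → 0ℚ ≤ E → 0ℚ ≤ q → 0ℚ ≤ κ → 0ℚ ≤ G → 0ℚ ≤ ω →
    Q * ω ≡ 1ℚ → V ≤ κ * q → 1ℚ + ι 4 * κ ≤ E * ε →
    ι 2 * (E * E) * κ * (ι 4 * κ * G) * (q * q * q) ≤ Q →
    ι 2 * (E * q * (E * q * V) * (ι 4 * κ * G * q * ω)) + ι 4 * (κ * q) ≤ E * q * ε
  parameters-small {E} {q} {κ} {G} {V} {ω} {Q} {ε} 0≤E 0≤q 0≤κ 0≤G 0≤ω Qω≡1 V≤ E≥ Q≥ = q-p≡e⇒p≤q
    (0≤q ⊠ p≤q⇒0≤q-p E≥ ⊞ 0≤ι 2 ⊠ (0≤E ⊠ 0≤E) ⊠ (0≤q ⊠ 0≤q) ⊠ (0≤ι 4 ⊠ 0≤κ ⊠ 0≤G ⊠ 0≤q ⊠ 0≤ω) ⊠ p≤q⇒0≤q-p V≤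
      ⊞ 0≤q ⊠ 0≤ω ⊠ p≤q⇒0≤q-p Q≥)
    (trans (lemma E q κ G V ω Q ε) (trans (cong (λ t → e + q * (1ℚ - t)) Qω≡1) (vanish e q)))
    where
    e : ℚ
    e = q * (E * ε - (1ℚ + ι 4 * κ)) + ι 2 * (E * E) * (q * q) * (ι 4 * κ * G * q * ω) * (κ * q - V)
        + q * ω * (Q - ι 2 * (E * E) * κ * (ι 4 * κ * G) * (q * q * q))
    vanish : ∀ e q → e + q * (1ℚ - 1ℚ) ≡ e
    vanish = solve-∀ ring
    lemma : ∀ E q κ G V ω Q ε → E * q * ε - (ι 2 * (E * q * (E * q * V) * (ι 4 * κ * G * q * ω)) + ι 4 * (κ * q)) ≡
      q * (E * ε - (1ℚ + ι 4 * κ)) + ι 2 * (E * E) * (q * q) * (ι 4 * κ * G * q * ω) * (κ * q - V)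
        + q * ω * (Q - ι 2 * (E * E) * κ * (ι 4 * κ * G) * (q * q * q)) + q * (1ℚ - Q * ω)
    lemma = solve-∀ ring

  -- The linear form of one period and the resulting small product

  module _ {a : ℕ → ℕ} (a⁺ : PartialQuotients a) {α β : ℝ} (cf : α IsCF[ a , a⁺ ])
           (a′ b′ c′ d′ : ℤ) where

    open Homography a′ b′ c′ d′

    γ : ℝ
    γ = fromInt c′ ℝ.* α ℝ.+ fromInt d′

    private
      αᵢ βᵢ γᵢ : ℕ → ℚ
      αᵢ = seq α
      βᵢ = seq β
      γᵢ i = fromℤ c′ * αᵢ i + fromℤ d′

    module _ (Δ≢0 : Δ ≢ + 0) (βγ≃ : (β ℝ.* γ) ℝ.≃ (fromInt a′ ℝ.* α ℝ.+ fromInt b′))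
             {G : ℕ} (γ≥ : Eventually (λ i → 1ℚ ≤ ι G * ∣ γᵢ i ∣)) where

      -- The constant required by `parameters-small`: threshold q_r ≤ q_s² yields threshold q_r³ ≤
      -- (q_r q_s)² ≤ q_n².
      threshold : ℕ → ℕ
      threshold E = 2 ℕ.* (E ℕ.* E) ℕ.* κ ℕ.* (4 ℕ.* κ ℕ.* G)

      module Period (r′ s′ : ℕ) (periodic : AgreeUpTo (suc s′) (shift (suc r′) a) a) where

        r s n q q′ qₙ : ℕ
        r = suc r′
        s = suc s′
        n = s ℕ.+ r
        q = den a r
        q′ = den a r′
        qₙ = den a n

        A B C u v w : ℤ
        A = + q′
        B = + q ℤ.- + num a r′
        C = ℤ.- (+ num a r)
        u = formᵤ A B C
        v = formᵥ A B C
        w = formʷ A B C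

        A≤q : ℤ.∣ A ∣ ℕ.≤ q
        A≤q = den-≤-suc a⁺ r′

        B≤q : ℤ.∣ B ∣ ℕ.≤ q
        B≤q = ∣m-n∣≤o ℕ.≤-refl (ℕ.≤-trans (num≤den a⁺ r′) A≤q)

        C≤q : ℤ.∣ C ∣ ℕ.≤ q
        C≤q = ℕ.≤-trans (ℕ.≤-reflexive (ℤ.∣-i∣≡∣i∣ (+ num a r))) (num≤den a⁺ r)

        instance
          q≢0 : ℕ.NonZero q
          q≢0 = den-nonZero a⁺ r

          qₙ≢0 : ℕ.NonZero qₙ
          qₙ≢0 = den-nonZero a⁺ n

          -- v = Δ q_(r-1), and q_(r-1) is positive even for r = 1, since q_0 = 1.
          v≢0 : ℤ.NonZero v
          v≢0 = ℤ.i*j≢0 Δ A {{ℤ.≢-nonZero Δ≢0}} {{den-nonZero a⁺ r′}}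

        Q : ℚ
        Q = ι qₙ * ι qₙ

        1≤Q : 1ℚ ≤ Q
        1≤Q = *-mono-≤ 0≤1 0≤1 (ι-mono-≤ (1≤den a⁺ n)) (ι-mono-≤ (1≤den a⁺ n))

        0≤Q : 0ℚ ≤ Q
        0≤Q = 1≤p⇒0≤p 1≤Q

        P : ℚ → ℚ
        P z = fromℤ A * (z * z) + fromℤ B * z + fromℤ C

        P-convergent : ∀ K → ∣ P (convergent a a⁺ (K ℕ.+ n)) ∣ * Q ≤ ι 2 * ι q
        P-convergent K = subst₂ (λ b c → ∣ fromℤ A * (z * z) + b * z + c ∣ * Q ≤ ι 2 * ι q)
          (sym (fromℤ-- (+ q) (+ num a r′))) (sym (fromℤ-neg (+ num a r)))
          (fixedPoint-boundℚ a⁺ r′ s′ periodic K)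
          where z = convergent a a⁺ (K ℕ.+ n)

        -- ω = 1 / (4 q_n²) is the closeness to a convergent that `quadratic-perturb` demands.
        scale : ∃[ ω ] (0ℚ < ω × ι (4 ℕ.* (qₙ ℕ.* qₙ)) * ω ≡ 1ℚ)
        scale = fraction 1ℚ (4 ℕ.* (qₙ ℕ.* qₙ)) {{ℕ.m*n≢0 4 (qₙ ℕ.* qₙ) {{_}} {{ℕ.m*n≢0 qₙ qₙ}}}} 0<1

        ω : ℚ
        ω = proj₁ scale

        0<ω : 0ℚ < ω
        0<ω = proj₁ (proj₂ scale)

        4Qω≡1 : ι 4 * Q * ω ≡ 1ℚ
        4Qω≡1 = trans (cong (_* ω) (trans (cong (ι 4 *_) (sym (ι-* qₙ qₙ))) (sym (ι-* 4 (qₙ ℕ.* qₙ)))))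
          (proj₂ (proj₂ scale))

        -- A convergent beyond index n stands in for α: the fixed-point estimate applies to it, and
        -- the bare definition of the limit brings it within ω, without any rate of convergence.
        α-near-convergent : ∃[ K ] Eventually (λ i → ∣ αᵢ i - convergent a a⁺ (K ℕ.+ n) ∣ ≤ ω)
        α-near-convergent = K , mapᵉ (λ {i} → step {i})
            (<⇒≤ᵉ {α ℝ.+ ℝ.- fromℚ ω} {fromℚ c} (proj₁ close) and <⇒≤ᵉ {fromℚ c} {α ℝ.+ fromℚ ω} (proj₂ close))
          where
          K = proj₁ (cf ω 0<ω)
          c = convergent a a⁺ (K ℕ.+ n)
          close = proj₂ (cf ω 0<ω) (K ℕ.+ n) (ℕ.m≤m+n K n)
          step : ∀ {i} → αᵢ i - ω ≤ c × c ≤ αᵢ i + ω → ∣ αᵢ i - c ∣ ≤ ω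
          step {i} (≤c , c≤) = subst (_≤ ω) (∣p-q∣≡∣q-p∣ c (αᵢ i)) (∣p-q∣≤ c≤ ≤c)

        P-bound : Eventually (λ i → ∣ P (αᵢ i) ∣ * Q ≤ ι 3 * ι q)
        P-bound = mapᵉ (λ {i} → step {i}) (proj₂ α-near-convergent)
          where
          K = proj₁ α-near-convergent
          c = convergent a a⁺ (K ℕ.+ n)
          step : ∀ {i} → ∣ αᵢ i - c ∣ ≤ ω → ∣ P (αᵢ i) ∣ * Q ≤ ι 3 * ι q
          step {i} α≈c = quadratic-perturb {fromℤ A} {fromℤ B} {fromℤ C} {c} {αᵢ i}
            (subst (_≤ ι q) (fromℤ-∣∣ A) (ι-mono-≤ A≤q)) (subst (_≤ ι q) (fromℤ-∣∣ B) (ι-mono-≤ B≤q))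
            (0≤convergent a⁺ (K ℕ.+ n)) (convergent≤1 a⁺ (K ℕ.+ n)) 1≤Q (P-convergent K)
            (subst (ι 4 * Q * ∣ αᵢ i - c ∣ ≤_) 4Qω≡1
              (*-monoˡ-≤-nonNeg (ι 4 * Q) {{nonNegative (0≤ι 4 ⊠ 0≤Q)}} α≈c))

        -- The bound 4 κ G q / Q of `linear-form-bound`, with 4 ω for 1 / Q.
        δ : ℚ
        δ = ι 4 * ι κ * ι G * ι q * (ι 4 * ω)

        Q4ω≡1 : Q * (ι 4 * ω) ≡ 1ℚ
        Q4ω≡1 = trans (lemma Q ω) 4Qω≡1
          where
          lemma : ∀ Q ω → Q * (ι 4 * ω) ≡ ι 4 * Q * ω
          lemma = solve-∀ ring

        form-bound : Eventually (λ i → ∣ fromℤ u + fromℤ v * αᵢ i + fromℤ w * βᵢ i ∣ ≤ δ)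
        form-bound = mapᵉ (λ {i} → step {i}) (γ≥ and P-bound and
            (proj₁ (βγ≃ ω 0<ω) , λ i N≤i → <⇒≤ (proj₂ (βγ≃ ω 0<ω) i N≤i)))
          where
          Lᵢ : ℕ → ℚ
          Lᵢ i = fromℤ u + fromℤ v * αᵢ i + fromℤ w * βᵢ i
          unscale : ∀ {l} → l * Q ≤ ι 4 * ι κ * ι G * ι q → l ≤ δ
          unscale {l} h = subst (_≤ δ)
            (trans (*-assoc l Q (ι 4 * ω)) (trans (cong (l *_) Q4ω≡1) (*-identityʳ l)))
            (*-monoʳ-≤-nonNeg (ι 4 * ω) {{nonNegative (0≤ι 4 ⊠ <⇒≤ 0<ω)}} h)
          β-close : ∀ {e} → e ≤ ω → e * Q ≤ 1ℚ
          β-close {e} e≤ω = q-p≡e⇒p≤q (p≤q⇒0≤q-p e≤ω ⊠ 0≤Q ⊞ 0≤ι 3 ⊠ 0≤Q ⊠ <⇒≤ 0<ω)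
            (trans (cong (_- e * Q) (sym 4Qω≡1)) (lemma e Q ω))
            where
            lemma : ∀ e Q ω → ι 4 * Q * ω - e * Q ≡ (ω - e) * Q + ι 3 * Q * ω
            lemma = solve-∀ ring
          cΔ≤ : ∣ fromℤ c′ * (fromℤ a′ * fromℤ d′ - fromℤ b′ * fromℤ c′) ∣ ≤ ι κ
          cΔ≤ = subst (_≤ ι κ) (trans (fromℤ-∣∣ (c′ ℤ.* Δ))
            (cong ∣_∣ (trans (fromℤ-* c′ Δ) (cong (fromℤ c′ *_) Δ-cast)))) (ι-mono-≤ ∣cΔ∣≤κ)
          w≤ : ∣ fromℤ w ∣ ≤ ι κ * ι q
          w≤ = subst₂ _≤_ (fromℤ-∣∣ w) (ι-* κ q) (ι-mono-≤ (∣formʷ∣≤ A B C A≤q B≤q C≤q))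
          step : ∀ {i} → 1ℚ ≤ ι G * ∣ γᵢ i ∣ × ∣ P (αᵢ i) ∣ * Q ≤ ι 3 * ι q ×
            ∣ βᵢ i * γᵢ i - (fromℤ a′ * αᵢ i + fromℤ b′) ∣ ≤ ω → ∣ Lᵢ i ∣ ≤ δ
          step {i} (γ≥ , P≤ , β≈) = unscale (subst (λ l → ∣ l ∣ * Q ≤ ι 4 * ι κ * ι G * ι q)
            (sym (cong₂ (λ x y → x + y * βᵢ i)
              (cong₂ (λ x y → x + y * αᵢ i) (formᵤ-cast A B C) (formᵥ-cast A B C)) (formʷ-cast A B C)))
            (linear-form-bound {fromℤ A} {fromℤ B} {fromℤ C} {fromℤ a′} {fromℤ b′} {fromℤ c′} {fromℤ d′} {αᵢ i} {βᵢ i}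
              (0≤ι κ) (0≤ι G) 0≤Q cΔ≤ (subst (λ z → ∣ z ∣ ≤ ι κ * ι q) (formʷ-cast A B C) w≤) γ≥ P≤ (β-close β≈)))

        module _ (E : ℕ) .{{_ : ℕ.NonZero E}} {ε : ℚ} (E≥ : 1ℚ + ι 4 * ι κ ≤ ι E * ε)
                 (growth : threshold E ℕ.* q ℕ.≤ den a s ℕ.* den a s) where

          R V : ℕ
          R = E ℕ.* q
          V = ℤ.∣ v ∣

          instance
            R≢0 : ℕ.NonZero R
            R≢0 = ℕ.m*n≢0 E q

            RRV≢0 : ℕ.NonZero (R ℕ.* (R ℕ.* V))
            RRV≢0 = ℕ.m*n≢0 R (R ℕ.* V) {{R≢0}} {{ℕ.m*n≢0 R V}}

          Q≥ : ι 2 * (ι E * ι E) * ι κ * (ι 4 * ι κ * ι G) * (ι q * ι q * ι q) ≤ Q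
          Q≥ = subst₂ _≤_ cast (ι-* qₙ qₙ) (ι-mono-≤ (begin
            threshold E ℕ.* (q ℕ.* q ℕ.* q)           ≡⟨ regroup (threshold E) q ⟩
            q ℕ.* q ℕ.* (threshold E ℕ.* q)           ≤⟨ ℕ.*-monoʳ-≤ (q ℕ.* q) growth ⟩
            q ℕ.* q ℕ.* (den a s ℕ.* den a s)         ≡⟨ regroup₂ q (den a s) ⟩
            (q ℕ.* den a s) ℕ.* (q ℕ.* den a s)       ≤⟨ ℕ.*-mono-≤ q*qₛ≤qₙ q*qₛ≤qₙ ⟩
            qₙ ℕ.* qₙ                                 ∎))
            where
            open ℕ.≤-Reasoning
            q*qₛ≤qₙ = den-superMultiplicative a⁺ r′ s′ periodic
            regroup : ∀ t q → t ℕ.* (q ℕ.* q ℕ.* q) ≡ q ℕ.* q ℕ.* (t ℕ.* q)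
            regroup = ℕSolver.solve-∀
            regroup₂ : ∀ q p → q ℕ.* q ℕ.* (p ℕ.* p) ≡ (q ℕ.* p) ℕ.* (q ℕ.* p)
            regroup₂ = ℕSolver.solve-∀
            cast : ι (threshold E ℕ.* (q ℕ.* q ℕ.* q)) ≡
              ι 2 * (ι E * ι E) * ι κ * (ι 4 * ι κ * ι G) * (ι q * ι q * ι q)
            cast = trans (ι-* (threshold E) (q ℕ.* q ℕ.* q)) (cong₂ _*_
              (trans (ι-* (2 ℕ.* (E ℕ.* E) ℕ.* κ) (4 ℕ.* κ ℕ.* G)) (cong₂ _*_
                (trans (ι-* (2 ℕ.* (E ℕ.* E)) κ) (cong (_* ι κ) (trans (ι-* 2 (E ℕ.* E)) (cong (ι 2 *_) (ι-* E E)))))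
                (trans (ι-* (4 ℕ.* κ) G) (cong (_* ι G) (ι-* 4 κ)))))
              (trans (ι-* (q ℕ.* q) q) (cong (_* ι q) (ι-* q q))))

          small : ι 2 * (ι R * (ι R * ι V) * δ) + ι 4 * (ι κ * ι q) ≤ ι R * ε
          small = subst (λ ρ → ι 2 * (ρ * (ρ * ι V) * δ) + ι 4 * (ι κ * ι q) ≤ ρ * ε) (sym (ι-* E q))
            (parameters-small (0≤ι E) (0≤ι q) (0≤ι κ) (0≤ι G) (0≤ι 4 ⊠ <⇒≤ 0<ω) Q4ω≡1
              (subst (ι V ≤_) (ι-* κ q) (ι-mono-≤ (∣formᵥ∣≤ A B C A≤q B≤q C≤q))) E≥ Q≥)

          small-product : ∃[ N ] (1 ℕ.≤ N ×
            Eventually (λ i → ι N * ‖ ι N * αᵢ i ‖ℚ * ‖ ι N * βᵢ i ‖ℚ ≤ ε))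
          small-product =
            -- θ = 1 / (R² V): replacing β by its term y then moves q β by at most 1 / R for every q
            -- ≤ R V, hence for the N found afterwards.
            let θ , 0<θ , θ≡ = fraction 1ℚ (R ℕ.* (R ℕ.* V)) 0<1
                I , st = stable β 0<θ
                y = βᵢ I
                N , p₁ , p₂ , 1≤N , N≤ , approx , relation = dirichlet-congruenceℚ y u v w R
            in N , 1≤N , mapᵉ (λ {i} (form≤ , I≤i) → ‖‖-product-≤ {ι N} {ι N * αᵢ i} {ι N * βᵢ i} p₁ p₂ (0≤ι N)
                 (product-bound {fromℤ u} {fromℤ v} {fromℤ w} {fromℤ p₁} {fromℤ p₂} {αᵢ i} {βᵢ i} {y}
                   (1≤⇒0< (ι-mono-≤ (ℕ.>-nonZero⁻¹ R))) (sym (fromℤ-∣∣ v))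
                   (subst₂ _≤_ (fromℤ-∣∣ w) (ι-* κ q) (ι-mono-≤ (∣formʷ∣≤ A B C A≤q B≤q C≤q)))
                   (0≤ι N) (subst (ι N ≤_) (ι-* R V) (ι-mono-≤ N≤)) approx
                   (β-close θ≡ (st i I I≤i ℕ.≤-refl)) form≤ relation small))
               (form-bound and (I , λ _ I≤i → I≤i))
            where
            β-close : ∀ {θ t} → ι (R ℕ.* (R ℕ.* V)) * θ ≡ 1ℚ → t ≤ θ → ι R * (ι R * ι V) * t ≤ 1ℚ
            β-close {θ} {t} θ≡ t≤θ = subst₂ _≤_ (cong (_* t) cast) θ≡
              (*-monoˡ-≤-nonNeg (ι (R ℕ.* (R ℕ.* V))) {{nonNegative (0≤ι (R ℕ.* (R ℕ.* V)))}} t≤θ)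
              where
              cast : ι (R ℕ.* (R ℕ.* V)) ≡ ι R * (ι R * ι V)
              cast = trans (ι-* R (R ℕ.* V)) (cong (ι R *_) (ι-* R V))

      small-product : ∀ {x} → 0ℚ < x → GrowsFast (den a) x →
        (U : ℕ → List ℕ) → (∀ k → 1 ℕ.≤ k → a BeginsWith (U k ++ U k ^ʷ x)) →
        (∀ k → 1 ℕ.≤ k → length (U k) ℕ.< length (U (suc k))) →
        ∀ {ε} → 0ℚ < ε → ∃[ N ] (1 ℕ.≤ N ×
          Eventually (λ i → ι N * ‖ ι N * αᵢ i ‖ℚ * ‖ ι N * βᵢ i ‖ℚ ≤ ε))
      small-product {x} 0<x growsFast U begins longer {ε} 0<ε =
        let n , 1≤n , 1≤nε = 1≤n*ε 0<ε
            -- Since n ε ≥ 1, this gives E ε ≥ 1 + 4 κ.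
            E = (1 ℕ.+ 4 ℕ.* κ) ℕ.* n
            R , growth = growsFast (threshold E)
            -- Lengths increase from U_1 on and U_1 may be empty, so |U_(j+1)| ≥ j is all that is
            -- known. Index R + 2 gives a length above R, in particular a positive one.
            k = suc (suc R)
            r = length (U k)
            s = length (U k ^ʷ x)
            R<r = length-U (suc R)
            xr≤s = x*length≤length-^ʷ (U k) x 0<x
        in from-period r s E {{ℕ.m*n≢0 (1 ℕ.+ 4 ℕ.* κ) n {{_}} {{ℕ.>-nonZero 1≤n}}}}
             (ℕ.≤-trans (ℕ.s≤s ℕ.z≤n) R<r) (1≤s r s (ℕ.≤-trans (ℕ.s≤s ℕ.z≤n) R<r) xr≤s)
             (beginsWith⇒periodic (U k) x (begins k (ℕ.s≤s ℕ.z≤n))) (E≥ n 1≤nε)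
             (growth r s (ℕ.≤-trans (ℕ.n≤1+n R) R<r) xr≤s)
        where
        length-U : ∀ k → k ℕ.≤ length (U (suc k))
        length-U zero    = ℕ.z≤n
        length-U (suc k) = ℕ.≤-trans (ℕ.s≤s (length-U k)) (longer (suc k) (ℕ.s≤s ℕ.z≤n))
        1≤s : ∀ r s → 1 ℕ.≤ r → x * ι r ≤ ι s → 1 ℕ.≤ s
        1≤s r (suc s) _ _ = ℕ.s≤s ℕ.z≤n
        1≤s r zero 1≤r xr≤0 = contradiction
          (<-≤-trans (*-pos 0<x (1≤⇒0< (ι-mono-≤ 1≤r))) xr≤0) (<-irrefl refl)
        E≥ : ∀ n → 1ℚ ≤ ι n * ε → 1ℚ + ι 4 * ι κ ≤ ι ((1 ℕ.+ 4 ℕ.* κ) ℕ.* n) * ε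
        E≥ n 1≤nε = subst₂ _≤_
          (trans (*-identityʳ _) (trans (ι-+ 1 (4 ℕ.* κ)) (cong (λ t → 1ℚ + t) (ι-* 4 κ))))
          (trans (sym (*-assoc (ι (1 ℕ.+ 4 ℕ.* κ)) (ι n) ε)) (cong (_* ε) (sym (ι-* (1 ℕ.+ 4 ℕ.* κ) n))))
          (*-monoˡ-≤-nonNeg (ι (1 ℕ.+ 4 ℕ.* κ)) {{nonNegative (0≤ι (1 ℕ.+ 4 ℕ.* κ))}} 1≤nε)
        from-period : ∀ r s E .{{_ : ℕ.NonZero E}} → 1 ℕ.≤ r → 1 ℕ.≤ s → AgreeUpTo s (shift r a) a →
          1ℚ + ι 4 * ι κ ≤ ι E * ε → threshold E ℕ.* den a r ℕ.≤ den a s ℕ.* den a s →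
          ∃[ N ] (1 ℕ.≤ N × Eventually (λ i → ι N * ‖ ι N * αᵢ i ‖ℚ * ‖ ι N * βᵢ i ‖ℚ ≤ ε))
        from-period (suc r′) (suc s′) E _ _ periodic E≥ growth =
          Period.small-product r′ s′ periodic E E≥ growth

    homography⇒inf≡0 : ∀ {x} → 0ℚ < x → GrowsFast (den a) x →
      (U : ℕ → List ℕ) → (∀ k → 1 ℕ.≤ k → a BeginsWith (U k ++ U k ^ʷ x)) →
      (∀ k → 1 ℕ.≤ k → length (U k) ℕ.< length (U (suc k))) →
      Δ ≢ + 0 → γ ℝ.#0 → (β ℝ.* γ) ℝ.≃ (fromInt a′ ℝ.* α ℝ.+ fromInt b′) →
      IsInf≥1 (λ q → fromℕ q ℝ.* ‖ fromℕ q ℝ.* α ‖ ℝ.* ‖ fromℕ q ℝ.* β ‖) (fromℕ 0)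
    homography⇒inf≡0 0<x growsFast U begins longer Δ≢0 γ#0 βγ≃ =
        (λ q _ ε 0<ε → 0 , λ i _ → 0≤ι q ⊠ 0≤‖p‖ (ι q * αᵢ i) ⊠ 0≤‖p‖ (ι q * βᵢ i) ⊞ <⇒≤ 0<ε)
      -- Strict inequality of reals needs a rational margin: one half of ε bounds the product, the
      -- other half is the margin.
      , λ ε 0<ε → let N , 1≤N , I , small = small-product Δ≢0 βγ≃ (proj₂ (#0⇒bounded-below γ γ#0))
                                              0<x growsFast U begins longer {½ * ε} (*-pos 0<½ 0<ε)
        in N , 1≤N , ½ * ε , *-pos 0<½ 0<ε , I , λ i I≤i →
           halves {ι N * ‖ ι N * αᵢ i ‖ℚ * ‖ ι N * βᵢ i ‖ℚ} {ε} (small i I≤i)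
      where
      halves : ∀ {p ε} → p ≤ ½ * ε → p + ½ * ε ≤ 0ℚ + ε
      halves {p} {ε} p≤ = q-p≡e⇒p≤q (p≤q⇒0≤q-p p≤) (lemma p ε)
        where
        lemma : ∀ p ε → 0ℚ + ε - (p + ½ * ε) ≡ ½ * ε - p
        lemma = solve-∀ ring

  positive⇒↥ : ∀ x → 0ℚ < x → ∃[ X ] (1 ℕ.≤ X × ↥ x ≡ + X)
  positive⇒↥ (mkℚ (+ suc n) _ _)  _           = suc n , ℕ.s≤s ℕ.z≤n , refl
  positive⇒↥ (mkℚ (+ 0) _ _)      (*<* (ℤ.+<+ ()))
  positive⇒↥ (mkℚ -[1+ _ ] _ _)   (*<* ())

-- Deduction of the growth condition from either hypothesis, and conclusion

open import Data.Nat using (NonZero)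
open import Data.Rational.Literals using (fromℤ)
open import Defs

theorem4 : (a : ℕ → ℕ) (a⁺ : PartialQuotients a) (α : ℝ) →
    α IsCF[ a , a⁺ ] →
    Bad α →
    (x : ℚ) → 0ℚ ℚ.< x →
    (U : ℕ → List ℕ) →
    (∀ k → 1 ℕ.≤ k → All NonZero (U k)) →
    (∀ k → 1 ℕ.≤ k → a BeginsWith (U k ++ U k ^ʷ x)) →
    (∀ k → 1 ℕ.≤ k → length (U k) ℕ.< length (U (suc k))) →
    (1ℚ ℚ.≤ x) ⊎
    (∃[ ρ ] ∃[ M ] ∃[ m ] ∃[ t ]
    ((∀ ℓ → 1 ℕ.≤ ℓ → IsRoot ℓ (fromℕ (den a ℓ)) (ρ ℓ)) ×
    IsLimsup ρ M × IsLiminf ρ m ×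
    IsLogRatio M m t × fromℚ ½ * t < fromℚ x)) →
    (β : ℝ) → β IsHomographyOf α →
    IsInf≥1 (λ q → fromℕ q * ‖ fromℕ q * α ‖ * ‖ fromℕ q * β ‖) (fromℕ 0)
theorem4 a a⁺ α cf _ x 0<x U _ begins longer hyp β (a′ , b′ , c′ , d′ , Δ≢0 , γ#0 , βγ≃) =
  Approximation.homography⇒inf≡0 a⁺ {α} {β} cf a′ b′ c′ d′ 0<x (growsFast hyp) U begins longer Δ≢0 γ#0 βγ≃
  where
  open Approximation using (GrowsFast; 1≤x⇒growsFast; logs⇒growsFast; positive⇒↥; q*↧q≡↥q)
  growsFast : (1ℚ ℚ.≤ x) ⊎
    (∃[ ρ ] ∃[ M ] ∃[ m ] ∃[ t ]
    ((∀ ℓ → 1 ℕ.≤ ℓ → IsRoot ℓ (fromℕ (den a ℓ)) (ρ ℓ)) ×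
    IsLimsup ρ M × IsLiminf ρ m ×
    IsLogRatio M m t × fromℚ ½ * t < fromℚ x)) → GrowsFast (den a) x
  growsFast (inj₁ 1≤x) = 1≤x⇒growsFast (Continuants.n≤den a⁺) (Continuants.den-mono-≤ a⁺) 1≤x
  growsFast (inj₂ (ρ , M , m , t , roots , sup , inf , (u , v , logM , logm , t≃u÷v) , ½t<x)) =
    -- Numerator and denominator of x become the integral exponents in M^Y < m^(2X).
    let X , 1≤X , ↥x≡X = positive⇒↥ x 0<x
    in logs⇒growsFast (Continuants.1≤den a⁺) roots X (ℚ.↧ₙ x) 1≤X
         (trans (q*↧q≡↥q x) (cong fromℤ ↥x≡X)) {M} {m} {t} {u} {v} sup inf logM logm t≃u÷v ½t<x
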